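{- Let $G$ be the $xy$-sum of connected graphs $G_1,G_2\in\mathcal G_{xy}^\circ$. If (i) $G_1\in\mathcal C_0^\circ(\widehat g^+)$ and (ii) $G_2\in\mathcal C_1^\circ(\widehat g^+)$, then $G\in\mathcal C_2^\circ(\widehat g^+)$. Conversely, every 2-connected graph $G\in\mathcal C_2^\circ(\widehat g^+)$ such that $\{x,y\}$ is a 2-vertex-cut is the $xy$-sum of connected graphs $G_1,G_2\in\mathcal G_{xy}^\circ$ satisfying (i) and (ii).
   Context: All graphs are finite and simple; after contracting an edge, parallel edges are replaced by single edges. The Euler genus $\widehat g(G)$ is the minimum Euler genus of a surface into which $G$ embeds. $\mathcal G_{xy}$ is the class of simple graphs with two distinguished vertices $x,y$ (terminals); $\mathcal G_{xy}^\circ$ the subclass with $x,y$ non-adjacent. The set $\mathcal M(G)$ of minor-operations consists of deletion of any edge and contraction of any edge other than $xy$ (contracting an edge incident with a terminal yields a terminal); $\mu G$ is the result. $G^+$ is $G$ with edge $xy$ added and $\widehat g^+(G)=\widehat g(G^+)$. For $G_1,G_2\in\mathcal G_{xy}$ with $V(G_1)\cap V(G_2)=\{x,y\}$, their $xy$-sum has vertex set $V(G_1)\cup V(G_2)$, edge set $E(G_1)\cup E(G_2)$ and terminals $x,y$. $G$ is $\widehat g^+$-critical if $\widehat g^+(\mu G)<\widehat g^+(G)$ for every $\mu\in\mathcal M(G)$; $\mathcal C_k^\circ(\widehat g^+)$ is the class of $\widehat g^+$-critical graphs $G\in\mathcal G_{xy}^\circ$ with $\widehat g^+(G)=k+1$.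 -}

module Defs where

open import Data.Bool using (Bool; true; false; _∧_; _∨_; not; if_then_else_)
open import Data.Nat using (ℕ; zero; suc; _+_; _*_; _≤_; _<_; ⌊_/2⌋; _<ᵇ_)
open import Data.Fin using (Fin; toℕ; _≟_)
open import Data.List using (List; []; _∷_; length; lookup; allFin; concatMap)
open import Data.Bool.ListAction using (any; all)
open import Data.Product using (Σ; _×_; _,_; ∃; ∃-syntax)
open import Data.Sum using (_⊎_)
open import Data.Empty using (⊥)
open import Relation.Nullary using (¬_; does)
open import Relation.Binary.PropositionalEquality using (_≡_; _≢_)
open import Relation.Binary.Construct.Closure.ReflexiveTransitive using (Star)
open import Function.Bundles using (_⇔_)
open import Function.Definitions using (Injective; Surjective)

_==_ : {n : ℕ} → Fin n → Fin n → Bool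
a == b = does (a ≟ b)

boolEq : Bool → Bool → Bool
boolEq true  b = b
boolEq false b = not b

countB : {A : Set} → (A → Bool) → List A → ℕ
countB p []       = 0
countB p (a ∷ as) = if p a then suc (countB p as) else countB p as

sumL : {A : Set} → (A → ℕ) → List A → ℕ
sumL f []       = 0
sumL f (a ∷ as) = f a + sumL f as

iter : {A : Set} → (A → A) → ℕ → A → A
iter f zero    a = a
iter f (suc i) a = f (iter f i a)

reachB : (m : ℕ) → (Fin m → Fin m → Bool) → ℕ → Fin m → Fin m → Bool
reachB m R zero    i j = i == j
reachB m R (suc k) i j =
  reachB m R k i j ∨ any (λ w → reachB m R k i w ∧ (R w j ∨ R j w)) (allFin m)

-- number of connected components of the (symmetrised) Boolean graph R on Fin m:
-- the number of vertices that are the least (in Fin order) of their component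
compsFin : (m : ℕ) → (Fin m → Fin m → Bool) → ℕ
compsFin m R =
  countB (λ i → all (λ j → not ((toℕ j <ᵇ toℕ i) ∧ reachB m R m i j)) (allFin m)) (allFin m)

-- Finite simple graphs on vertex set Fin n.
-- The raw Boolean relation 'adj' is read as a simple graph through 'E':
-- u and v are adjacent iff u ≠ v and (adj u v or adj v u).

record Graph : Set where
  field
    n   : ℕ
    adj : Fin n → Fin n → Bool

open Graph public

E : (G : Graph) → Fin (n G) → Fin (n G) → Bool
E G u v = not (u == v) ∧ (adj G u v ∨ adj G v u)

numEdges : Graph → ℕ
numEdges G = ⌊ sumL (λ u → countB (E G u) (allFin (n G))) (allFin (n G)) /2⌋

numComps : Graph → ℕ
numComps G = compsFin (n G) (E G)

-- Combinatorial embeddings (embedding schemes = rotation system + signature),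
-- and Euler genus (Mohar–Thomassen, Ch. 3–4).

-- rot v is a cyclic permutation of the neighbourhood of v
IsRotation : (G : Graph) → (Fin (n G) → Fin (n G) → Fin (n G)) → Set
IsRotation G rot = ∀ v →
  (∀ u → E G v u ≡ true → E G v (rot v u) ≡ true) ×
  (∀ u w → E G v u ≡ true → E G v w ≡ true → ∃[ i ] iter (rot v) i u ≡ w)

Flag : Graph → Set
Flag G = Fin (n G) × Fin (n G) × Bool

-- flags (v , u , b): corner at v of the edge vu, on the side towards
-- rot v u (b = true) or towards rot⁻¹ v u (b = false)
flags : (G : Graph) → List (Flag G)
flags G = concatMap (λ v → concatMap (λ u →
  if E G v u then (v , u , true) ∷ (v , u , false) ∷ [] else [])
  (allFin (n G))) (allFin (n G))

positive : (G : Graph) → (Fin (n G) → Fin (n G) → Bool) → Fin (n G) → Fin (n G) → Bool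
positive G sig u v = sig u v ∧ sig v u

-- two flags are related if they differ by the vertex-changing involution
-- or by the edge-changing involution; faces are the resulting orbits
faceAdj : (G : Graph) → (rot : Fin (n G) → Fin (n G) → Fin (n G)) →
          (sig : Fin (n G) → Fin (n G) → Bool) → Flag G → Flag G → Bool
faceAdj G rot sig (v , u , b) (v' , u' , b') =
  (v' == u ∧ u' == v ∧ boolEq b' (if positive G sig v u then not b else b))
  ∨ (v' == v ∧ b ∧ not b' ∧ u' == rot v u)

isolated : (G : Graph) → Fin (n G) → Bool
isolated G v = not (any (E G v) (allFin (n G)))

-- number of faces of the embedding (an isolated vertex contributes one face)
numFaces : (G : Graph) → (rot : Fin (n G) → Fin (n G) → Fin (n G)) →
           (sig : Fin (n G) → Fin (n G) → Bool) → ℕ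
numFaces G rot sig =
  compsFin (length (flags G))
    (λ i j → faceAdj G rot sig (lookup (flags G) i) (lookup (flags G) j))
  + countB (isolated G) (allFin (n G))

-- G embeds in a surface of Euler genus at most k:
-- Euler genus of the embedding = 2c - V + E - F ≤ k
EmbedsIn : Graph → ℕ → Set
EmbedsIn G k =
  Σ (Fin (n G) → Fin (n G) → Fin (n G)) λ rot → IsRotation G rot ×
  Σ (Fin (n G) → Fin (n G) → Bool) λ sig →
    2 * numComps G + numEdges G ≤ k + n G + numFaces G rot sig

EulerGenus : Graph → ℕ → Set
EulerGenus G k = EmbedsIn G k × (∀ j → EmbedsIn G j → k ≤ j)

record TGraph : Set where
  field
    graph : Graph
    x     : Fin (n graph)
    y     : Fin (n graph)
    x≢y   : x ≢ y

open TGraph public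

V : TGraph → ℕ
V G = n (graph G)

Adj : (G : TGraph) → Fin (V G) → Fin (V G) → Set
Adj G u v = E (graph G) u v ≡ true

NonAdjTerminals : TGraph → Set
NonAdjTerminals G = ¬ Adj G (x G) (y G)

plus : TGraph → Graph
plus G = record { n = V G
                ; adj = λ a b → adj (graph G) a b ∨ (a == x G ∧ b == y G) }

EulerGenusPlus : TGraph → ℕ → Set
EulerGenusPlus G k = EulerGenus (plus G) k

-- Minor operations (the result is given up to isomorphism via φ)

IsTerminalEdge : (G : TGraph) → Fin (V G) → Fin (V G) → Set
IsTerminalEdge G u v = (u ≡ x G × v ≡ y G) ⊎ (u ≡ y G × v ≡ x G)

DeleteEdge : (G H : TGraph) → Fin (V G) → Fin (V G) → Set
DeleteEdge G H u v = Adj G u v ×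
  Σ (Fin (V G) → Fin (V H)) λ φ →
    Injective _≡_ _≡_ φ × Surjective _≡_ _≡_ φ ×
    φ (x G) ≡ x H × φ (y G) ≡ y H ×
    (∀ a b → Adj H (φ a) (φ b) ⇔
       (Adj G a b × ¬ ((a ≡ u × b ≡ v) ⊎ (a ≡ v × b ≡ u))))

ContractEdge : (G H : TGraph) → Fin (V G) → Fin (V G) → Set
ContractEdge G H u v = Adj G u v × ¬ IsTerminalEdge G u v ×
  Σ (Fin (V G) → Fin (V H)) λ φ →
    Surjective _≡_ _≡_ φ ×
    φ (x G) ≡ x H × φ (y G) ≡ y H ×
    (∀ a b → φ a ≡ φ b ⇔ (a ≡ b ⊎ (a ≡ u × b ≡ v) ⊎ (a ≡ v × b ≡ u))) ×
    (∀ a' b' → Adj H a' b' ⇔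
       (a' ≢ b' × ∃[ a ] ∃[ b ] (φ a ≡ a' × φ b ≡ b' × Adj G a b)))

MinorOp : TGraph → TGraph → Set
MinorOp G H = ∃[ u ] ∃[ v ] (DeleteEdge G H u v ⊎ ContractEdge G H u v)

Critical : TGraph → Set
Critical G = ∀ H → MinorOp G H →
  ∀ a b → EulerGenusPlus H a → EulerGenusPlus G b → a < b

InC° : ℕ → TGraph → Set
InC° k G = NonAdjTerminals G × Critical G × EulerGenusPlus G (suc k)

ConnectedAvoiding : (G : TGraph) → (Fin (V G) → Bool) → Set
ConnectedAvoiding G S = ∀ u v → S u ≡ false → S v ≡ false →
  Star (λ a b → Adj G a b × S a ≡ false × S b ≡ false) u v

Connected : TGraph → Set
Connected G = ConnectedAvoiding G (λ _ → false)

TwoConnected : TGraph → Set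
TwoConnected G = 3 ≤ V G × ∀ w → ConnectedAvoiding G (λ a → a == w)

TerminalsCut : TGraph → Set
TerminalsCut G = ¬ ConnectedAvoiding G (λ a → a == x G ∨ a == y G)

IsXYSum : (G G₁ G₂ : TGraph) → Set
IsXYSum G G₁ G₂ =
  Σ (Fin (V G₁) → Fin (V G)) λ f₁ → Σ (Fin (V G₂) → Fin (V G)) λ f₂ →
    Injective _≡_ _≡_ f₁ × Injective _≡_ _≡_ f₂ ×
    f₁ (x G₁) ≡ x G × f₁ (y G₁) ≡ y G × f₂ (x G₂) ≡ x G × f₂ (y G₂) ≡ y G ×
    (∀ v → (∃[ a ] f₁ a ≡ v) ⊎ (∃[ b ] f₂ b ≡ v)) ×
    (∀ a b → f₁ a ≡ f₂ b → (a ≡ x G₁ × b ≡ x G₂) ⊎ (a ≡ y G₁ × b ≡ y G₂)) ×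
    (∀ u v → Adj G u v ⇔
      ((∃[ a ] ∃[ a' ] (f₁ a ≡ u × f₁ a' ≡ v × Adj G₁ a a')) ⊎
       (∃[ b ] ∃[ b' ] (f₂ b ≡ u × f₂ b' ≡ v × Adj G₂ b b'))))

{-# OPTIONS --safe #-}
-- The Euler genus is additive over xy-sums once the edge xy is added: if G₁⁺ and G₂⁺ have genus
-- a and b, then G⁺ has genus a + b. Since a minor operation on the sum is one on a summand and
-- conversely, criticality passes between G and its summands, and the theorem is the arithmetic
-- of 3 = 1 + 2, a critical graph with an edge having positive genus.
--
-- Gluing two embeddings along xy gives genus at most a + b. For the reverse inequality, double the
-- edge xy so that the summands share only x and y, and let S, M and N be the matchings on the ends
-- of edges at x and y given by the two sides of an edge, by the face walks away from x and y, and
-- by the corners. S and M respect the summands, N need not; the faces are the cycles of M ∪ N.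
-- Counting components (submodularity of the rank of a graph, and parity) bounds their number in
-- terms of M and S alone. Conversely, exchanging pairs of M one by one, at the cost of at most one
-- cycle each, yields a matching B inside the summands such that S ∪ B is one cycle at x and one
-- at y in each summand and M ∪ B has as many cycles as that bound allows; B gives embeddings of
-- G₁⁺ and G₂⁺ with enough faces.
module Submission where

open import Defs
open import Data.Bool using (Bool; true; false; _∧_; _∨_; not; _xor_; if_then_else_)
open import Data.Bool.ListAction using (any; all)
import Data.Bool.Properties as Bool
open import Data.Nat using (ℕ; zero; suc; _+_; _*_; _∸_; _≤_; _<_; z≤n; s≤s; ⌊_/2⌋; _<ᵇ_)
import Data.Nat.Properties as ℕ
open import Data.Nat.Tactic.RingSolver using (solve-∀)
open import Data.Fin using (Fin; zero; suc; toℕ; fromℕ<; _≟_; punchIn; punchOut)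
import Data.Fin.Properties as Fin
open import Data.List using (List; []; _∷_; length; lookup; map; allFin; filter; cartesianProduct; tabulate)
open import Data.List.Membership.Propositional using (_∈_)
import Data.List.Membership.Propositional.Properties as ∈
open import Data.List.Relation.Unary.Any as Any using (here; there)
open import Data.Product using (Σ; _×_; _,_; proj₁; proj₂; ∃; ∃₂; ∃-syntax)
open import Data.Sum using (_⊎_; inj₁; inj₂; [_,_]; [_,_]′)
open import Data.Sum.Function.Propositional using (_⊎-↔_)
import Data.Sum.Properties as Sum
open import Data.Unit using (⊤; tt)
open import Data.Empty using (⊥; ⊥-elim)
open import Relation.Nullary using (¬_; Dec; yes; no; does; ¬?; _×-dec_; _⊎-dec_)
open import Relation.Nullary.Decidable using (map′; dec-true; dec-false)
open import Relation.Binary using (Rel; Decidable; DecidableEquality)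
open import Relation.Binary.PropositionalEquality using (_≡_; _≢_; refl; sym; trans; cong; cong₂; subst; subst₂; module ≡-Reasoning)
open import Relation.Binary.Construct.Closure.ReflexiveTransitive using (Star; ε; _◅_; _◅◅_)
open import Relation.Binary.Construct.Closure.Symmetric using (fwd; bwd)
import Relation.Binary.Construct.Closure.Equivalence as Eq
open Eq using (EqClosure)
open import Relation.Binary.Construct.Union using (_∪_)
open import Function using (_∘_; id)
open import Function.Bundles using (_↔_; mk↔ₛ′; mk⇔; Inverse; Equivalence)
import Function.Construct.Composition as Comp
open import Axiom.UniquenessOfIdentityProofs.WithK using (uip)
import Function.Construct.Symmetry as Symm
open import Relation.Binary.PropositionalEquality.Properties using () renaming (isEquivalence to ≡-isEquivalence)
open import Data.Sum.Relation.Binary.Pointwise using (Pointwise; inj₁; inj₂)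
open import Level using (0ℓ)
import Relation.Binary.Definitions as Tri
import Data.List.Relation.Unary.Any.Properties as AnyP
open import Data.Nat.Induction using (<-rec)

-- Finite sets

-- An embedding of G⁺ may interleave the edges of the two summands at x and y in any way, so the
-- cyclic orders there cannot simply be restricted. Instead any rotations inside the summands with
-- at least as many faces are sought, and nothing is kept of a surface but numbers of classes of
-- unions of matchings. The two estimates meet exactly. Let M have k₀ pairs, T of them joining x to
-- y, and let S and the other pairs of M form κ cycles and paths. Every N that makes S ∪ N one cycle
-- at x and one at y satisfies 2f + 2κ ≤ 2k₀ + T, while the exchanges reach 2k₀ + T ≤ 2f′ + 2κ in
-- each summand; κ, k₀ and T are sums over the summands. The edge xy makes T positive in each
-- summand. This connects x with y in the first estimate and gives the exchanges a pair to start
-- from. The edge also balances Euler's formula: passing from G⁺ to its summands raises the numbers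
-- of components, edges, vertices and (at best) faces by 1, 1, 2 and 1, and 2·1 + 1 - 2 - 1 = 0.

module _ {A B : Set} (F : A ↔ B) where
  private module F = Inverse F

  from-to : ∀ a → F.from (F.to a) ≡ a
  from-to = F.strictlyInverseʳ

  to-from : ∀ i → F.to (F.from i) ≡ i
  to-from = F.strictlyInverseˡ

  to-injective : ∀ {a b} → F.to a ≡ F.to b → a ≡ b
  to-injective {a} {b} e = trans (sym (from-to a)) (trans (cong F.from e) (from-to b))

  from-injective : ∀ {i j} → F.from i ≡ F.from j → i ≡ j
  from-injective {i} {j} e = trans (sym (to-from i)) (trans (cong F.to e) (to-from j))

module _ {A : Set} {m : ℕ} (F : A ↔ Fin m) where
  private module F = Inverse F

  opaque
    decEq : DecidableEquality A
    decEq a b = map′ (to-injective F) (cong F.to) (F.to a ≟ F.to b)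

    search : {P : A → Set} → (∀ a → Dec (P a)) → Dec (∃ P)
    search {P} P? = map′ (λ { (i , p) → F.from i , p })
      (λ { (a , p) → F.to a , subst P (sym (from-to F a)) p }) (Fin.any? (P? ∘ F.from))

Unit↔Fin1 : ⊤ ↔ Fin 1
Unit↔Fin1 = mk↔ₛ′ (λ _ → zero) (λ _ → tt) (λ { zero → refl }) (λ _ → refl)

Fin↔Fin : ∀ {k} → Fin k ↔ Fin k
Fin↔Fin = mk↔ₛ′ id id (λ _ → refl) (λ _ → refl)

_↔∘_ : {A B C : Set} → A ↔ B → B ↔ C → A ↔ C
F ↔∘ G = Comp.inverse F G

injective⇒≤ : {A B : Set} {j k : ℕ} → A ↔ Fin j → B ↔ Fin k →
  (f : A → B) → (∀ {a b} → f a ≡ f b → a ≡ b) → j ≤ k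
injective⇒≤ F G f inj = Fin.injective⇒≤ {f = Inverse.to G ∘ f ∘ Inverse.from F}
  (λ e → from-injective F (inj (to-injective G e)))

⊎-size : {A B : Set} {j k : ℕ} → A ↔ Fin j → B ↔ Fin k → (A ⊎ B) ↔ Fin (j + k)
⊎-size F G = (F ⊎-↔ G) ↔∘ Symm.inverse Fin.+↔⊎

size-unique : {A B : Set} {j k : ℕ} → A ↔ Fin j → B ↔ Fin k → A ↔ B → j ≡ k
size-unique F G I = ℕ.≤-antisym
  (injective⇒≤ F G (Inverse.to I) (to-injective I))
  (injective⇒≤ G F (Inverse.from I) (from-injective I))

module _ {A : Set} {m : ℕ} (F : A ↔ Fin m) where

  -- A missed value would let A ⊎ ⊤ inject into A.
  injective⇒surjective : (f : A → A) → (∀ {a b} → f a ≡ f b → a ≡ b) → ∀ b → ∃[ a ] f a ≡ b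
  injective⇒surjective f inj b with search F (λ a → decEq F (f a) b)
  ... | yes w = w
  ... | no ¬w = ⊥-elim (ℕ.1+n≰n (subst (_≤ m) (ℕ.+-comm m 1) (injective⇒≤ (⊎-size F Unit↔Fin1) F g (g-inj _ _))))
    where
    g : A ⊎ ⊤ → A
    g (inj₁ a) = f a
    g (inj₂ _) = b
    g-inj : ∀ s t → g s ≡ g t → s ≡ t
    g-inj (inj₁ a) (inj₁ a′) e = cong inj₁ (inj e)
    g-inj (inj₁ a) (inj₂ _) e = ⊥-elim (¬w (a , e))
    g-inj (inj₂ _) (inj₁ a) e = ⊥-elim (¬w (a , sym e))
    g-inj (inj₂ _) (inj₂ _) e = refl

-- Membership is a Boolean equation and has at most one proof, so elements are determined by their
-- first components.
Sub : {A : Set} → (A → Bool) → Set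
Sub {A} p = Σ A (λ a → p a ≡ true)

Sub-≡ : {A : Set} {p : A → Bool} {s t : Sub p} → proj₁ s ≡ proj₁ t → s ≡ t
Sub-≡ {s = a , e} {t = _ , e′} refl = cong (a ,_) (uip e e′)

true≢false : ∀ {ℓ} {W : Set ℓ} {b} → b ≡ true → b ≡ false → W
true≢false refl ()

countF : ∀ {m} → (Fin m → Bool) → ℕ
countF {zero} p = 0
countF {suc m} p = (if p zero then suc else id) (countF (p ∘ suc))

Sub-Fin : ∀ {m} (p : Fin m → Bool) → Sub p ↔ Fin (countF p)
Sub-Fin {zero} p = mk↔ₛ′ (λ { (() , _) }) (λ ()) (λ ()) (λ { (() , _) })
Sub-Fin {suc m} p = go (p zero) refl
  where
  module R = Inverse (Sub-Fin (p ∘ suc))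
  go : ∀ b → p zero ≡ b → Sub p ↔ Fin ((if b then suc else id) (countF (p ∘ suc)))
  go true e = mk↔ₛ′ to from to∘from from∘to
    where
    to : Sub p → Fin (suc (countF (p ∘ suc)))
    to (zero , _) = zero
    to (suc i , q) = suc (R.to (i , q))
    from : Fin (suc (countF (p ∘ suc))) → Sub p
    from zero = zero , e
    from (suc j) = suc (proj₁ (R.from j)) , proj₂ (R.from j)
    to∘from : ∀ j → to (from j) ≡ j
    to∘from zero = refl
    to∘from (suc j) = cong suc (R.strictlyInverseˡ j)
    from∘to : ∀ s → from (to s) ≡ s
    from∘to (zero , q) = Sub-≡ refl
    from∘to (suc i , q) = Sub-≡ (cong suc (cong proj₁ (R.strictlyInverseʳ (i , q))))
  go false e = mk↔ₛ′ to from to∘from from∘to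
    where
    to : Sub p → Fin (countF (p ∘ suc))
    to (zero , q) = true≢false q e
    to (suc i , q) = R.to (i , q)
    from : Fin (countF (p ∘ suc)) → Sub p
    from j = suc (proj₁ (R.from j)) , proj₂ (R.from j)
    to∘from : ∀ j → to (from j) ≡ j
    to∘from j = R.strictlyInverseˡ j
    from∘to : ∀ s → from (to s) ≡ s
    from∘to (zero , q) = true≢false q e
    from∘to (suc i , q) = Sub-≡ (cong suc (cong proj₁ (R.strictlyInverseʳ (i , q))))

opaque
  Sub-finite : {A : Set} {m : ℕ} → A ↔ Fin m → (p : A → Bool) → ∃[ k ] (Sub p ↔ Fin k)
  Sub-finite {A} F p = countF (p ∘ F.from) , (mk↔ₛ′ to from to∘from from∘to ↔∘ Sub-Fin (p ∘ F.from))
    where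
    module F = Inverse F
    to : Sub p → Sub (p ∘ F.from)
    to (a , q) = F.to a , trans (cong p (from-to F a)) q
    from : Sub (p ∘ F.from) → Sub p
    from (i , q) = F.from i , q
    to∘from : ∀ s → to (from s) ≡ s
    to∘from (i , q) = Sub-≡ (to-from F i)
    from∘to : ∀ s → from (to s) ≡ s
    from∘to (a , q) = Sub-≡ (from-to F a)

-- Counting the classes of a relation

gr : {A : Set} → (A → A) → Rel A 0ℓ
gr f a b = f a ≡ b

edge : {A : Set} → A → A → Rel A 0ℓ
edge p q a b = a ≡ p × b ≡ q

module _ {A : Set} {R : Rel A 0ℓ} where

  cl-sym : ∀ {a b} → EqClosure R a b → EqClosure R b a
  cl-sym = Eq.symmetric R

  cl-inv : {B : Set} {φ : A → B} → (∀ {a b} → R a b → φ a ≡ φ b) →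
    ∀ {a b} → EqClosure R a b → φ a ≡ φ b
  cl-inv {φ = φ} h = Eq.gfold ≡-isEquivalence φ h

  cl-map : {B : Set} {Q : Rel B 0ℓ} (h : A → B) →
    (∀ {a b} → R a b → EqClosure Q (h a) (h b)) →
    ∀ {a b} → EqClosure R a b → EqClosure Q (h a) (h b)
  cl-map {Q = Q} h r = Eq.gfold (Eq.isEquivalence Q) h r

  cl-refl : ∀ {a b} → a ≡ b → EqClosure R a b
  cl-refl refl = ε

cl₁ : {A : Set} {R Q : Rel A 0ℓ} {a b : A} → R a b → EqClosure (R ∪ Q) a b
cl₁ r = Eq.return (inj₁ r)

cl₂ : {A : Set} {R Q : Rel A 0ℓ} {a b : A} → Q a b → EqClosure (R ∪ Q) a b
cl₂ r = Eq.return (inj₂ r)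

-- A certificate that the equivalence generated by `R` has exactly `k` classes. By `classes-unique`
-- the index is determined by `R`, so counts are compared by mapping classes to classes.
record Classes {A : Set} (R : Rel A 0ℓ) (k : ℕ) : Set where
  field
    cls      : A → Fin k
    rep      : Fin k → A
    cls-rep  : ∀ i → cls (rep i) ≡ i
    sound    : ∀ {a b} → R a b → cls a ≡ cls b
    complete : ∀ {a b} → cls a ≡ cls b → EqClosure R a b

  sound* : ∀ {a b} → EqClosure R a b → cls a ≡ cls b
  sound* = cl-inv sound

  rep-cls : ∀ a → EqClosure R (rep (cls a)) a
  rep-cls a = complete (cls-rep (cls a))

  opaque
    related? : ∀ a b → Dec (EqClosure R a b)
    related? a b = map′ complete sound* (cls a ≟ cls b)

open Classes public

-- As `h` reflects relatedness, sending a class to the class of the image of its representative is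
-- injective.
classes-≤ : {A B : Set} {R : Rel A 0ℓ} {Q : Rel B 0ℓ} {j k : ℕ} → Classes R j → Classes Q k →
  (h : A → B) → (∀ {a b} → EqClosure Q (h a) (h b) → EqClosure R a b) → j ≤ k
classes-≤ C D h refl-h = Fin.injective⇒≤ {f = λ i → cls D (h (rep C i))}
  (λ {i} {j} e → trans (sym (cls-rep C i)) (trans (sound* C (refl-h (complete D e))) (cls-rep C j)))

classes-antitone : {A : Set} {R Q : Rel A 0ℓ} {j k : ℕ} → Classes R j → Classes Q k →
  (∀ {a b} → R a b → EqClosure Q a b) → k ≤ j
classes-antitone C D r = classes-≤ D C id (cl-map id r)

classes-unique : {A : Set} {R : Rel A 0ℓ} {j k : ℕ} → Classes R j → Classes R k → j ≡ k
classes-unique C D = ℕ.≤-antisym (classes-antitone D C Eq.return) (classes-antitone C D Eq.return)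

module _ {A B : Set} {R : Rel A 0ℓ} {Q : Rel B 0ℓ} where

  classes-transport : {k : ℕ} (h : A → B) (s : B → A) →
    (∀ {a b} → R a b → EqClosure Q (h a) (h b)) →
    (∀ {a b} → Q a b → EqClosure R (s a) (s b)) →
    (∀ a → EqClosure R (s (h a)) a) → (∀ b → EqClosure Q (h (s b)) b) →
    Classes R k → Classes Q k
  classes-transport h s hr sr sh hs C = record
    { cls = cls C ∘ s
    ; rep = h ∘ rep C
    ; cls-rep = λ i → trans (sound* C (sh (rep C i))) (cls-rep C i)
    ; sound = λ q → sound* C (sr q)
    ; complete = λ {a} {b} e → cl-sym (hs a) ◅◅ cl-map h hr (complete C e) ◅◅ hs b
    }

  classes-⊎ : {j k : ℕ} → Classes R j → Classes Q k → Classes (Pointwise R Q) (j + k)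
  classes-⊎ {j} {k} C D = record
    { cls = Inverse.from Fin.+↔⊎ ∘ c
    ; rep = r ∘ Inverse.to (Fin.+↔⊎ {j})
    ; cls-rep = λ i → trans (cong (Inverse.from Fin.+↔⊎) (c-r (Inverse.to (Fin.+↔⊎ {j}) i)))
        (Inverse.strictlyInverseʳ (Fin.+↔⊎ {j}) i)
    ; sound = λ { (inj₁ e) → cong (Inverse.from Fin.+↔⊎ ∘ inj₁) (sound C e)
                ; (inj₂ e) → cong (Inverse.from (Fin.+↔⊎ {j}) ∘ inj₂) (sound D e) }
    ; complete = λ {a} {b} e → comp a b (from-injective (Fin.+↔⊎ {j} {k}) e)
    }
    where
    c : A ⊎ B → Fin j ⊎ Fin k
    c (inj₁ a) = inj₁ (cls C a)
    c (inj₂ b) = inj₂ (cls D b)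
    r : Fin j ⊎ Fin k → A ⊎ B
    r (inj₁ i) = inj₁ (rep C i)
    r (inj₂ i) = inj₂ (rep D i)
    c-r : ∀ i → c (r i) ≡ i
    c-r (inj₁ i) = cong inj₁ (cls-rep C i)
    c-r (inj₂ i) = cong inj₂ (cls-rep D i)
    comp : ∀ a b → c a ≡ c b → EqClosure (Pointwise R Q) a b
    comp (inj₁ a) (inj₁ b) e = cl-map inj₁ (Eq.return ∘ inj₁) (complete C (Sum.inj₁-injective e))
    comp (inj₂ a) (inj₂ b) e = cl-map inj₂ (Eq.return ∘ inj₂) (complete D (Sum.inj₂-injective e))

discrete : {A : Set} {m : ℕ} → A ↔ Fin m → Classes {A} (λ _ _ → ⊥) m
discrete F = record
  { cls = Inverse.to F ; rep = Inverse.from F ; cls-rep = to-from F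
  ; sound = λ () ; complete = λ e → cl-refl (to-injective F e) }

module _ {A : Set} {R : Rel A 0ℓ} where

  add-inner : ∀ {k p q} → Classes R k → EqClosure R p q → Classes (R ∪ edge p q) k
  add-inner C pq = record
    { cls = cls C ; rep = rep C ; cls-rep = cls-rep C
    ; sound = λ { (inj₁ r) → sound C r ; (inj₂ (refl , refl)) → sound* C pq }
    ; complete = λ e → cl-map id cl₁ (complete C e) }

  add-bridge : ∀ {k p q} → Classes R (suc k) → ¬ EqClosure R p q → Classes (R ∪ edge p q) k
  add-bridge {k} {p} {q} C p≁q = record
    { cls = λ a → punchOut (m≢ a)
    ; rep = λ i → rep C (punchIn cq i)
    ; cls-rep = λ i → trans (Fin.punchOut-cong cq (trans (cong m (cls-rep C _)) (m-other (punchIn cq i) (Fin.punchInᵢ≢i cq i))))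
        (Fin.punchOut-punchIn cq {i})
    ; sound = λ { (inj₁ r) → Fin.punchOut-cong cq (cong m (sound C r))
                ; (inj₂ (refl , refl)) → Fin.punchOut-cong cq
                    (trans (m-other (cls C p) (λ e → p≁q (complete C e))) (sym m-cq)) }
    ; complete = λ {a} {b} e → cl-sym (m-rel a) ◅◅ cl-map id cl₁ (complete C
         (trans (cls-rep C _) (trans (Fin.punchOut-injective (m≢ a) (m≢ b) e) (sym (cls-rep C _))))) ◅◅ m-rel b
    }
    where
    cq = cls C q
    -- Redirects the class of `q` to that of `p`; the two differ, so the value `cq` is never taken
    -- and can be punched out.
    m : Fin (suc k) → Fin (suc k)
    m i with i ≟ cq
    ... | yes _ = cls C p
    ... | no  _ = i
    m-other : ∀ i → i ≢ cq → m i ≡ i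
    m-other i i≢ with i ≟ cq
    ... | yes e = ⊥-elim (i≢ e)
    ... | no  _ = refl
    m-cq : m cq ≡ cls C p
    m-cq with cq ≟ cq
    ... | yes _ = refl
    ... | no ¬e = ⊥-elim (¬e refl)
    m≢ : ∀ a → cq ≢ m (cls C a)
    m≢ a e with cls C a ≟ cq
    ... | yes _ = p≁q (complete C (sym e))
    ... | no ¬e = ¬e (sym e)
    m-rel : ∀ a → EqClosure (R ∪ edge p q) (rep C (m (cls C a))) a
    m-rel a with cls C a ≟ cq
    ... | yes e = cl-map id cl₁ (rep-cls C p) ◅◅ cl₂ (refl , refl) ◅◅ cl-map id cl₁ (complete C (sym e))
    ... | no  _ = cl-map id cl₁ (rep-cls C a)

  suc-classes : ∀ {k} → Classes R k → A → ∃[ k′ ] k ≡ suc k′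
  suc-classes {zero} C a with () ← cls C a
  suc-classes {suc k} C a = k , refl

  add-edge : ∀ {k} → Classes R k → ∀ p q →
    (EqClosure R p q × Classes (R ∪ edge p q) k) ⊎
    (¬ EqClosure R p q × ∃[ k′ ] (k ≡ suc k′ × Classes (R ∪ edge p q) k′))
  add-edge C p q with related? C p q
  ... | yes r = inj₁ (r , add-inner C r)
  ... | no ¬r with suc-classes C p
  ...   | k′ , refl = inj₂ (¬r , k′ , refl , add-bridge C ¬r)

classes-cong : {A : Set} {R Q : Rel A 0ℓ} {k : ℕ} →
  (∀ {a b} → R a b → EqClosure Q a b) → (∀ {a b} → Q a b → EqClosure R a b) →
  Classes R k → Classes Q k
classes-cong r q = classes-transport id id r q (λ _ → ε) (λ _ → ε)

-- Listing the pairs of a finite relation reduces every count to the dichotomy of `add-edge`: a new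
-- pair leaves the number of classes or lowers it by one.
inList : {A : Set} → List (A × A) → Rel A 0ℓ
inList ls a b = (a , b) ∈ ls

module _ {A : Set} {R : Rel A 0ℓ} {p q : A} {ls : List (A × A)} where

  cons→ : ∀ {a b} → ((R ∪ inList ls) ∪ edge p q) a b → EqClosure (R ∪ inList ((p , q) ∷ ls)) a b
  cons→ (inj₁ (inj₁ r)) = cl₁ r
  cons→ (inj₁ (inj₂ r)) = cl₂ (there r)
  cons→ (inj₂ (refl , refl)) = cl₂ (here refl)

  cons← : ∀ {a b} → (R ∪ inList ((p , q) ∷ ls)) a b → EqClosure ((R ∪ inList ls) ∪ edge p q) a b
  cons← (inj₁ r) = cl₁ (inj₁ r)
  cons← (inj₂ (here refl)) = cl₂ (refl , refl)
  cons← (inj₂ (there r)) = cl₁ (inj₂ r)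

add-list : {A : Set} {R : Rel A 0ℓ} {k : ℕ} → Classes R k → (ls : List (A × A)) →
  ∃[ k′ ] Classes (R ∪ inList ls) k′
add-list C [] = _ , classes-cong cl₁ (λ { (inj₁ r) → Eq.return r ; (inj₂ ()) }) C
add-list C ((p , q) ∷ ls) with add-list C ls
... | _ , D with add-edge D p q
...   | inj₁ (_ , D′) = _ , classes-cong cons→ cons← D′
...   | inj₂ (_ , _ , _ , D′) = _ , classes-cong cons→ cons← D′

module _ {A : Set} {m : ℕ} (F : A ↔ Fin m) {R : Rel A 0ℓ} (R? : Decidable R) where

  private
    els : List A
    els = map (Inverse.from F) (allFin m)

  pairs : List (A × A)
  pairs = filter (λ ab → R? (proj₁ ab) (proj₂ ab)) (cartesianProduct els els)

  pairs⁺ : ∀ {a b} → R a b → (a , b) ∈ pairs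
  pairs⁺ {a} {b} r = ∈.∈-filter⁺ (λ ab → R? (proj₁ ab) (proj₂ ab))
    (∈.∈-cartesianProduct⁺ (all-els a) (all-els b)) r
    where
    all-els : ∀ a → a ∈ els
    all-els a = subst (_∈ _) (from-to F a) (∈.∈-map⁺ (Inverse.from F) (∈.∈-allFin (Inverse.to F a)))

  pairs⁻ : ∀ {a b} → (a , b) ∈ pairs → R a b
  pairs⁻ i = proj₂ (∈.∈-filter⁻ (λ ab → R? (proj₁ ab) (proj₂ ab)) {xs = cartesianProduct els els} i)

  opaque
    classes : ∃[ k ] Classes R k
    classes with add-list (discrete F) pairs
    ... | k , C = k , classes-cong (λ { (inj₁ ()) ; (inj₂ i) → Eq.return (pairs⁻ i) }) (λ r → cl₂ (pairs⁺ r)) C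

-- Rank submodularity of the graphic matroid.
submodular-list : {A : Set} {R Q : Rel A 0ℓ} {a b c d : ℕ} (ls : List (A × A)) →
  Classes R a → Classes (R ∪ Q) b → Classes (R ∪ inList ls) c → Classes ((R ∪ Q) ∪ inList ls) d →
  b + c ≤ a + d
submodular-list {a = a} {d = d} [] CR CRQ C D = ℕ.≤-reflexive (trans (cong₂ _+_
    (classes-unique (classes-cong cl₁ (λ { (inj₁ r) → Eq.return r ; (inj₂ ()) }) CRQ) D)
    (classes-unique C (classes-cong cl₁ (λ { (inj₁ r) → Eq.return r ; (inj₂ ()) }) CR)))
  (ℕ.+-comm d a))
submodular-list {a = a} {b} {c} {d} ((p , q) ∷ ls) CR CRQ C D
  with add-list CR ls | add-list CRQ ls
... | c₀ , C₀ | d₀ , D₀ with add-edge C₀ p q | add-edge D₀ p q | submodular-list ls CR CRQ C₀ D₀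
... | inj₁ (r , C₁) | inj₁ (_ , D₁) | ih =
  subst₂ (λ s t → b + s ≤ a + t) (classes-unique (classes-cong cons→ cons← C₁) C)
    (classes-unique (classes-cong cons→ cons← D₁) D) ih
-- Impossible: a pair related by the smaller relation is related by the larger one. In the other
-- mixed case only the smaller relation loses a class, which favours the inequality.
... | inj₁ (r , C₁) | inj₂ (¬r , _) | ih =
  ⊥-elim (¬r (cl-map id (λ { (inj₁ s) → cl₁ (inj₁ s) ; (inj₂ s) → cl₂ s }) r))
... | inj₂ (_ , c₁ , refl , C₁) | inj₁ (_ , D₁) | ih =
  subst₂ (λ s t → b + s ≤ a + t) (classes-unique (classes-cong cons→ cons← C₁) C)
    (classes-unique (classes-cong cons→ cons← D₁) D)
    (ℕ.≤-trans (ℕ.+-monoʳ-≤ b (ℕ.n≤1+n c₁)) ih)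
... | inj₂ (_ , c₁ , refl , C₁) | inj₂ (_ , d₁ , refl , D₁) | ih =
  subst₂ (λ s t → b + s ≤ a + t) (classes-unique (classes-cong cons→ cons← C₁) C)
    (classes-unique (classes-cong cons→ cons← D₁) D)
    (ℕ.≤-pred (subst₂ _≤_ (ℕ.+-suc b c₁) (ℕ.+-suc a d₁) ih))

submodular : {A : Set} {m : ℕ} {R Q S : Rel A 0ℓ} {a b c d : ℕ} → A ↔ Fin m → Decidable S →
  Classes R a → Classes (R ∪ Q) b → Classes (R ∪ S) c → Classes ((R ∪ Q) ∪ S) d →
  b + c ≤ a + d
submodular {A} {S = S} F S? CR CRQ CRS CRQS = submodular-list (pairs F S?) CR CRQ
  (classes-cong to′ from′ CRS) (classes-cong to′ from′ CRQS)
  where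
  to′ : ∀ {T : Rel A 0ℓ} {a b} → (T ∪ S) a b → EqClosure (T ∪ inList (pairs F S?)) a b
  to′ (inj₁ r) = cl₁ r
  to′ (inj₂ s) = cl₂ (pairs⁺ F S? s)
  from′ : ∀ {T : Rel A 0ℓ} {a b} → (T ∪ inList (pairs F S?)) a b → EqClosure (T ∪ S) a b
  from′ (inj₁ r) = cl₁ r
  from′ (inj₂ s) = cl₂ (pairs⁻ F S? s)

-- Perfect matchings as fixed-point-free involutions

true⇒ : {P : Set} (d : Dec P) → does d ≡ true → P
true⇒ (yes p) _ = p

record FPFInvolution {A : Set} (f : A → A) : Set where
  field
    invol : ∀ a → f (f a) ≡ a
    fpf   : ∀ a → f a ≢ a

  invol-injective : ∀ {a b} → f a ≡ f b → a ≡ b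
  invol-injective {a} {b} e = trans (sym (invol a)) (trans (cong f e) (invol b))

  flip : ∀ {a b} → f a ≡ b → f b ≡ a
  flip {a} e = trans (cong f (sym e)) (invol a)

open FPFInvolution public

cl-pred : {A : Set} {R : Rel A 0ℓ} (P : A → Set) → (∀ {a b} → R a b → P a → P b) →
  (∀ {a b} → R a b → P b → P a) → ∀ {a b} → EqClosure R a b → P a → P b
cl-pred P f g ε pa = pa
cl-pred P f g (fwd r ◅ rs) pa = cl-pred P f g rs (f r pa)
cl-pred P f g (bwd r ◅ rs) pa = cl-pred P f g rs (g r pa)

module _ {A : Set} {m : ℕ} (F : A ↔ Fin m) where

  gr? : (f : A → A) → Decidable (gr f)
  gr? f a b = decEq F (f a) b

  classes₁ : (f : A → A) → ∃[ k ] Classes (gr f) k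
  classes₁ f = classes F (gr? f)

  classes₂ : (f g : A → A) → ∃[ k ] Classes (gr f ∪ gr g) k
  classes₂ f g = classes F (λ a b → gr? f a b ⊎-dec gr? g a b)

  classes₃ : (f g h : A → A) → ∃[ k ] Classes ((gr f ∪ gr g) ∪ gr h) k
  classes₃ f g h = classes F (λ a b → (gr? f a b ⊎-dec gr? g a b) ⊎-dec gr? h a b)

gr-class : {A : Set} {f : A → A} → FPFInvolution f → ∀ {a b} → EqClosure (gr f) a b → b ≡ a ⊎ b ≡ f a
gr-class {f = f} I {a} r = cl-pred (λ b → b ≡ a ⊎ b ≡ f a) step
  (λ {b} {c} e → step (flip I e)) r (inj₁ refl)
  where
  step : ∀ {b c} → f b ≡ c → b ≡ a ⊎ b ≡ f a → c ≡ a ⊎ c ≡ f a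
  step e (inj₁ refl) = inj₂ (sym e)
  step e (inj₂ refl) = inj₁ (trans (sym e) (invol I a))

-- Every orbit consists of its representative and the image of the latter.
involution-size : {A : Set} {m k : ℕ} {f : A → A} → FPFInvolution f → A ↔ Fin m →
  Classes (gr f) k → k + k ≡ m
involution-size {A} {m} {k} {f} I F C = ℕ.≤-antisym
  (injective⇒≤ K2 F g (g-inj _ _)) (injective⇒≤ F K2 h (h-inj _ _))
  where
  K2 : (Fin k ⊎ Fin k) ↔ Fin (k + k)
  K2 = Symm.inverse Fin.+↔⊎
  r : Fin k → A
  r = rep C
  g : Fin k ⊎ Fin k → A
  g (inj₁ i) = r i
  g (inj₂ i) = f (r i)
  cls-g : ∀ s → cls C (g s) ≡ [ id , id ] s
  cls-g (inj₁ i) = cls-rep C i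
  cls-g (inj₂ i) = trans (sym (sound C refl)) (cls-rep C i)
  g-inj : ∀ s t → g s ≡ g t → s ≡ t
  g-inj s t e with trans (sym (cls-g s)) (trans (cong (cls C) e) (cls-g t))
  g-inj (inj₁ i) (inj₁ .i) e | refl = refl
  g-inj (inj₁ i) (inj₂ .i) e | refl = ⊥-elim (fpf I _ (sym e))
  g-inj (inj₂ i) (inj₁ .i) e | refl = ⊥-elim (fpf I _ e)
  g-inj (inj₂ i) (inj₂ .i) e | refl = refl
  h : A → Fin k ⊎ Fin k
  h a with decEq F a (r (cls C a))
  ... | yes _ = inj₁ (cls C a)
  ... | no  _ = inj₂ (cls C a)
  other : ∀ a → a ≢ r (cls C a) → a ≡ f (r (cls C a))
  other a ¬e with gr-class I (rep-cls C a)
  ... | inj₁ e = ⊥-elim (¬e e)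
  ... | inj₂ e = e
  h-inj : ∀ a b → h a ≡ h b → a ≡ b
  h-inj a b e with decEq F a (r (cls C a)) | decEq F b (r (cls C b))
  ... | yes p | yes q = trans p (trans (cong r (Sum.inj₁-injective e)) (sym q))
  ... | no ¬p | no ¬q = trans (other a ¬p) (trans (cong (f ∘ r) (Sum.inj₂-injective e)) (sym (other b ¬q)))
  ... | yes p | no ¬q with () ← e
  ... | no ¬p | yes q with () ← e

k+k≢1+j+j : ∀ k j → k + k ≢ suc (j + j)
k+k≢1+j+j zero j ()
k+k≢1+j+j (suc k) zero e with ℕ.suc-injective e
... | e′ with () ← trans (sym (ℕ.+-suc k k)) e′
k+k≢1+j+j (suc k) (suc j) e = k+k≢1+j+j k j
  (ℕ.suc-injective (trans (sym (ℕ.+-suc k k)) (trans (ℕ.suc-injective e) (cong suc (ℕ.+-suc j j)))))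

-- The two involutions force |U| to be even and odd.
module _ {A : Set} {m : ℕ} (F : A ↔ Fin m) where

  no-odd-orbit : {C B : A → A} → FPFInvolution C → (U : A → Bool) (p : A) → U p ≡ true →
    (∀ a → U a ≡ true → U (C a) ≡ true) →
    (∀ a → U a ≡ true → a ≢ p → U (B a) ≡ true × B a ≢ p × B (B a) ≡ a × B a ≢ a) → ⊥
  no-odd-orbit {C} {B} IC U p Up closedC closedB =
    k+k≢1+j+j (proj₁ (classes₁ (proj₂ FU) C′)) (proj₁ (classes₁ (proj₂ FW) B′)) (trans (involution-size IC′ (proj₂ FU) (proj₂ (classes₁ (proj₂ FU) C′)))
      (trans sizes (cong suc (sym (involution-size IB′ (proj₂ FW) (proj₂ (classes₁ (proj₂ FW) B′)))))))
    where
    FU = Sub-finite F U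
    C′ : Sub U → Sub U
    C′ (a , u) = C a , closedC a u
    IC′ : FPFInvolution C′
    IC′ = record { invol = λ { (a , u) → Sub-≡ (invol IC a) } ; fpf = λ { (a , u) e → fpf IC a (cong proj₁ e) } }
    W : Sub U → Bool
    W (a , _) = not (does (decEq F a p))
    W⇒≢ : ∀ a → not (does (decEq F a p)) ≡ true → a ≢ p
    W⇒≢ a w e with decEq F a p
    W⇒≢ a () e | yes _
    W⇒≢ a w e | no ¬e = ¬e e
    ≢⇒W : ∀ a → a ≢ p → not (does (decEq F a p)) ≡ true
    ≢⇒W a ≢ with decEq F a p
    ... | yes e = ⊥-elim (≢ e)
    ... | no _ = refl
    FW = Sub-finite (proj₂ FU) W
    B′ : Sub W → Sub W
    B′ ((a , u) , w) = (B a , proj₁ (closedB a u (W⇒≢ a w))) , ≢⇒W _ (proj₁ (proj₂ (closedB a u (W⇒≢ a w))))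
    IB′ : FPFInvolution B′
    IB′ = record
      { invol = λ { ((a , u) , w) → Sub-≡ (Sub-≡ (proj₁ (proj₂ (proj₂ (closedB a u (W⇒≢ a w)))))) }
      ; fpf = λ { ((a , u) , w) e → proj₂ (proj₂ (proj₂ (closedB a u (W⇒≢ a w)))) (cong (proj₁ ∘ proj₁) e) } }
    split : Sub U ↔ (⊤ ⊎ Sub W)
    split = mk↔ₛ′ to from to∘from from∘to
      where
      to : Sub U → ⊤ ⊎ Sub W
      to (a , u) with decEq F a p
      ... | yes _ = inj₁ tt
      ... | no ¬e = inj₂ ((a , u) , ≢⇒W a ¬e)
      from : ⊤ ⊎ Sub W → Sub U
      from (inj₁ _) = p , Up
      from (inj₂ s) = proj₁ s
      to∘from : ∀ s → to (from s) ≡ s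
      to∘from (inj₁ _) with decEq F p p
      ... | yes _ = refl
      ... | no ¬e = ⊥-elim (¬e refl)
      to∘from (inj₂ ((a , u) , w)) with decEq F a p | ≢⇒W a | W⇒≢ a w
      ... | yes e | _ | ne = ⊥-elim (ne e)
      ... | no ¬e | _ | _ = cong inj₂ (Sub-≡ refl)
      from∘to : ∀ s → from (to s) ≡ s
      from∘to (a , u) with decEq F a p
      ... | yes e = Sub-≡ (sym e)
      ... | no _ = refl
    sizes : proj₁ FU ≡ suc (proj₁ FW)
    sizes = size-unique (proj₂ FU) (⊎-size Unit↔Fin1 (proj₂ FW)) split

module Swap {A : Set} {m : ℕ} (F : A ↔ Fin m) {B : A → A} (I : FPFInvolution B)
  (p q : A) (p≢q : p ≢ q) (q≢Bp : q ≢ B p) where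

  private
    _≟A_ = decEq F

    -- The transposition of `q` and `B p`: conjugating by it renames the partner of `p` to `q`.
    τ : A → A
    τ a with a ≟A q | a ≟A B p
    ... | yes _ | _     = B p
    ... | no _  | yes _ = q
    ... | no _  | no _  = a

    τ-q : τ q ≡ B p
    τ-q with q ≟A q
    ... | yes _ = refl
    ... | no ¬e = ⊥-elim (¬e refl)

    τ-Bp : τ (B p) ≡ q
    τ-Bp with B p ≟A q | B p ≟A B p
    ... | yes e | _ = e
    ... | no _ | yes _ = refl
    ... | no _ | no ¬e = ⊥-elim (¬e refl)

    τ-else : ∀ {a} → a ≢ q → a ≢ B p → τ a ≡ a
    τ-else {a} ≢q ≢Bp with a ≟A q | a ≟A B p
    ... | yes e | _ = ⊥-elim (≢q e)
    ... | no _ | yes e = ⊥-elim (≢Bp e)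
    ... | no _ | no _ = refl

    τ-invol : ∀ a → τ (τ a) ≡ a
    τ-invol a = go (a ≟A q) (a ≟A B p)
      where
      go : Dec (a ≡ q) → Dec (a ≡ B p) → τ (τ a) ≡ a
      go (yes refl) _ = trans (cong τ τ-q) τ-Bp
      go (no _) (yes refl) = trans (cong τ τ-Bp) τ-q
      go (no ≢q) (no ≢Bp) = trans (cong τ (τ-else ≢q ≢Bp)) (τ-else ≢q ≢Bp)

  opaque
    -- Replaces the pairs {p, B p} and {q, B q} of B by {p, q} and {B p, B q};
    -- being a conjugate of B it is again a fixed-point-free involution.
    swap : A → A
    swap a = τ (B (τ a))

    swap-FPF : FPFInvolution swap
    swap-FPF = record
      { invol = λ a → trans (cong (τ ∘ B) (τ-invol (B (τ a)))) (trans (cong τ (invol I (τ a))) (τ-invol a))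
      ; fpf = λ a e → fpf I (τ a) (trans (sym (τ-invol (B (τ a)))) (cong τ e)) }

    swap-p : swap p ≡ q
    swap-p = trans (cong (τ ∘ B) (τ-else p≢q (λ e → fpf I p (sym e)))) τ-Bp

    swap-q : swap q ≡ p
    swap-q = flip swap-FPF swap-p

    swap-Bp : swap (B p) ≡ B q
    swap-Bp = trans (cong (τ ∘ B) τ-Bp) (τ-else (fpf I q) (λ e → p≢q (sym (invol-injective I e))))

    swap-Bq : swap (B q) ≡ B p
    swap-Bq = flip swap-FPF swap-Bp

    swap-else : ∀ {a} → a ≢ p → a ≢ q → a ≢ B p → a ≢ B q → swap a ≡ B a
    swap-else {a} ≢p ≢q ≢Bp ≢Bq = trans (cong (τ ∘ B) (τ-else ≢q ≢Bp))
      (τ-else (λ e → ≢Bq (sym (flip I e))) (λ e → ≢p (invol-injective I e)))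

  data View (a : A) : Set where
    at-p  : a ≡ p → swap a ≡ q → View a
    at-q  : a ≡ q → swap a ≡ p → View a
    at-Bp : a ≡ B p → swap a ≡ B q → View a
    at-Bq : a ≡ B q → swap a ≡ B p → View a
    at-else : a ≢ p → a ≢ q → a ≢ B p → a ≢ B q → swap a ≡ B a → View a

  opaque
    view : ∀ a → View a
    view a with a ≟A p | a ≟A q | a ≟A B p | a ≟A B q
    ... | yes refl | _ | _ | _ = at-p refl swap-p
    ... | no _ | yes refl | _ | _ = at-q refl swap-q
    ... | no _ | no _ | yes refl | _ = at-Bp refl swap-Bp
    ... | no _ | no _ | no _ | yes refl = at-Bq refl swap-Bq
    ... | no a₁ | no a₂ | no a₃ | no a₄ = at-else a₁ a₂ a₃ a₄ (swap-else a₁ a₂ a₃ a₄)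

  -- The points `p`, `q`, `B p`, `B q` carry two pairs of `B`, and one link between these pairs
  -- joins all four; so the hypothesis on `p` and `q` covers both new pairs. `⊆swap` is the same
  -- with the two matchings interchanged.
  swap⊆ : ∀ {R : Rel A 0ℓ} → (∀ {a b} → gr B a b → EqClosure R a b) → EqClosure R p q →
    ∀ {a b} → gr swap a b → EqClosure R a b
  swap⊆ b pq {a} refl with view a
  ... | at-p refl e rewrite e = pq
  ... | at-q refl e rewrite e = cl-sym pq
  ... | at-Bp refl e rewrite e = cl-sym (b refl) ◅◅ pq ◅◅ b refl
  ... | at-Bq refl e rewrite e = cl-sym (b refl) ◅◅ cl-sym pq ◅◅ b refl
  ... | at-else _ _ _ _ e rewrite e = b refl

  ⊆swap : ∀ {R : Rel A 0ℓ} → (∀ {a b} → gr swap a b → EqClosure R a b) → EqClosure R p (B p) →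
    ∀ {a b} → gr B a b → EqClosure R a b
  ⊆swap {R} s pBp {a} refl = go (view a)
    where
    q∼Bq : EqClosure R q (B q)
    q∼Bq = s swap-q ◅◅ pBp ◅◅ s swap-Bp
    go : View a → EqClosure R a (B a)
    go (at-p refl _) = pBp
    go (at-q refl _) = q∼Bq
    go (at-Bp refl _) = cl-sym pBp ◅◅ cl-refl (sym (invol I p))
    go (at-Bq refl _) = cl-sym q∼Bq ◅◅ cl-refl (sym (invol I q))
    go (at-else _ _ _ _ e) = s e

  swap-preserves : {W : Set} {φ : A → W} → (∀ a → φ (B a) ≡ φ a) → φ p ≡ φ q → ∀ a → φ (swap a) ≡ φ a
  swap-preserves {φ = φ} h pq a with view a
  ... | at-p refl e = trans (cong φ e) (sym pq)
  ... | at-q refl e = trans (cong φ e) pq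
  ... | at-Bp refl e = trans (cong φ e) (trans (h q) (trans (sym pq) (sym (h p))))
  ... | at-Bq refl e = trans (cong φ e) (trans (h p) (trans pq (sym (h q))))
  ... | at-else _ _ _ _ e = trans (cong φ e) (h a)

  -- Adding the link from `p` to `q` to `R ∪ gr B` costs at most one class and yields a relation
  -- whose closure contains `R ∪ gr swap`.
  swap-classes : ∀ {R : Rel A 0ℓ} {k k′} → Classes (R ∪ gr B) k → Classes (R ∪ gr swap) k′ → k ≤ suc k′
  swap-classes {R} C C′ with add-edge C p q
  ... | inj₁ (pq , _) = ℕ.m≤n⇒m≤1+n (classes-antitone C′ C
    λ { (inj₁ r) → cl₁ r ; (inj₂ r) → swap⊆ cl₂ pq r })
  ... | inj₂ (_ , _ , refl , D) = s≤s (classes-antitone C′ D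
    λ { (inj₁ r) → cl₁ (inj₁ r) ; (inj₂ r) → swap⊆ (λ b → cl₁ (inj₂ b)) (cl₂ (refl , refl)) r })

  -- If the new orbit of p missed B p, its part inside the old orbit of p would be odd.
  merge : {C : A → A} → FPFInvolution C → ¬ EqClosure (gr C ∪ gr B) p q →
    EqClosure (gr C ∪ gr swap) p (B p)
  merge {C} IC p≁q with classes₂ F C B | classes₂ F C swap
  ... | _ , K | _ , K′ with related? K′ p (B p)
  ... | yes r = r
  ... | no ¬r = ⊥-elim (no-odd-orbit F IC U p (dec-true (U? p) (ε , ε)) closedC closedB)
    where
    U? : ∀ a → Dec (EqClosure (gr C ∪ gr B) p a × EqClosure (gr C ∪ gr swap) p a)
    U? a = related? K p a ×-dec related? K′ p a
    U : A → Bool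
    U a = does (U? a)
    closedC : ∀ a → U a ≡ true → U (C a) ≡ true
    closedC a u with true⇒ (U? a) u
    ... | r , s = dec-true (U? (C a)) (r ◅◅ cl₁ refl , s ◅◅ cl₁ refl)
    closedB : ∀ a → U a ≡ true → a ≢ p →
      U (swap a) ≡ true × swap a ≢ p × swap (swap a) ≡ a × swap a ≢ a
    closedB a u ≢p with true⇒ (U? a) u | view a
    ... | r , s | at-p e _ = ⊥-elim (≢p e)
    ... | r , s | at-q refl _ = ⊥-elim (p≁q r)
    ... | r , s | at-Bp refl _ = ⊥-elim (¬r s)
    ... | r , s | at-Bq refl _ = ⊥-elim (p≁q (r ◅◅ cl-sym (cl₂ refl)))
    ... | r , s | at-else _ ≢q _ _ e =
      dec-true (U? (swap a)) (subst (EqClosure _ p) (sym e) (r ◅◅ cl₂ refl) , s ◅◅ cl₂ refl) ,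
      (λ e′ → ≢q (trans (sym (flip swap-FPF e′)) swap-p)) , invol swap-FPF a , fpf swap-FPF a

-- Nonnegativity of the Euler genus, for three matchings: the two-coloured cycles play the parts of
-- vertices, edges and faces, `K` is half the number of points and `abc` the number of components.
-- Exchanges turn `A` into `B` pair by pair, and for `A = B` equality holds. Each exchange splits
-- off the cycle of `p` and `B p`, so `ab` grows, and `K` bounds it. Meanwhile `ac` may drop by one;
-- but if a component splits, `ac` grows too, which pays for the two units gained on the right.
euler-inequality : {X : Set} {m : ℕ} → X ↔ Fin m → {B C : X → X} → FPFInvolution B → FPFInvolution C →
  ∀ {K β} → Classes (gr B) K → Classes (gr B ∪ gr C) β →
  ∀ fuel {A : X → X} → FPFInvolution A → ∀ {ab ac abc} → Classes (gr B ∪ gr A) ab →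
  Classes (gr C ∪ gr A) ac → Classes ((gr B ∪ gr C) ∪ gr A) abc →
  K ≤ ab + fuel → (ab + ac) + β ≤ K + (abc + abc)
euler-inequality {X} F {B} {C} IB IC {K} {β} CB CBC fuel {A} IA {ab} {ac} {abc} CAB CAC CABC bound
  with search F (λ p → ¬? (decEq F (A p) (B p)))
... | no all-eq = ℕ.≤-reflexive (trans (cong₂ (λ s t → s + t + β) ab≡K ac≡β)
      (trans (ℕ.+-assoc K β β) (cong (λ t → K + (t + t)) (sym abc≡β))))
  where
  A⊆B : ∀ {a b} → A a ≡ b → B a ≡ b
  A⊆B {a} refl with decEq F (A a) (B a)
  ... | yes e = sym e
  ... | no ¬e = ⊥-elim (all-eq (a , ¬e))
  B⊆A : ∀ {a b} → B a ≡ b → A a ≡ b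
  B⊆A {a} e = trans (trans (sym (A⊆B refl)) refl) e
  ab≡K : ab ≡ K
  ab≡K = classes-unique (classes-cong (λ { (inj₁ r) → Eq.return r ; (inj₂ r) → Eq.return (A⊆B r) })
    (λ r → cl₁ r) CAB) CB
  ac≡β : ac ≡ β
  ac≡β = classes-unique (classes-cong (λ { (inj₁ r) → cl₂ r ; (inj₂ r) → cl₁ (A⊆B r) })
    (λ { (inj₁ r) → cl₂ (B⊆A r) ; (inj₂ r) → cl₁ r }) CAC) CBC
  abc≡β : abc ≡ β
  abc≡β = classes-unique (classes-cong (λ { (inj₁ r) → Eq.return r ; (inj₂ r) → cl₁ (A⊆B r) })
    (λ r → cl₁ r) CABC) CBC
... | yes (p , Ap≢Bp) = go fuel bound
  where
  open Swap F IA p (B p) (λ e → fpf IB p (sym e)) (λ e → Ap≢Bp (sym e))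
  A′B = classes₂ F B swap
  A′C = classes₂ F C swap
  A′BC = classes₃ F B C swap
  p≁Ap : ¬ EqClosure (gr B ∪ gr swap) p (A p)
  p≁Ap r with cl-pred (λ a → a ≡ p ⊎ a ≡ B p) step back r (inj₁ refl)
    where
    sw : ∀ {a b} → swap a ≡ b → a ≡ p ⊎ a ≡ B p → b ≡ p ⊎ b ≡ B p
    sw refl (inj₁ refl) = inj₂ swap-p
    sw refl (inj₂ refl) = inj₁ swap-q
    bb : ∀ {a b} → B a ≡ b → a ≡ p ⊎ a ≡ B p → b ≡ p ⊎ b ≡ B p
    bb refl (inj₁ refl) = inj₂ refl
    bb refl (inj₂ refl) = inj₁ (invol IB p)
    step : ∀ {a b} → (gr B ∪ gr swap) a b → a ≡ p ⊎ a ≡ B p → b ≡ p ⊎ b ≡ B p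
    step (inj₁ e) = bb e
    step (inj₂ e) = sw e
    back : ∀ {a b} → (gr B ∪ gr swap) a b → b ≡ p ⊎ b ≡ B p → a ≡ p ⊎ a ≡ B p
    back (inj₁ e) = bb (flip IB e)
    back (inj₂ e) = sw (flip swap-FPF e)
  ... | inj₁ e = fpf IA p e
  ... | inj₂ e = Ap≢Bp e
  ab<ab′ : suc ab ≤ proj₁ A′B
  ab<ab′ with add-edge (proj₂ A′B) p (A p)
  ... | inj₁ (r , _) = ⊥-elim (p≁Ap r)
  ... | inj₂ (_ , d , e , D) = subst (suc ab ≤_) (sym e) (s≤s (classes-antitone D CAB
    λ { (inj₁ (inj₁ r)) → cl₁ r ; (inj₁ (inj₂ r)) → swap⊆ cl₂ (cl₁ refl) r ; (inj₂ (refl , refl)) → cl₂ refl }))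
  ab′≤K : proj₁ A′B ≤ K
  ab′≤K = classes-antitone CB (proj₂ A′B) cl₁
  key : (proj₁ A′B + proj₁ A′C) + β ≤ K + (proj₁ A′BC + proj₁ A′BC) → (ab + ac) + β ≤ K + (abc + abc)
  key ih with add-edge (proj₂ A′BC) p (A p)
  ... | inj₁ (r , _) = ℕ.≤-trans
      (ℕ.+-monoˡ-≤ β (ℕ.≤-pred (ℕ.≤-trans (ℕ.+-monoʳ-≤ (suc ab) (swap-classes CAC (proj₂ A′C)))
        (subst (suc ab + suc (proj₁ A′C) ≤_) (ℕ.+-suc _ _) (ℕ.+-monoˡ-≤ (suc (proj₁ A′C)) ab<ab′)))))
      (ℕ.≤-trans ih (ℕ.+-monoʳ-≤ K (ℕ.+-mono-≤ c′≤c c′≤c)))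
    where
    c′≤c : proj₁ A′BC ≤ abc
    c′≤c = classes-antitone CABC (proj₂ A′BC)
      λ { (inj₁ r′) → cl₁ r′ ; (inj₂ r′) → ⊆swap cl₂ r r′ }
  ... | inj₂ (p≁ , d , e , D) = ℕ.+-cancelˡ-≤ 2 _ _ (ℕ.≤-trans
      (ℕ.≤-trans (ℕ.≤-reflexive (lem₁ ab ac β)) (ℕ.+-monoˡ-≤ β (ℕ.+-mono-≤ ab<ab′ ac<ac′)))
      (ℕ.≤-trans ih (ℕ.≤-trans (ℕ.+-monoʳ-≤ K (ℕ.+-mono-≤ c′≤ c′≤)) (ℕ.≤-reflexive (lem₂ K abc)))))
    where
    lem₁ : ∀ s t u → 2 + (s + t + u) ≡ suc s + suc t + u
    lem₁ = solve-∀
    lem₂ : ∀ s t → s + (suc t + suc t) ≡ 2 + (s + (t + t))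
    lem₂ = solve-∀
    c′≤ : proj₁ A′BC ≤ suc abc
    c′≤ = subst (_≤ suc abc) (sym e) (s≤s (classes-antitone CABC D
      λ { (inj₁ r′) → cl₁ (inj₁ r′) ; (inj₂ r′) → ⊆swap (λ s → cl₁ (inj₂ s)) (cl₂ (refl , refl)) r′ }))
    p≁′ : ¬ EqClosure (gr C ∪ gr swap) p (A p)
    p≁′ r = p≁ (cl-map id (λ { (inj₁ s) → cl₁ (inj₂ s) ; (inj₂ s) → cl₂ s }) r)
    -- Otherwise the exchange would merge the cycles of `p` and `B p` and keep `p` joined to `A p`,
    -- against `p≁′`.
    p∼q : EqClosure (gr C ∪ gr A) p (B p)
    p∼q with related? CAC p (B p)
    ... | yes r = r
    ... | no ¬r = ⊥-elim (p≁′ (merge IC ¬r))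
    ac<ac′ : suc ac ≤ proj₁ A′C
    ac<ac′ with add-edge (proj₂ A′C) p (A p)
    ... | inj₁ (r , _) = ⊥-elim (p≁′ r)
    ... | inj₂ (_ , d′ , e′ , D′) = subst (suc ac ≤_) (sym e′) (s≤s (classes-antitone D′ CAC
      λ { (inj₁ (inj₁ r)) → cl₁ r ; (inj₁ (inj₂ r)) → swap⊆ cl₂ p∼q r ; (inj₂ (refl , refl)) → cl₂ refl }))
  go : ∀ fuel → K ≤ ab + fuel → (ab + ac) + β ≤ K + (abc + abc)
  -- Out of fuel means `K ≤ ab`, while `ab < ab′ ≤ K`.
  go zero bd = ⊥-elim (ℕ.<-irrefl refl (ℕ.≤-trans ab<ab′ (ℕ.≤-trans ab′≤K (subst (K ≤_) (ℕ.+-identityʳ ab) bd))))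
  go (suc n) bd = key (euler-inequality F IB IC CB CBC n swap-FPF (proj₂ A′B) (proj₂ A′C) (proj₂ A′BC)
    (ℕ.≤-trans bd (ℕ.≤-trans (ℕ.≤-reflexive (ℕ.+-suc ab n)) (ℕ.+-monoˡ-≤ n ab<ab′))))

-- Two matchings of which the second is defined only off a set of ends: every
-- component is a cycle or a path, hence contains no end or exactly two of them.
module Ends {A : Set} {m : ℕ} (F : A ↔ Fin m) {C : A → A} (IC : FPFInvolution C)
  (isEnd : A → Bool) (B : A → A)
  (B-inner : ∀ a → isEnd a ≡ false → isEnd (B a) ≡ false)
  (B-invol : ∀ a → isEnd a ≡ false → B (B a) ≡ a)
  (B-fpf : ∀ a → isEnd a ≡ false → B a ≢ a) where

  inner : Rel A 0ℓ
  inner a b = isEnd a ≡ false × B a ≡ b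

  paths : Rel A 0ℓ
  paths = gr C ∪ inner

  inner-sym : ∀ {a b} → inner a b → inner b a
  inner-sym {a} (e , refl) = B-inner a e , B-invol a e

  inner? : Decidable inner
  inner? a b = (isEnd a Bool.≟ false) ×-dec decEq F (B a) b

  opaque
    path-classes : ∃[ k ] Classes paths k
    path-classes = classes F (λ a b → gr? F C a b ⊎-dec inner? a b)

  -- The walk along a path from `p`: after `i` uses of `B` it arrives at `v` through `C`. Since
  -- `step` demands that `v` is no end, an end stops the walk, and the point reached is a function
  -- of `p` and `i`; hence a walk meets at most one end.
  data Walk (p : A) : ℕ → A → Set where
    start : Walk p 0 (C p)
    step  : ∀ {i v} → Walk p i v → isEnd v ≡ false → Walk p (suc i) (C (B v))

  walk-det : ∀ {p i v w} → Walk p i v → Walk p i w → v ≡ w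
  walk-det start start = refl
  walk-det (step s _) (step t _) = cong (C ∘ B) (walk-det s t)

  walk-inner : ∀ {p i j v w} → Walk p i v → Walk p j w → i < j → isEnd v ≡ false
  walk-inner {i = i} s (step {j} t e) (s≤s i≤j) with ℕ.m≤n⇒m<n∨m≡n i≤j
  ... | inj₁ i<j = walk-inner s t i<j
  ... | inj₂ refl rewrite walk-det s t = e

  walk-end : ∀ {p i j v w} → Walk p i v → Walk p j w → isEnd v ≡ true → isEnd w ≡ true → v ≡ w
  walk-end {i = i} {j} s t ev ew with ℕ.<-cmp i j
  ... | Tri.tri< i<j _ _ = true≢false ev (walk-inner s t i<j)
  ... | Tri.tri≈ _ refl _ = walk-det s t
  ... | Tri.tri> _ _ j<i = true≢false ew (walk-inner t s j<i)

  -- The walk records only the points entered through `C`. Together with their `C`-partners they are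
  -- closed under `paths` when `p` is an end, and so exhaust its component.
  Visited : A → A → Set
  Visited p a = ∃₂ λ i v → Walk p i v × (a ≡ v ⊎ a ≡ C v)

  visited : ∀ {p a} → isEnd p ≡ true → EqClosure paths p a → Visited p a
  visited {p} ep r = cl-pred (Visited p) move
    (λ { (inj₁ e) → move (inj₁ (flip IC e)) ; (inj₂ e) → move (inj₂ (inner-sym e)) })
    r (0 , C p , start , inj₂ (sym (invol IC p)))
    where
    move : ∀ {a b} → paths a b → Visited p a → Visited p b
    move (inj₁ refl) (i , v , w , inj₁ refl) = i , v , w , inj₂ refl
    move (inj₁ refl) (i , v , w , inj₂ refl) = i , v , w , inj₁ (invol IC v)
    move (inj₂ (e , refl)) (i , v , w , inj₁ refl) = suc i , C (B v) , step w e , inj₂ (sym (invol IC (B v)))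
    move (inj₂ (e , refl)) (_ , _ , start , inj₂ refl) = true≢false ep (subst (λ a → isEnd a ≡ false) (invol IC p) e)
    move (inj₂ (e , refl)) (_ , _ , step {i} {v} w ev , inj₂ refl) =
      i , v , w , inj₁ (trans (cong B (invol IC (B v))) (B-invol v ev))

  end-visited : ∀ {p a} → isEnd p ≡ true → isEnd a ≡ true → EqClosure paths p a →
    a ≡ p ⊎ ∃[ i ] Walk p i a
  end-visited ep ea r with visited ep r
  ... | i , v , w , inj₁ refl = inj₂ (i , w)
  ... | _ , _ , start , inj₂ refl = inj₁ (invol IC _)
  ... | _ , _ , step {i} {v} w ev , inj₂ refl =
    true≢false ea (trans (cong isEnd (invol IC (B v))) (B-inner v ev))

  at-most-two : ∀ {p a b} → isEnd p ≡ true → isEnd a ≡ true → isEnd b ≡ true →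
    EqClosure paths p a → EqClosure paths p b → a ≢ p → b ≢ p → a ≡ b
  at-most-two ep ea eb pa pb a≢p b≢p with end-visited ep ea pa | end-visited ep eb pb
  ... | inj₁ e | _ = ⊥-elim (a≢p e)
  ... | inj₂ _ | inj₁ e = ⊥-elim (b≢p e)
  ... | inj₂ (_ , s) | inj₂ (_ , t) = walk-end s t ea eb

  End : Set
  End = Sub isEnd

  private
    Other : End → A → Set
    Other (p , _) a = isEnd a ≡ true × a ≢ p × EqClosure paths p a

    -- A component whose only end is `p` would be paired off completely by `C`, and by `B` except
    -- for `p`.
    other : ∀ e → ∃ (Other e)
    other (p , ep) with search F {Other (p , ep)} (λ a → (isEnd a Bool.≟ true) ×-dec
                          (¬? (decEq F a p) ×-dec related? (proj₂ path-classes) p a))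
    ... | yes w = w
    ... | no ¬w = ⊥-elim (no-odd-orbit F IC U p (dec-true (U? p) ε)
            (λ a u → dec-true (U? (C a)) (true⇒ (U? a) u ◅◅ cl₁ refl)) closedB)
      where
      U? : ∀ a → Dec (EqClosure paths p a)
      U? = related? (proj₂ path-classes) p
      U : A → Bool
      U a = does (U? a)
      closedB : ∀ a → U a ≡ true → a ≢ p → U (B a) ≡ true × B a ≢ p × B (B a) ≡ a × B a ≢ a
      closedB a u a≢p with isEnd a in ea
      ... | true = ⊥-elim (¬w (a , ea , a≢p , true⇒ (U? a) u))
      ... | false = dec-true (U? (B a)) (true⇒ (U? a) u ◅◅ cl₂ (ea , refl)) ,
        (λ e → true≢false ep (subst (λ b → isEnd b ≡ false) e (B-inner a ea))) , B-invol a ea , B-fpf a ea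

  opaque
    -- Each path is contracted to a single pair, so that later arguments can take place on the ends
    -- alone.
    mate : End → End
    mate e = proj₁ (other e) , proj₁ (proj₂ (other e))

    mate-related : ∀ e → EqClosure paths (proj₁ e) (proj₁ (mate e))
    mate-related e = proj₂ (proj₂ (proj₂ (other e)))

    mate-≢ : ∀ e → proj₁ (mate e) ≢ proj₁ e
    mate-≢ e = proj₁ (proj₂ (proj₂ (other e)))

    mate-unique : ∀ e e′ → EqClosure paths (proj₁ e) (proj₁ e′) → e′ ≡ e ⊎ e′ ≡ mate e
    mate-unique e e′ r with decEq F (proj₁ e′) (proj₁ e)
    ... | yes eq = inj₁ (Sub-≡ eq)
    ... | no e′≢e = inj₂ (Sub-≡ (at-most-two (proj₂ e) (proj₂ e′) (proj₂ (mate e)) r (mate-related e) e′≢e (mate-≢ e)))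

    mate-FPF : FPFInvolution mate
    mate-FPF = record { invol = inv ; fpf = λ e eq → mate-≢ e (cong proj₁ eq) }
      where
      inv : ∀ e → mate (mate e) ≡ e
      inv e with mate-unique (mate e) e (cl-sym (mate-related e))
      ... | inj₁ eq = ⊥-elim (mate-≢ e (cong proj₁ (sym eq)))
      ... | inj₂ eq = sym eq

  private
    close-at : (End → End) → ∀ a b → isEnd a ≡ b → A
    close-at Q a true  e = proj₁ (Q (a , e))
    close-at Q a false _ = B a

    close-at-true : ∀ Q a b (e : isEnd a ≡ b) (t : isEnd a ≡ true) → close-at Q a b e ≡ proj₁ (Q (a , t))
    close-at-true Q a true e t = cong (λ t → proj₁ (Q t)) (Sub-≡ refl)
    close-at-true Q a false e t = true≢false t e

    close-at-false : ∀ Q a b (e : isEnd a ≡ b) → isEnd a ≡ false → close-at Q a b e ≡ B a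
    close-at-false Q a true e t = true≢false e t
    close-at-false Q a false e t = refl

  close : (End → End) → A → A
  close Q a = close-at Q a (isEnd a) refl

  opaque
    close-end : ∀ Q e → close Q (proj₁ e) ≡ proj₁ (Q e)
    close-end Q (a , e) = close-at-true Q a (isEnd a) refl e

    close-inner : ∀ Q {a} → isEnd a ≡ false → close Q a ≡ B a
    close-inner Q {a} e = close-at-false Q a (isEnd a) refl e

  close-FPF : ∀ {Q} → FPFInvolution Q → FPFInvolution (close Q)
  close-FPF {Q} IQ = record { invol = λ a → inv a (isEnd a) refl ; fpf = λ a → ff a (isEnd a) refl }
    where
    inv : ∀ a b → isEnd a ≡ b → close Q (close Q a) ≡ a
    inv a true ea = trans (cong (close Q) (close-end Q (a , ea))) (trans (close-end Q (Q (a , ea))) (cong proj₁ (invol IQ (a , ea))))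
    inv a false ea = trans (cong (close Q) (close-inner Q ea)) (trans (close-inner Q (B-inner a ea)) (B-invol a ea))
    ff : ∀ a b → isEnd a ≡ b → close Q a ≢ a
    ff a true ea e = fpf IQ (a , ea) (Sub-≡ (trans (sym (close-end Q (a , ea))) e))
    ff a false ea e = B-fpf a ea (trans (sym (close-inner Q ea)) e)

  private
    K = proj₂ path-classes

    has-end? : ∀ a → Dec (∃[ e ] EqClosure paths (proj₁ {B = λ a → isEnd a ≡ true} e) a)
    has-end? a = search (proj₂ (Sub-finite F isEnd)) (λ e → related? K (proj₁ e) a)

    -- Components without an end are closed already; no choice of `Q` on the ends affects them.
    endless : Fin (proj₁ path-classes) → Bool
    endless i = not (does (has-end? (rep K i)))

    ZZ = Sub-finite Fin↔Fin endless

  closed-cycles : ℕ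
  closed-cycles = proj₁ ZZ

  -- Closing up the paths by Q: the cycles are those already closed and those of mate and Q.
  close-classes : ∀ {Q k} → Classes (gr mate ∪ gr Q) k → Classes (gr C ∪ gr (close Q)) (closed-cycles + k)
  close-classes {Q} {k} D = classes-transport h s h-resp s-resp sh hs (classes-⊎ (discrete (proj₂ ZZ)) D)
    where
    T : Rel (Sub endless ⊎ End) 0ℓ
    T = Pointwise (λ _ _ → ⊥) (gr mate ∪ gr Q)
    Full : Rel A 0ℓ
    Full = gr C ∪ gr (close Q)
    paths⊆ : ∀ {a b} → paths a b → EqClosure Full a b
    paths⊆ (inj₁ r) = cl₁ r
    paths⊆ (inj₂ (e , refl)) = cl₂ (close-inner Q e)
    h : Sub endless ⊎ End → A
    h (inj₁ (i , _)) = rep K i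
    h (inj₂ e) = proj₁ e
    h-resp : ∀ {a b} → T a b → EqClosure Full (h a) (h b)
    h-resp (inj₂ {a} (inj₁ refl)) = cl-map id paths⊆ (mate-related a)
    h-resp (inj₂ {a} (inj₂ refl)) = cl₂ (close-end Q a)
    endless-true : ∀ a → ¬ (∃[ e ] EqClosure paths (proj₁ {B = λ a → isEnd a ≡ true} e) a) → endless (cls K a) ≡ true
    endless-true a ¬e with has-end? (rep K (cls K a))
    ... | yes (e , r) = ⊥-elim (¬e (e , (r ◅◅ rep-cls K a)))
    ... | no _ = refl
    endless⇒ : ∀ i → endless i ≡ true → ¬ (∃[ e ] EqClosure paths (proj₁ {B = λ a → isEnd a ≡ true} e) (rep K i))
    endless⇒ i z w with has-end? (rep K i)
    endless⇒ i () w | yes _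
    ... | no ¬w = ¬w w
    s : A → Sub endless ⊎ End
    s a with has-end? a
    ... | yes (e , _) = inj₂ e
    ... | no ¬e = inj₁ (cls K a , endless-true a ¬e)
    same-end : ∀ {e e′} → EqClosure paths (proj₁ e) (proj₁ e′) → EqClosure T (inj₂ e) (inj₂ e′)
    same-end {e} {e′} r with mate-unique e e′ r
    ... | inj₁ refl = ε
    ... | inj₂ refl = Eq.return (inj₂ (inj₁ refl))
    s-path : ∀ {a b} → EqClosure paths a b → EqClosure T (s a) (s b)
    s-path {a} {b} r with has-end? a | has-end? b
    ... | yes (e , p) | yes (e′ , p′) = same-end (p ◅◅ r ◅◅ cl-sym p′)
    ... | yes (e , p) | no ¬e = ⊥-elim (¬e (e , (p ◅◅ r)))
    ... | no ¬e | yes (e , p) = ⊥-elim (¬e (e , (p ◅◅ cl-sym r)))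
    ... | no _ | no _ = cl-refl (cong inj₁ (Sub-≡ (sound* K r)))
    s-end : ∀ e → EqClosure T (s (proj₁ e)) (inj₂ e)
    s-end e with has-end? (proj₁ e)
    ... | yes (e′ , p) = same-end p
    ... | no ¬e = ⊥-elim (¬e (e , ε))
    s-resp : ∀ {a b} → Full a b → EqClosure T (s a) (s b)
    s-resp (inj₁ r) = s-path (cl₁ r)
    s-resp {a} (inj₂ refl) = go (isEnd a) refl
      where
      go : ∀ t → isEnd a ≡ t → EqClosure T (s a) (s (close Q a))
      go true ea = s-end (a , ea) ◅◅ Eq.return (inj₂ (inj₂ refl)) ◅◅ cl-sym (s-end (Q (a , ea)))
        ◅◅ cl-refl (cong s (sym (close-end Q (a , ea))))
      go false ea = s-path (cl₂ (ea , refl)) ◅◅ cl-refl (cong s (sym (close-inner Q ea)))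
    sh : ∀ t → EqClosure T (s (h t)) t
    sh (inj₂ e) = s-end e
    sh (inj₁ (i , z)) with has-end? (rep K i) | endless⇒ i z
    ... | no _ | _ = cl-refl (cong inj₁ (Sub-≡ (cls-rep K i)))
    ... | yes w | ¬w = ⊥-elim (¬w w)
    hs : ∀ a → EqClosure Full (h (s a)) a
    hs a with has-end? a
    ... | yes (e , p) = cl-map id paths⊆ p
    ... | no _ = cl-map id paths⊆ (rep-cls K a)

-- Rebuilding a matching inside the parts

≤-sum : ∀ {a b c d} → a ≤ b → c ≤ d → a + c ≤ b + d
≤-sum = ℕ.+-mono-≤

glue : {A : Set} → (A → Bool) → Rel A 0ℓ
glue D a b = D a ≡ true × D b ≡ true

connected⇒≤1 : {A : Set} {R : Rel A 0ℓ} {k : ℕ} → Classes R k → (∀ a b → EqClosure R a b) → k ≤ 1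
connected⇒≤1 C conn = injective⇒≤ Fin↔Fin Fin↔Fin (λ _ → zero)
  (λ {i} {j} _ → trans (sym (cls-rep C i)) (trans (sound* C (conn _ _)) (cls-rep C j)))

module _ {A : Set} {m : ℕ} (F : A ↔ Fin m) {R : Rel A 0ℓ} (D : A → Bool)
  {k k′ d : ℕ} (C : Classes R k) (C′ : Classes (R ∪ glue D) k′) (FD : Sub D ↔ Fin d) (d₀ : Sub D) where

  -- The `d` classes of the points of `D` become one. That glued class takes the extra place on the
  -- right; every other glued class contains an old class that misses `D`.
  glue-distinct : (∀ s t → EqClosure R (proj₁ s) (proj₁ {B = λ a → D a ≡ true} t) → s ≡ t) →
    k′ + d ≤ k + 1
  glue-distinct distinct = injective⇒≤ (⊎-size Fin↔Fin FD) (⊎-size Fin↔Fin Unit↔Fin1) g (g-inj _ _)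
    where
    c₀ = cls C′ (proj₁ d₀)
    g : Fin k′ ⊎ Sub D → Fin k ⊎ ⊤
    g (inj₁ i) with i ≟ c₀
    ... | yes _ = inj₂ tt
    ... | no  _ = inj₁ (cls C (rep C′ i))
    g (inj₂ s) = inj₁ (cls C (proj₁ s))
    no-clash : ∀ i s → i ≢ c₀ → cls C (rep C′ i) ≢ cls C (proj₁ {B = λ a → D a ≡ true} s)
    no-clash i s i≢ e = i≢ (trans (sym (cls-rep C′ i))
      (sound* C′ (cl-map id cl₁ (complete C e) ◅◅ cl₂ (proj₂ s , proj₂ d₀))))
    g-inj : ∀ s t → g s ≡ g t → s ≡ t
    g-inj (inj₁ i) (inj₁ j) e with i ≟ c₀ | j ≟ c₀
    ... | yes p | yes q = cong inj₁ (trans p (sym q))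
    ... | no _ | no _ = cong inj₁ (trans (sym (cls-rep C′ i)) (trans
          (sound* C′ (cl-map id cl₁ (complete C (Sum.inj₁-injective e)))) (cls-rep C′ j)))
    g-inj (inj₁ i) (inj₁ j) () | yes _ | no _
    g-inj (inj₁ i) (inj₁ j) () | no _ | yes _
    g-inj (inj₁ i) (inj₂ t) e with i ≟ c₀
    ... | no i≢ = ⊥-elim (no-clash i t i≢ (Sum.inj₁-injective e))
    g-inj (inj₁ i) (inj₂ t) () | yes _
    g-inj (inj₂ s) (inj₁ j) e with j ≟ c₀
    ... | no j≢ = ⊥-elim (no-clash j s j≢ (sym (Sum.inj₁-injective e)))
    g-inj (inj₂ s) (inj₁ j) () | yes _
    g-inj (inj₂ s) (inj₂ t) e = cong inj₂ (distinct s t (complete C (Sum.inj₁-injective e)))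

  -- At most d / 2 classes meet D, and gluing turns them into one.
  glue-pairs : (∀ s → ∃[ t ] (proj₁ t ≢ proj₁ s × EqClosure R (proj₁ s) (proj₁ {B = λ a → D a ≡ true} t))) →
    k + k + 2 ≤ k′ + k′ + d
  glue-pairs partner with classes FD {λ s t → EqClosure R (proj₁ s) (proj₁ t)} (λ s t → related? C (proj₁ s) (proj₁ t))
  ... | j , J = ℕ.+-cancelʳ-≤ (j + j) _ _
      (subst₂ _≤_ (lem₁ k j) (lem₂ k′ j d) (≤-sum (≤-sum k+1≤k′+j k+1≤k′+j) j+j≤d))
    where
    lem₁ : ∀ k j → (k + 1) + (k + 1) + (j + j) ≡ k + k + 2 + (j + j)
    lem₁ = solve-∀
    lem₂ : ∀ k j d → (k + j) + (k + j) + d ≡ k + k + d + (j + j)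
    lem₂ = solve-∀
    J-rel : ∀ {s t} → cls J s ≡ cls J t → EqClosure R (proj₁ s) (proj₁ t)
    J-rel e = cl-map proj₁ id (complete J e)
    g : Fin j ⊎ Fin j → Sub D
    g (inj₁ i) = rep J i
    g (inj₂ i) = proj₁ (partner (rep J i))
    cls-g : ∀ s → cls J (g s) ≡ [ id , id ] s
    cls-g (inj₁ i) = cls-rep J i
    cls-g (inj₂ i) = trans (sym (sound J (proj₂ (proj₂ (partner (rep J i)))))) (cls-rep J i)
    g-inj : ∀ s t → g s ≡ g t → s ≡ t
    g-inj s t e with trans (sym (cls-g s)) (trans (cong (cls J) e) (cls-g t))
    g-inj (inj₁ i) (inj₁ .i) e | refl = refl
    g-inj (inj₁ i) (inj₂ .i) e | refl = ⊥-elim (proj₁ (proj₂ (partner (rep J i))) (cong proj₁ (sym e)))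
    g-inj (inj₂ i) (inj₁ .i) e | refl = ⊥-elim (proj₁ (proj₂ (partner (rep J i))) (cong proj₁ e))
    g-inj (inj₂ i) (inj₂ .i) e | refl = refl
    j+j≤d : j + j ≤ d
    j+j≤d = injective⇒≤ (Symm.inverse Fin.+↔⊎) FD g (g-inj _ _)
    meets? : ∀ i → Dec (∃[ s ] cls C (proj₁ {B = λ a → D a ≡ true} s) ≡ i)
    meets? i = search FD (λ s → cls C (proj₁ s) ≟ i)
    h : Fin k ⊎ ⊤ → Fin k′ ⊎ Fin j
    h (inj₁ i) with meets? i
    ... | yes (s , _) = inj₂ (cls J s)
    ... | no _ = inj₁ (cls C′ (rep C i))
    h (inj₂ _) = inj₁ (cls C′ (proj₁ d₀))
    -- A class that misses `D` is not enlarged by gluing.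
    avoid : ∀ i → ¬ (∃[ s ] cls C (proj₁ {B = λ a → D a ≡ true} s) ≡ i) →
      ∀ {b} → EqClosure (R ∪ glue D) (rep C i) b → EqClosure R (rep C i) b × D b ≡ false
    avoid i ¬s r = cl-pred (λ b → EqClosure R (rep C i) b × D b ≡ false) fw bw r (ε , outside ε)
      where
      outside : ∀ {b} → EqClosure R (rep C i) b → D b ≡ false
      outside {b} r with D b in db
      ... | false = refl
      ... | true = ⊥-elim (¬s ((b , db) , trans (sound* C (cl-sym r)) (cls-rep C i)))
      fw : ∀ {a b} → (R ∪ glue D) a b → EqClosure R (rep C i) a × D a ≡ false → EqClosure R (rep C i) b × D b ≡ false
      fw (inj₁ q) (p , _) = (p ◅◅ Eq.return q) , outside (p ◅◅ Eq.return q)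
      fw (inj₂ (t , _)) (_ , f) = true≢false t f
      bw : ∀ {a b} → (R ∪ glue D) a b → EqClosure R (rep C i) b × D b ≡ false → EqClosure R (rep C i) a × D a ≡ false
      bw (inj₁ q) (p , _) = (p ◅◅ cl-sym (Eq.return q)) , outside (p ◅◅ cl-sym (Eq.return q))
      bw (inj₂ (_ , t)) (_ , f) = true≢false t f
    h-inj : ∀ s t → h s ≡ h t → s ≡ t
    h-inj (inj₁ i) (inj₁ i′) e with meets? i | meets? i′
    ... | yes (s , p) | yes (t , q) = cong inj₁ (trans (sym p)
          (trans (sound* C (J-rel (Sum.inj₂-injective e))) q))
    ... | no ¬p | no ¬q = cong inj₁ (trans (sym (cls-rep C i)) (trans
          (sound* C (proj₁ (avoid i ¬p (complete C′ (Sum.inj₁-injective e))))) (cls-rep C i′)))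
    h-inj (inj₁ i) (inj₁ i′) () | yes _ | no _
    h-inj (inj₁ i) (inj₁ i′) () | no _ | yes _
    h-inj (inj₁ i) (inj₂ _) e with meets? i
    ... | no ¬p = true≢false (proj₂ d₀) (proj₂ (avoid i ¬p (complete C′ (Sum.inj₁-injective e))))
    h-inj (inj₁ i) (inj₂ _) () | yes _
    h-inj (inj₂ _) (inj₁ i) e with meets? i
    ... | no ¬p = true≢false (proj₂ d₀) (proj₂ (avoid i ¬p (complete C′ (sym (Sum.inj₁-injective e)))))
    h-inj (inj₂ _) (inj₁ i) () | yes _
    h-inj (inj₂ _) (inj₂ _) e = refl
    k+1≤k′+j : k + 1 ≤ k′ + j
    k+1≤k′+j = injective⇒≤ (⊎-size Fin↔Fin Unit↔Fin1) (⊎-size Fin↔Fin Fin↔Fin) h (h-inj _ _)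

xor-false : ∀ {a b} → a xor b ≡ false → a ≡ b
xor-false {true} {true} _ = refl
xor-false {false} {false} _ = refl

xor-self : ∀ {a b} → a ≡ b → a xor b ≡ false
xor-self {true} refl = refl
xor-self {false} refl = refl

∧-true : ∀ {a b} → a ∧ b ≡ true → a ≡ true × b ≡ true
∧-true {true} e = refl , e

not-true : ∀ {b} → not b ≡ true → b ≡ false
not-true {false} _ = refl

not-false : ∀ {b} → not b ≡ false → b ≡ true
not-false {true} _ = refl

-- The points are coloured by X; S preserves colours, and a pair of B is crossing
-- if its two points have different colours.
module Crossing {A : Set} {m : ℕ} (F : A ↔ Fin m) (X : A → Bool)
  {S : A → A} (IS : FPFInvolution S) (XS : ∀ a → X (S a) ≡ X a)
  {B : A → A} (IB : FPFInvolution B) where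

  crossing : A → Bool
  crossing a = X a xor X (B a)

  -- Selects one end of each crossing pair, the one of colour `true`, so that `Sub crossingX` counts
  -- crossing pairs.
  crossingX : A → Bool
  crossingX a = X a ∧ not (X (B a))

  crossing-B : ∀ a → crossing (B a) ≡ crossing a
  crossing-B a = trans (cong (λ b → X (B a) xor X b) (invol IB a)) (Bool.xor-comm (X (B a)) (X a))

  crossingX⇒ : ∀ {a} → crossingX a ≡ true → X a ≡ true × X (B a) ≡ false
  crossingX⇒ e with ∧-true e
  ... | p , q = p , not-true q

  ⇒crossingX : ∀ {a} → X a ≡ true → X (B a) ≡ false → crossingX a ≡ true
  ⇒crossingX p q = cong₂ (λ s t → s ∧ not t) p q

  crossingX⇒crossing : ∀ {a} → crossingX a ≡ true → crossing a ≡ true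
  crossingX⇒crossing e with crossingX⇒ e
  ... | p , q = cong₂ _xor_ p q

  crossing⇒ : ∀ {a} → crossing a ≡ true → crossingX a ≡ true ⊎ crossingX (B a) ≡ true
  crossing⇒ {a} e with X a in p | X (B a) in q
  ... | true | false = inj₁ refl
  ... | false | true = inj₂ (cong₂ (λ s t → s ∧ not t) refl (trans (cong X (invol IB a)) p))
  crossing⇒ () | true | true
  crossing⇒ () | false | false

  open Ends F IS crossing B (λ a e → trans (crossing-B a) e) (λ a _ → invol IB a) (λ a _ → fpf IB a) public

  paths-X : ∀ {a b} → EqClosure paths a b → X a ≡ X b
  paths-X = cl-inv λ { {a} (inj₁ refl) → sym (XS a) ; (inj₂ (e , refl)) → xor-false e }

module _ {A : Set} {m : ℕ} (F : A ↔ Fin m) (X : A → Bool)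
  {S : A → A} (IS : FPFInvolution S) (XS : ∀ a → X (S a) ≡ X a)
  {M : A → A} (IM : FPFInvolution M) where

  open Crossing F X IS XS IM

  -- Let `R` be `M` with the `true` ends of its crossing pairs glued together, and compare by
  -- submodularity the effects of adding `N`, `S` and both. Both together leave one class: `S` and
  -- `N` connect each colour, and a crossing pair joins the colours. A face meets the `true` ends in
  -- none or at least two points, and a path has no end or two, so both counts enter through
  -- `glue-pairs`; `glue-distinct` evaluates `R` itself.
  crossing-bound : ∀ {N} → FPFInvolution N → (∀ a → X (N a) ≡ X a) →
    (∀ a b → X a ≡ X b → EqClosure (gr S ∪ gr N) a b) →
    ∀ {f κ k₀ T} → Classes (gr M ∪ gr N) f → Classes paths κ → Classes (gr M) k₀ →
    Sub crossingX ↔ Fin T → Sub crossingX → (f + f) + (κ + κ) ≤ (k₀ + k₀) + T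
  crossing-bound {N} IN XN conn {f} {κ} {k₀} {T} Cf Cκ C₀ FT p₀ =
    arith f κ (proj₁ CRN) (proj₁ CRS) (proj₁ CR) k₀ T fN κS sub r+T
    where
    D = crossingX
    R : Rel A 0ℓ
    R = gr M ∪ glue D
    glue? : Decidable (glue D)
    glue? a b = (D a Bool.≟ true) ×-dec (D b Bool.≟ true)
    CR = classes F {R} (λ a b → gr? F M a b ⊎-dec glue? a b)
    CRN = classes F {R ∪ gr N} (λ a b → (gr? F M a b ⊎-dec glue? a b) ⊎-dec gr? F N a b)
    CRS = classes F {R ∪ gr S} (λ a b → (gr? F M a b ⊎-dec glue? a b) ⊎-dec gr? F S a b)
    CRNS = classes F {(R ∪ gr N) ∪ gr S}
      (λ a b → ((gr? F M a b ⊎-dec glue? a b) ⊎-dec gr? F N a b) ⊎-dec gr? F S a b)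

    SN⊆ : ∀ {a b} → EqClosure (gr S ∪ gr N) a b → EqClosure ((R ∪ gr N) ∪ gr S) a b
    SN⊆ = cl-map id λ { (inj₁ r) → cl₂ r ; (inj₂ r) → cl₁ (inj₂ r) }
    to-p₀ : ∀ a → EqClosure ((R ∪ gr N) ∪ gr S) a (proj₁ p₀)
    to-p₀ a with X a in xa
    ... | true = SN⊆ (conn _ _ (trans xa (sym (proj₁ (crossingX⇒ (proj₂ p₀))))))
    ... | false = SN⊆ (conn _ _ (trans xa (sym (proj₂ (crossingX⇒ (proj₂ p₀))))))
          ◅◅ cl-sym (cl₁ (inj₁ (inj₁ refl)))
    sub : proj₁ CRN + proj₁ CRS ≤ proj₁ CR + 1
    sub = ℕ.≤-trans (submodular F (gr? F S) (proj₂ CR) (proj₂ CRN) (proj₂ CRS) (proj₂ CRNS))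
      (ℕ.+-monoʳ-≤ (proj₁ CR) (connected⇒≤1 (proj₂ CRNS) (λ a b → to-p₀ a ◅◅ cl-sym (to-p₀ b))))

    r+T : proj₁ CR + T ≤ k₀ + 1
    r+T = glue-distinct F D C₀ (proj₂ CR) FT p₀ distinct
      where
      distinct : ∀ s t → EqClosure (gr M) (proj₁ s) (proj₁ {B = λ a → D a ≡ true} t) → s ≡ t
      distinct s t r with gr-class IM r
      ... | inj₁ e = Sub-≡ (sym e)
      ... | inj₂ e = true≢false (proj₁ (crossingX⇒ (proj₂ t)))
        (trans (cong X e) (proj₂ (crossingX⇒ (proj₂ s))))

    fN : f + f + 2 ≤ proj₁ CRN + proj₁ CRN + T
    fN = glue-pairs F D Cf (classes-cong
        (λ { (inj₁ (inj₁ r)) → cl₁ (inj₁ r) ; (inj₁ (inj₂ r)) → cl₂ r ; (inj₂ r) → cl₁ (inj₂ r) })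
        (λ { (inj₁ (inj₁ r)) → cl₁ (inj₁ r) ; (inj₂ r) → cl₁ (inj₂ r) ; (inj₁ (inj₂ r)) → cl₂ r })
        (proj₂ CRN)) FT p₀ partner
      where
      -- The points of colour `true` on the face of `p` are paired off by `N`. Were `p` the only
      -- crossing end among them, `M` would pair off all of them except `p`.
      partner : ∀ s → ∃[ t ] (proj₁ t ≢ proj₁ s × EqClosure (gr M ∪ gr N) (proj₁ s) (proj₁ {B = λ a → D a ≡ true} t))
      partner (p , Dp) with search FT (λ t → ¬? (decEq F (proj₁ t) p) ×-dec related? Cf p (proj₁ t))
      ... | yes w = w
      ... | no ¬w = ⊥-elim (no-odd-orbit F IN U p (dec-true (U? p) (proj₁ (crossingX⇒ Dp) , ε)) closedN closedM)
        where
        U? : ∀ a → Dec (X a ≡ true × EqClosure (gr M ∪ gr N) p a)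
        U? a = (X a Bool.≟ true) ×-dec related? Cf p a
        U : A → Bool
        U a = does (U? a)
        closedN : ∀ a → U a ≡ true → U (N a) ≡ true
        closedN a u with true⇒ (U? a) u
        ... | xa , r = dec-true (U? (N a)) (trans (XN a) xa , (r ◅◅ cl₂ refl))
        closedM : ∀ a → U a ≡ true → a ≢ p → U (M a) ≡ true × M a ≢ p × M (M a) ≡ a × M a ≢ a
        closedM a u a≢p = go (true⇒ (U? a) u) (X (M a)) refl
          where
          go : X a ≡ true × EqClosure (gr M ∪ gr N) p a → ∀ b → X (M a) ≡ b →
            U (M a) ≡ true × M a ≢ p × M (M a) ≡ a × M a ≢ a
          go (xa , r) false xma = ⊥-elim (¬w ((a , ⇒crossingX xa xma) , a≢p , r))
          go (xa , r) true xma = dec-true (U? (M a)) (xma , (r ◅◅ cl₁ refl)) ,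
            (λ e → true≢false xa (trans (cong X (sym (flip IM e))) (proj₂ (crossingX⇒ Dp)))) ,
            invol IM a , fpf IM a

    FD = Sub-finite F crossing
    D≤2T : proj₁ FD ≤ T + T
    D≤2T = injective⇒≤ (proj₂ FD) (⊎-size FT FT) g (g-inj _ _)
      where
      g : Sub crossing → Sub D ⊎ Sub D
      g (a , c) with crossing⇒ c
      ... | inj₁ e = inj₁ (a , e)
      ... | inj₂ e = inj₂ (M a , e)
      g-inj : ∀ s t → g s ≡ g t → s ≡ t
      g-inj (a , c) (b , c′) e with crossing⇒ c | crossing⇒ c′
      ... | inj₁ _ | inj₁ _ = Sub-≡ (cong proj₁ (Sum.inj₁-injective e))
      ... | inj₂ _ | inj₂ _ = Sub-≡ (invol-injective IM (cong proj₁ (Sum.inj₂-injective e)))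
      g-inj (a , c) (b , c′) () | inj₁ _ | inj₂ _
      g-inj (a , c) (b , c′) () | inj₂ _ | inj₁ _
    -- In the presence of `M`, gluing all ends of crossing pairs has the same effect as gluing the
    -- `true` ones. With all of them glued, `mate` gives each end a second one on its path, at the
    -- price of `T + T` for the number of points.
    κS : κ + κ + 2 ≤ proj₁ CRS + proj₁ CRS + (T + T)
    κS = ℕ.≤-trans (glue-pairs F crossing Cκ (classes-cong fw bw (proj₂ CRS)) (proj₂ FD)
        (proj₁ p₀ , crossingX⇒crossing (proj₂ p₀))
        (λ s → mate s , mate-≢ s , mate-related s)) (ℕ.+-monoʳ-≤ (proj₁ CRS + proj₁ CRS) D≤2T)
      where
      G : Rel A 0ℓ
      G = paths ∪ glue crossing
      fw : ∀ {a b} → (R ∪ gr S) a b → EqClosure G a b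
      fw (inj₂ r) = cl₁ (inj₁ r)
      fw (inj₁ (inj₂ (s , t))) = cl₂ (crossingX⇒crossing s , crossingX⇒crossing t)
      fw {a} (inj₁ (inj₁ refl)) with crossing a in ca
      ... | true = cl₂ (ca , trans (crossing-B a) ca)
      ... | false = cl₁ (inj₂ (ca , refl))
      to-D : ∀ {a} → crossing a ≡ true → ∃[ b ] (D b ≡ true × EqClosure (R ∪ gr S) a b)
      to-D {a} c with crossing⇒ c
      ... | inj₁ e = a , e , ε
      ... | inj₂ e = M a , e , cl₁ (inj₁ refl)
      bw : ∀ {a b} → G a b → EqClosure (R ∪ gr S) a b
      bw (inj₁ (inj₁ r)) = cl₂ r
      bw (inj₁ (inj₂ (_ , r))) = cl₁ (inj₁ r)
      bw (inj₂ (c , c′)) with to-D c | to-D c′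
      ... | _ , d , r | _ , d′ , r′ = r ◅◅ cl₁ (inj₂ (d , d′)) ◅◅ cl-sym r′

    arith : ∀ f κ a b r k T → f + f + 2 ≤ a + a + T → κ + κ + 2 ≤ b + b + (T + T) → a + b ≤ r + 1 →
      r + T ≤ k + 1 → (f + f) + (κ + κ) ≤ (k + k) + T
    arith f κ a b r k T h₁ h₂ h₃ h₄ = ℕ.+-cancelʳ-≤ (4 + 2 * (a + b) + 2 * (r + T)) _ _
      (subst₂ _≤_ (lem₁ f κ a b r T) (lem₂ a b r k T)
        (≤-sum (≤-sum h₁ h₂) (≤-sum (≤-sum h₃ h₃) (≤-sum h₄ h₄))))
      where
      lem₁ : ∀ f κ a b r T → (f + f + 2 + (κ + κ + 2)) + ((a + b + (a + b)) + (r + T + (r + T))) ≡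
        (f + f) + (κ + κ) + (4 + 2 * (a + b) + 2 * (r + T))
      lem₁ = solve-∀
      lem₂ : ∀ a b r k T → (a + a + T + (b + b + (T + T))) + ((r + 1 + (r + 1)) + (k + 1 + (k + 1))) ≡
        (k + k) + T + (4 + 2 * (a + b) + 2 * (r + T))
      lem₂ = solve-∀

module Rematch {A : Set} {m : ℕ} (F : A ↔ Fin m) (X : A → Bool)
  {S : A → A} (IS : FPFInvolution S) (XS : ∀ a → X (S a) ≡ X a)
  (M : A → A) where

  -- `M` stays fixed and measures the faces, `B` is the matching being rebuilt. `B-X` and `B-conn`
  -- say that `S` and `B` form a single class on each colour.
  record Rematching (bound : ℕ → Set) : Set where
    field
      B      : A → A
      B-FPF  : FPFInvolution B
      B-X    : ∀ a → X (B a) ≡ X a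
      B-conn : ∀ a b → X a ≡ X b → EqClosure (gr S ∪ gr B) a b
      f      : ℕ
      B-cls  : Classes (gr M ∪ gr B) f
      B-bnd  : bound f

  weaken : ∀ {P Q} → (∀ {f} → P f → Q f) → Rematching P → Rematching Q
  weaken h r = record { B = B ; B-FPF = B-FPF ; B-X = B-X ; B-conn = B-conn ; f = f ; B-cls = B-cls ; B-bnd = h B-bnd }
    where open Rematching r

  module _ (p₀ q₀ : A) (Xp₀ : X p₀ ≡ true) (Xq₀ : X q₀ ≡ false) where

    two≤ : ∀ {R : Rel A 0ℓ} {κ} → Classes R κ → (∀ {a b} → R a b → X a ≡ X b) → 2 ≤ κ
    two≤ {κ = κ} C h = injective⇒≤ Fin↔Fin Fin↔Fin g (g-inj _ _)
      where
      absurd : ∀ {W : Set} → cls C p₀ ≡ cls C q₀ → W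
      absurd e = true≢false Xp₀ (trans (cl-inv h (complete C e)) Xq₀)
      g : Fin 2 → Fin κ
      g zero = cls C p₀
      g (suc _) = cls C q₀
      g-inj : ∀ i j → g i ≡ g j → i ≡ j
      g-inj zero zero _ = refl
      g-inj zero (suc zero) e = absurd e
      g-inj (suc zero) zero e = absurd (sym e)
      g-inj (suc zero) (suc zero) _ = refl

    -- An exchange at two points of the same colour in different classes of `S` and `B` merges these
    -- classes and costs at most one face. Two classes remain, one per colour, so at most `κ − 2`
    -- faces are lost.
    join-pure : ∀ fuel {B : A → A} → FPFInvolution B → (∀ a → X (B a) ≡ X a) →
      ∀ {κ f} → Classes (gr S ∪ gr B) κ → Classes (gr M ∪ gr B) f → κ ≤ fuel →
      Rematching (λ f′ → f + 2 ≤ f′ + κ)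
    join-pure fuel {B} IB XB {κ} {f} Cκ Cf bd
      with search F (λ p → search F (λ q → (X p Bool.≟ X q) ×-dec ¬? (related? Cκ p q)))
    ... | no none = record
      { B = B ; B-FPF = IB ; B-X = XB ; f = f ; B-cls = Cf
      ; B-conn = λ a b e → conn a b e (related? Cκ a b)
      ; B-bnd = ℕ.+-monoʳ-≤ f (two≤ Cκ λ { (inj₁ refl) → sym (XS _) ; (inj₂ refl) → sym (XB _) }) }
      where
      conn : ∀ a b → X a ≡ X b → Dec (EqClosure (gr S ∪ gr B) a b) → EqClosure (gr S ∪ gr B) a b
      conn a b e (yes r) = r
      conn a b e (no ¬r) = ⊥-elim (none (a , b , e , ¬r))
    ... | yes (p , q , Xpq , p≁q) = go fuel bd
      where
      open Swap F IB p q (λ e → p≁q (cl-refl e)) (λ e → p≁q (cl₂ (sym e)))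
      Cκ′ = classes₂ F S swap
      Cf′ = classes₂ F M swap
      κ′<κ : suc (proj₁ Cκ′) ≤ κ
      κ′<κ with add-edge Cκ p q
      ... | inj₁ (r , _) = ⊥-elim (p≁q r)
      ... | inj₂ (_ , d , e , D) = subst (suc (proj₁ Cκ′) ≤_) (sym e) (s≤s (classes-antitone D (proj₂ Cκ′)
        λ { (inj₁ (inj₁ r)) → cl₁ r ; (inj₁ (inj₂ r)) → ⊆swap cl₂ (merge IS p≁q) r
          ; (inj₂ (refl , refl)) → cl₂ swap-p }))
      go : ∀ fuel → κ ≤ fuel → Rematching (λ f′ → f + 2 ≤ f′ + κ)
      go zero z with () ← ℕ.≤-trans κ′<κ z
      go (suc n) bd = weaken
        (λ {f′} h → ℕ.≤-trans (ℕ.+-monoˡ-≤ 2 (swap-classes Cf (proj₂ Cf′)))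
          (ℕ.≤-trans (s≤s h) (ℕ.≤-trans (ℕ.≤-reflexive (sym (ℕ.+-suc f′ _))) (ℕ.+-monoʳ-≤ f′ κ′<κ))))
        (join-pure n swap-FPF (swap-preserves XB Xpq) (proj₂ Cκ′) (proj₂ Cf′)
          (ℕ.≤-pred (ℕ.≤-trans κ′<κ bd)))

    -- A crossing pair is exchanged with one lying on different paths on both sides, as
    -- long as possible; this joins two paths of each colour at the cost of one face.
    rematch : ∀ fuel {B : A → A} (IB : FPFInvolution B) → let open Crossing F X IS XS IB in
      ∀ {κ f T} → Classes paths κ → Classes (gr M ∪ gr B) f → Sub crossingX ↔ Fin T → Sub crossingX →
      T ≤ fuel → Rematching (λ f′ → (f + f) + T ≤ (f′ + f′) + (κ + κ))
    rematch fuel {B} IB {κ} {f} {T} Cκ Cf FT (p , Dp) bd = decide (search FT good?)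
      where
      open Crossing F X IS XS IB
      Xp = proj₁ (crossingX⇒ Dp)
      XBp = proj₂ (crossingX⇒ Dp)

      asEnd : Sub crossingX → End
      asEnd (a , d) = a , crossingX⇒crossing d
      -- The crossing pair at the far end of the path from the `true` end of `s`; `mateY` follows
      -- the path from its `false` end.
      mateX : Sub crossingX → Sub crossingX
      mateX s = proj₁ (mate (asEnd s)) , ok
        where
        Xm : X (proj₁ (mate (asEnd s))) ≡ true
        Xm = trans (sym (paths-X (mate-related (asEnd s)))) (proj₁ (crossingX⇒ (proj₂ s)))
        ok : crossingX (proj₁ (mate (asEnd s))) ≡ true
        ok with crossing⇒ (proj₂ (mate (asEnd s)))
        ... | inj₁ e = e
        ... | inj₂ e = true≢false Xm (trans (sym (cong X (invol IB _))) (proj₂ (crossingX⇒ e)))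
      Bend : Sub crossingX → End
      Bend (a , d) = B a , trans (crossing-B a) (crossingX⇒crossing d)
      mateY : Sub crossingX → Sub crossingX
      mateY s = B (proj₁ (mate (Bend s))) , ok
        where
        Xm : X (proj₁ (mate (Bend s))) ≡ false
        Xm = trans (sym (paths-X (mate-related (Bend s)))) (proj₂ (crossingX⇒ (proj₂ s)))
        ok : crossingX (B (proj₁ (mate (Bend s)))) ≡ true
        ok with crossing⇒ (proj₂ (mate (Bend s)))
        ... | inj₁ e = true≢false (proj₁ (crossingX⇒ e)) Xm
        ... | inj₂ e = e

      s₀ : Sub crossingX
      s₀ = p , Dp
      p₁ = mateX s₀
      p₂ = mateY s₀

      -- Excludes the pairs that share a path with `s₀`: on the `true` side this is `p₁`, on the
      -- `false` side `p₂`.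
      Good : Sub crossingX → Set
      Good s = proj₁ s ≢ p × proj₁ s ≢ proj₁ p₁ × proj₁ s ≢ proj₁ p₂
      good? : ∀ s → Dec (Good s)
      good? s = ¬? (decEq F _ _) ×-dec (¬? (decEq F _ _) ×-dec ¬? (decEq F _ _))

      goodCase : ∀ s → Good s → ∀ fuel → T ≤ fuel → Rematching (λ f′ → (f + f) + T ≤ (f′ + f′) + (κ + κ))
      goodCase (q , Dq) (q≢p , q≢p₁ , q≢p₂) = go
        where
        Xq = proj₁ (crossingX⇒ Dq)
        XBq = proj₂ (crossingX⇒ Dq)
        open Swap F IB p q (λ e → q≢p (sym e)) (λ e → true≢false Xq (trans (cong X e) XBp))
        module C′ = Crossing F X IS XS swap-FPF

        p≁q : ¬ EqClosure paths p q
        p≁q r with mate-unique (asEnd s₀) (asEnd (q , Dq)) r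
        ... | inj₁ e = q≢p (cong proj₁ e)
        ... | inj₂ e = q≢p₁ (cong proj₁ e)
        Bp≁Bq : ¬ EqClosure paths (B p) (B q)
        Bp≁Bq r with mate-unique (Bend s₀) (Bend (q , Dq)) r
        ... | inj₁ e = q≢p (invol-injective IB (cong proj₁ e))
        ... | inj₂ e = q≢p₂ (trans (sym (invol IB q)) (cong (B ∘ proj₁) e))
        Bp≁Bq′ : ¬ EqClosure (paths ∪ edge p q) (B p) (B q)
        Bp≁Bq′ r = Bp≁Bq (proj₂ (cl-pred (λ b → X b ≡ false × EqClosure paths (B p) b)
          (λ { (inj₁ e) (x , s) → trans (sym (paths-X (Eq.return e))) x , (s ◅◅ Eq.return e)
             ; (inj₂ (refl , refl)) (x , s) → true≢false Xp x })
          (λ { (inj₁ e) (x , s) → trans (paths-X (Eq.return e)) x , (s ◅◅ cl-sym (Eq.return e))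
             ; (inj₂ (refl , refl)) (x , s) → true≢false Xq x })
          r (XBp , ε)))

        Cκ′ = C′.path-classes
        Cf′ = classes₂ F M swap
        FT′ = Sub-finite F C′.crossingX
        -- The new pairs are pure and join two paths of each colour; the first join does not spoil
        -- the second, because it happens inside the other colour.
        κ′≤ : 2 + proj₁ Cκ′ ≤ κ
        κ′≤ with add-edge Cκ p q
        ... | inj₁ (r , _) = ⊥-elim (p≁q r)
        ... | inj₂ (_ , d , refl , D) with add-edge D (B p) (B q)
        ...   | inj₁ (r , _) = ⊥-elim (Bp≁Bq′ r)
        ...   | inj₂ (_ , d′ , refl , D′) = s≤s (s≤s (classes-antitone D′ (proj₂ Cκ′) sub))
          where
          pure-at : ∀ {a b} → swap a ≡ b → X a ≡ X b → EqClosure C′.paths a b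
          pure-at {a} refl e = cl₂ (xor-self e , refl)
          sub : ∀ {a b} → ((paths ∪ edge p q) ∪ edge (B p) (B q)) a b → EqClosure C′.paths a b
          sub (inj₁ (inj₁ (inj₁ r))) = cl₁ r
          sub {a} (inj₁ (inj₁ (inj₂ (ca , refl)))) with view a
          ... | at-p refl _ = true≢false (crossingX⇒crossing Dp) ca
          ... | at-q refl _ = true≢false (crossingX⇒crossing Dq) ca
          ... | at-Bp refl _ = true≢false (crossingX⇒crossing Dp) (trans (sym (crossing-B p)) ca)
          ... | at-Bq refl _ = true≢false (crossingX⇒crossing Dq) (trans (sym (crossing-B q)) ca)
          ... | at-else _ _ _ _ e = pure-at e (xor-false ca)
          sub (inj₁ (inj₂ (refl , refl))) = pure-at swap-p (trans Xp (sym Xq))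
          sub (inj₂ (refl , refl)) = pure-at swap-Bp (trans XBp (sym XBq))

        T′≡ : 2 + proj₁ FT′ ≡ T
        T′≡ = size-unique (⊎-size Fin↔Fin (proj₂ FT′)) FT (mk↔ₛ′ to from to∘from from∘to)
          where
          fromD : ∀ {a} → C′.crossingX a ≡ true → crossingX a ≡ true × a ≢ p × a ≢ q
          fromD {a} d with C′.crossingX⇒ d | view a
          ... | x , y | at-p refl e = true≢false (trans (cong X e) Xq) y
          ... | x , y | at-q refl e = true≢false (trans (cong X e) Xp) y
          ... | x , y | at-Bp refl e = true≢false x XBp
          ... | x , y | at-Bq refl e = true≢false x XBq
          ... | x , y | at-else ≢p ≢q _ _ e = ⇒crossingX x (trans (sym (cong X e)) y) , ≢p , ≢q
          toD : ∀ {a} → crossingX a ≡ true → a ≢ p → a ≢ q → C′.crossingX a ≡ true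
          toD {a} d ≢p ≢q with crossingX⇒ d | view a
          ... | _ | at-p e _ = ⊥-elim (≢p e)
          ... | _ | at-q e _ = ⊥-elim (≢q e)
          ... | x , y | at-Bp refl _ = true≢false x XBp
          ... | x , y | at-Bq refl _ = true≢false x XBq
          ... | x , y | at-else _ _ _ _ e = C′.⇒crossingX x (trans (cong X e) y)
          to : Fin 2 ⊎ Sub C′.crossingX → Sub crossingX
          to (inj₁ zero) = p , Dp
          to (inj₁ (suc zero)) = q , Dq
          to (inj₂ (a , d)) = a , proj₁ (fromD d)
          from : Sub crossingX → Fin 2 ⊎ Sub C′.crossingX
          from (a , d) with decEq F a p | decEq F a q
          ... | yes _ | _ = inj₁ zero
          ... | no _ | yes _ = inj₁ (suc zero)
          ... | no ≢p | no ≢q = inj₂ (a , toD d ≢p ≢q)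
          to∘from : ∀ s → to (from s) ≡ s
          to∘from (a , d) with decEq F a p | decEq F a q
          ... | yes e | _ = Sub-≡ (sym e)
          ... | no _ | yes e = Sub-≡ (sym e)
          ... | no _ | no _ = Sub-≡ refl
          from∘to : ∀ s → from (to s) ≡ s
          from∘to (inj₁ zero) with decEq F p p
          ... | yes _ = refl
          ... | no ¬e = ⊥-elim (¬e refl)
          from∘to (inj₁ (suc zero)) with decEq F q p | decEq F q q
          ... | yes e | _ = ⊥-elim (q≢p e)
          ... | no _ | yes _ = refl
          ... | no _ | no ¬e = ⊥-elim (¬e refl)
          from∘to (inj₂ (a , d)) with decEq F a p | decEq F a q
          ... | yes e | _ = ⊥-elim (proj₁ (proj₂ (fromD d)) e)
          ... | no _ | yes e = ⊥-elim (proj₂ (proj₂ (fromD d)) e)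
          ... | no _ | no _ = cong inj₂ (Sub-≡ refl)

        -- The pair of `p₁` survives the exchange, so the recursion again has a crossing pair to
        -- start from.
        p₁′ : Sub C′.crossingX
        p₁′ = proj₁ p₁ , C′.⇒crossingX (proj₁ (crossingX⇒ (proj₂ p₁))) X′
          where
          X′ : X (swap (proj₁ p₁)) ≡ false
          X′ with view (proj₁ p₁)
          ... | at-p e _ = ⊥-elim (mate-≢ (asEnd s₀) e)
          ... | at-q e _ = ⊥-elim (q≢p₁ (sym e))
          ... | at-Bp e _ = true≢false (proj₁ (crossingX⇒ (proj₂ p₁))) (trans (cong X e) XBp)
          ... | at-Bq e _ = true≢false (proj₁ (crossingX⇒ (proj₂ p₁))) (trans (cong X e) XBq)
          ... | at-else _ _ _ _ e = trans (cong X e) (proj₂ (crossingX⇒ (proj₂ p₁)))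

        -- The balance of one exchange: `2f + T` drops by at most 4, and `2κ` by at least 4.
        arith : ∀ f f₁ f′ T₁ κ₁ → f ≤ suc f₁ → 2 + κ₁ ≤ κ → (f₁ + f₁) + T₁ ≤ (f′ + f′) + (κ₁ + κ₁) →
          (f + f) + (2 + T₁) ≤ (f′ + f′) + (κ + κ)
        arith f f₁ f′ T₁ κ₁ h₁ h₂ h₃ = ℕ.≤-trans (ℕ.+-monoˡ-≤ (2 + T₁) (≤-sum h₁ h₁))
          (ℕ.≤-trans (subst₂ _≤_ (lem₁ f₁ T₁) (lem₂ f′ κ₁) (ℕ.+-monoʳ-≤ 4 h₃))
            (ℕ.+-monoʳ-≤ (f′ + f′) (≤-sum h₂ h₂)))
          where
          lem₁ : ∀ f T → 4 + ((f + f) + T) ≡ (suc f + suc f) + (2 + T)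
          lem₁ = solve-∀
          lem₂ : ∀ f κ → 4 + ((f + f) + (κ + κ)) ≡ (f + f) + ((2 + κ) + (2 + κ))
          lem₂ = solve-∀

        go : ∀ fuel → T ≤ fuel → Rematching (λ f′ → (f + f) + T ≤ (f′ + f′) + (κ + κ))
        go zero z with () ← subst (_≤ 0) (sym T′≡) z
        go (suc n) bd = weaken
          (λ {f′} h → subst (λ t → (f + f) + t ≤ (f′ + f′) + (κ + κ)) T′≡
            (arith f (proj₁ Cf′) f′ (proj₁ FT′) (proj₁ Cκ′) (swap-classes Cf (proj₂ Cf′)) κ′≤ h))
          (rematch n swap-FPF (proj₂ Cκ′) (proj₂ Cf′) (proj₂ FT′) p₁′
            (ℕ.≤-pred (ℕ.≤-trans (ℕ.n≤1+n _) (subst (_≤ suc n) (sym T′≡) bd))))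

      -- All crossing pairs are among `s₀`, `p₁`, `p₂`, and `mateX` pairs them off, so `p₂ ≡ p₁` and
      -- only two are left. Exchanging these two makes the matching pure without adding a class, and
      -- `join-pure` finishes.
      lastCase : ¬ ∃ Good → Rematching (λ f′ → (f + f) + T ≤ (f′ + f′) + (κ + κ))
      lastCase none = weaken
        (λ {f′} h → arith f (proj₁ Cf′) f′ T (proj₁ Cκ′) (swap-classes Cf (proj₂ Cf′)) κ′≤κ T≤2 h)
        (join-pure (proj₁ Cκ′) swap-FPF pure (proj₂ Cκ′) (proj₂ Cf′) ℕ.≤-refl)
        where
        three : ∀ s → s ≡ s₀ ⊎ s ≡ p₁ ⊎ s ≡ p₂
        three s with decEq F (proj₁ s) p | decEq F (proj₁ s) (proj₁ p₁) | decEq F (proj₁ s) (proj₁ p₂)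
        ... | yes e | _ | _ = inj₁ (Sub-≡ e)
        ... | no _ | yes e | _ = inj₂ (inj₁ (Sub-≡ e))
        ... | no _ | no _ | yes e = inj₂ (inj₂ (Sub-≡ e))
        ... | no a | no b | no c = ⊥-elim (none (s , a , b , c))
        mateX-invol : ∀ s → mateX (mateX s) ≡ s
        mateX-invol s = Sub-≡ (trans (cong (proj₁ ∘ mate) (Sub-≡ refl)) (cong proj₁ (invol mate-FPF (asEnd s))))
        mateX-fpf : ∀ s → mateX s ≢ s
        mateX-fpf s e = mate-≢ (asEnd s) (cong proj₁ e)
        p₂≢s₀ : p₂ ≢ s₀
        p₂≢s₀ e = mate-≢ (Bend s₀) (trans (sym (invol IB _)) (cong (B ∘ proj₁) e))
        p₂≡p₁ : p₂ ≡ p₁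
        p₂≡p₁ = go (three (mateX p₂))
          where
          go : mateX p₂ ≡ s₀ ⊎ mateX p₂ ≡ p₁ ⊎ mateX p₂ ≡ p₂ → p₂ ≡ p₁
          go (inj₁ e) = trans (sym (mateX-invol p₂)) (cong mateX e)
          go (inj₂ (inj₁ e)) = ⊥-elim (p₂≢s₀ (trans (sym (mateX-invol p₂)) (trans (cong mateX e) (mateX-invol s₀))))
          go (inj₂ (inj₂ e)) = ⊥-elim (mateX-fpf p₂ e)
        two : ∀ s → s ≡ s₀ ⊎ s ≡ p₁
        two s with three s
        ... | inj₁ e = inj₁ e
        ... | inj₂ (inj₁ e) = inj₂ e
        ... | inj₂ (inj₂ e) = inj₂ (trans e p₂≡p₁)
        T≤2 : T ≤ 2
        T≤2 = injective⇒≤ FT Fin↔Fin g (λ {s} {t} → g-inj s t)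
          where
          g : Sub crossingX → Fin 2
          g s with two s
          ... | inj₁ _ = zero
          ... | inj₂ _ = suc zero
          g-inj : ∀ s t → g s ≡ g t → s ≡ t
          g-inj s t e with two s | two t
          ... | inj₁ a | inj₁ b = trans a (sym b)
          ... | inj₂ a | inj₂ b = trans a (sym b)
          g-inj s t () | inj₁ _ | inj₂ _
          g-inj s t () | inj₂ _ | inj₁ _
        q = proj₁ p₁
        Xq = proj₁ (crossingX⇒ (proj₂ p₁))
        XBq = proj₂ (crossingX⇒ (proj₂ p₁))
        open Swap F IB p q (λ e → mate-≢ (asEnd s₀) (sym e)) (λ e → true≢false Xq (trans (cong X e) XBp))
        Cκ′ = classes₂ F S swap
        Cf′ = classes₂ F M swap
        pure : ∀ a → X (swap a) ≡ X a
        pure a with view a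
        ... | at-p refl e = trans (cong X e) (trans Xq (sym Xp))
        ... | at-q refl e = trans (cong X e) (trans Xp (sym Xq))
        ... | at-Bp refl e = trans (cong X e) (trans XBq (sym XBp))
        ... | at-Bq refl e = trans (cong X e) (trans XBp (sym XBq))
        ... | at-else ≢p ≢q ≢Bp ≢Bq e with crossing a in ca
        ...   | false = trans (cong X e) (sym (xor-false ca))
        ...   | true with crossing⇒ ca
        ...     | inj₁ d with two (a , d)
        ...       | inj₁ eq = ⊥-elim (≢p (cong proj₁ eq))
        ...       | inj₂ eq = ⊥-elim (≢q (cong proj₁ eq))
        pure a | at-else ≢p ≢q ≢Bp ≢Bq e | true | inj₂ d with two (B a , d)
        ...       | inj₁ eq = ⊥-elim (≢Bp (trans (sym (invol IB a)) (cong (B ∘ proj₁) eq)))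
        ...       | inj₂ eq = ⊥-elim (≢Bq (trans (sym (invol IB a)) (cong (B ∘ proj₁) eq)))
        κ′≤κ : proj₁ Cκ′ ≤ κ
        κ′≤κ = classes-antitone Cκ (proj₂ Cκ′) sub
          where
          sub : ∀ {a b} → paths a b → EqClosure (gr S ∪ gr swap) a b
          sub (inj₁ r) = cl₁ r
          sub {a} (inj₂ (ca , refl)) with view a
          ... | at-p refl _ = true≢false (crossingX⇒crossing Dp) ca
          ... | at-q refl _ = true≢false (crossingX⇒crossing (proj₂ p₁)) ca
          ... | at-Bp refl _ = true≢false (crossingX⇒crossing Dp) (trans (sym (crossing-B p)) ca)
          ... | at-Bq refl _ = true≢false (crossingX⇒crossing (proj₂ p₁)) (trans (sym (crossing-B q)) ca)
          ... | at-else _ _ _ _ e = cl₂ e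
        arith : ∀ f f₁ f′ T κ₁ → f ≤ suc f₁ → κ₁ ≤ κ → T ≤ 2 → f₁ + 2 ≤ f′ + κ₁ →
          (f + f) + T ≤ (f′ + f′) + (κ + κ)
        arith f f₁ f′ T κ₁ h₁ h₂ h₃ h₄ = ℕ.≤-trans (≤-sum (≤-sum h₁ h₁) h₃)
          (ℕ.≤-trans (ℕ.≤-reflexive (lem₁ f₁)) (ℕ.≤-trans (≤-sum h₄ h₄)
            (ℕ.≤-trans (ℕ.≤-reflexive (lem₂ f′ κ₁)) (ℕ.+-monoʳ-≤ (f′ + f′) (≤-sum h₂ h₂)))))
          where
          lem₁ : ∀ f → (suc f + suc f) + 2 ≡ (f + 2) + (f + 2)
          lem₁ = solve-∀
          lem₂ : ∀ f κ → (f + κ) + (f + κ) ≡ (f + f) + (κ + κ)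
          lem₂ = solve-∀

      decide : Dec (∃ Good) → Rematching (λ f′ → (f + f) + T ≤ (f′ + f′) + (κ + κ))
      decide (yes (s , g)) = goodCase s g fuel bd
      decide (no none) = lastCase none

-- Components, flags and embeddings

any⇒ : {A : Set} (p : A → Bool) (xs : List A) → any p xs ≡ true → ∃[ a ] p a ≡ true
any⇒ p (a ∷ xs) e with p a in pa
... | true = a , pa
... | false = any⇒ p xs e

⇒any : {A : Set} (p : A → Bool) {xs : List A} {a : A} → a ∈ xs → p a ≡ true → any p xs ≡ true
⇒any p {b ∷ xs} (here refl) e = cong (_∨ any p xs) e
⇒any p {b ∷ _} (there i) e = trans (cong (p b ∨_) (⇒any p i e)) (Bool.∨-zeroʳ (p b))

all⇒ : {A : Set} (p : A → Bool) {xs : List A} {a : A} → a ∈ xs → all p xs ≡ true → p a ≡ true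
all⇒ p (here refl) e = proj₁ (∧-true e)
all⇒ p {b ∷ _} (there i) e = all⇒ p i (proj₂ (∧-true {p b} e))

⇒all : {A : Set} (p : A → Bool) (xs : List A) → (∀ a → p a ≡ true) → all p xs ≡ true
⇒all p [] h = refl
⇒all p (a ∷ xs) h = cong₂ _∧_ (h a) (⇒all p xs h)

∨-true : ∀ {a b} → a ∨ b ≡ true → a ≡ true ⊎ b ≡ true
∨-true {true} _ = inj₁ refl
∨-true {false} e = inj₂ e

∨-true₁ : ∀ {a b} → a ≡ true → a ∨ b ≡ true
∨-true₁ refl = refl

∨-true₂ : ∀ {a b} → b ≡ true → a ∨ b ≡ true
∨-true₂ {a} refl = Bool.∨-zeroʳ a

countB-tabulate : {A : Set} (p : A → Bool) {m : ℕ} (f : Fin m → A) → countB p (tabulate f) ≡ countF (p ∘ f)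
countB-tabulate p {zero} f = refl
countB-tabulate p {suc m} f with p (f zero)
... | true = cong suc (countB-tabulate p (f ∘ suc))
... | false = countB-tabulate p (f ∘ suc)

least : ∀ {m} {P : Fin m → Set} → (∀ i → Dec (P i)) → ∃ P → ∃[ i ] (P i × ∀ j → toℕ j < toℕ i → ¬ P j)
least {suc m} P? (i , p) with P? zero
... | yes p₀ = zero , p₀ , λ _ ()
least {suc m} P? (zero , p) | no ¬p₀ = ⊥-elim (¬p₀ p)
least {suc m} P? (suc i , p) | no ¬p₀ with least (P? ∘ suc) (i , p)
... | j , q , min = suc j , q , λ { zero _ → ¬p₀ ; (suc k) (s≤s lt) → min k lt }

bool-rel : {A : Set} → (A → A → Bool) → Rel A 0ℓ
bool-rel R a b = R a b ≡ true

module _ (m : ℕ) (R : Fin m → Fin m → Bool) where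

  reachB-sound : ∀ k i j → reachB m R k i j ≡ true → EqClosure (bool-rel R) i j
  reachB-sound zero i j e = cl-refl (true⇒ (i ≟ j) e)
  reachB-sound (suc k) i j e with ∨-true {reachB m R k i j} e
  ... | inj₁ e′ = reachB-sound k i j e′
  ... | inj₂ e′ with any⇒ _ (allFin m) e′
  ...   | w , e″ with ∧-true {reachB m R k i w} e″
  ...     | r , s with ∨-true {R w j} s
  ...       | inj₁ s′ = reachB-sound k i w r ◅◅ Eq.return s′
  ...       | inj₂ s′ = reachB-sound k i w r ◅◅ cl-sym (Eq.return s′)

  module _ (i : Fin m) where
    private
      r : ℕ → Fin m → Bool
      r k = reachB m R k i

      r-mono : ∀ {k l} → k ≤ l → ∀ j → r k j ≡ true → r l j ≡ true
      r-mono {k} {l} k≤l j e with ℕ.m≤n⇒m<n∨m≡n k≤l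
      ... | inj₂ refl = e
      r-mono {k} {suc l} k≤l j e | inj₁ (s≤s k≤l′) = ∨-true₁ (r-mono k≤l′ j e)

      r-step : ∀ k {a b} → (R a b ∨ R b a) ≡ true → r k a ≡ true → r (suc k) b ≡ true
      r-step k {a} {b} e ra = ∨-true₂ {r k b} (⇒any _ (∈.∈-allFin a) (cong₂ _∧_ ra e))

      Stable : ℕ → Set
      Stable k = ∀ j → r (suc k) j ≡ true → r k j ≡ true

      grow : ∀ k → ¬ Stable k → suc (countF (r k)) ≤ countF (r (suc k))
      grow k ¬st with Fin.any? (λ j → (r (suc k) j Bool.≟ true) ×-dec ¬? (r k j Bool.≟ true))
      ... | no none = ⊥-elim (¬st λ j e → st j e (r k j Bool.≟ true))
        where
        st : ∀ j → r (suc k) j ≡ true → Dec (r k j ≡ true) → r k j ≡ true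
        st j e (yes p) = p
        st j e (no ¬p) = ⊥-elim (none (j , e , ¬p))
      ... | yes (j , new , old) = injective⇒≤ (⊎-size Unit↔Fin1 (Sub-Fin (r k))) (Sub-Fin (r (suc k))) g (g-inj _ _)
        where
        g : ⊤ ⊎ Sub (r k) → Sub (r (suc k))
        g (inj₁ _) = j , new
        g (inj₂ (a , e)) = a , ∨-true₁ e
        g-inj : ∀ s t → g s ≡ g t → s ≡ t
        g-inj (inj₁ _) (inj₁ _) e = refl
        g-inj (inj₁ _) (inj₂ (a , p)) e = ⊥-elim (old (subst (λ b → r k b ≡ true) (sym (cong proj₁ e)) p))
        g-inj (inj₂ (a , p)) (inj₁ _) e = ⊥-elim (old (subst (λ b → r k b ≡ true) (cong proj₁ e) p))
        g-inj (inj₂ _) (inj₂ _) e = cong inj₂ (Sub-≡ (cong proj₁ e))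

      stable? : ∀ k → Dec (Stable k)
      stable? k = Fin.all? (λ j → imp (r (suc k) j Bool.≟ true) (r k j Bool.≟ true))
        where
        imp : {P Q : Set} → Dec P → Dec Q → Dec (P → Q)
        imp _ (yes q) = yes (λ _ → q)
        imp (no ¬p) (no _) = yes (λ p → ⊥-elim (¬p p))
        imp (yes p) (no ¬q) = no (λ f → ¬q (f p))

      -- Until it stabilises, the reachable set gains a point in every round; there are only `m`
      -- points, so `m` rounds suffice for `reachB`.
      progress : ∀ k → (∃[ l ] (l ≤ k × Stable l)) ⊎ (suc k ≤ countF (r k))
      progress zero = inj₂ (injective⇒≤ Unit↔Fin1 (Sub-Fin (r 0)) (λ _ → i , dec-true (i ≟ i) refl) (λ _ → refl))
      progress (suc k) with progress k
      ... | inj₁ (l , l≤k , st) = inj₁ (l , ℕ.m≤n⇒m≤1+n l≤k , st)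
      ... | inj₂ c with stable? k
      ...   | yes st = inj₁ (k , ℕ.n≤1+n k , st)
      ...   | no ¬st = inj₂ (ℕ.≤-trans (s≤s c) (grow k ¬st))

      saturated : ∃[ l ] (l ≤ m × Stable l)
      saturated with progress m
      ... | inj₁ s = s
      ... | inj₂ c = ⊥-elim (ℕ.1+n≰n (ℕ.≤-trans c
        (injective⇒≤ (Sub-Fin (r m)) Fin↔Fin proj₁ (λ e → Sub-≡ e))))

    reachB-complete : ∀ {j} → EqClosure (bool-rel R) i j → reachB m R m i j ≡ true
    reachB-complete {j} e with saturated
    ... | l , l≤m , st = r-mono l≤m j (cl-pred (λ b → r l b ≡ true)
      (λ {a} {b} e p → st b (r-step l (∨-true₁ e) p))
      (λ {a} {b} e p → st a (r-step l (∨-true₂ {R b a} e) p)) e (r-mono {0} {l} z≤n i (dec-true (i ≟ i) refl)))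

  -- Every class has exactly one least element, and `isMin` singles it out.
  compsFin-classes : ∀ {k} → Classes (bool-rel R) k → compsFin m R ≡ k
  compsFin-classes {k} C = trans (countB-tabulate isMin id) (ℕ.≤-antisym
      (injective⇒≤ (Sub-Fin isMin) Fin↔Fin (cls C ∘ proj₁) (λ {s} {t} e → Sub-≡ (inj s t e)))
      (injective⇒≤ Fin↔Fin (Sub-Fin isMin) h (λ {a} {b} e → trans (sym (h-cls a)) (trans (cong (cls C ∘ proj₁) e) (h-cls b)))))
    where
    isMin : Fin m → Bool
    isMin i = all (λ j → not ((toℕ j <ᵇ toℕ i) ∧ reachB m R m i j)) (allFin m)
    not-before : ∀ {i j} → isMin i ≡ true → EqClosure (bool-rel R) i j → ¬ (toℕ j < toℕ i)
    not-before {i} {j} mi r lt = true≢false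
      (cong₂ _∧_ (Equivalence.to Bool.T-≡ (ℕ.<⇒<ᵇ lt)) (reachB-complete i r))
      (not-true (all⇒ (λ j → not ((toℕ j <ᵇ toℕ i) ∧ reachB m R m i j)) (∈.∈-allFin j) mi))
    inj : ∀ s t → cls C (proj₁ s) ≡ cls C (proj₁ {B = λ i → isMin i ≡ true} t) → proj₁ s ≡ proj₁ t
    inj (i , mi) (j , mj) e with ℕ.<-cmp (toℕ i) (toℕ j)
    ... | Tri.tri< lt _ _ = ⊥-elim (not-before mj (complete C (sym e)) lt)
    ... | Tri.tri≈ _ eq _ = Fin.toℕ-injective eq
    ... | Tri.tri> _ _ gt = ⊥-elim (not-before mi (complete C e) gt)
    first : ∀ c → ∃[ i ] (cls C i ≡ c × ∀ j → toℕ j < toℕ i → cls C j ≢ c)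
    first c = least (λ i → cls C i ≟ c) (rep C c , cls-rep C c)
    h : Fin k → Sub isMin
    h c = proj₁ (first c) , ⇒all _ (allFin m) ok
      where
      i = proj₁ (first c)
      ok : ∀ j → not ((toℕ j <ᵇ toℕ i) ∧ reachB m R m i j) ≡ true
      ok j with toℕ j <ᵇ toℕ i in lt | reachB m R m i j in rj
      ... | false | _ = refl
      ... | true | false = refl
      ... | true | true = ⊥-elim (proj₂ (proj₂ (first c)) j (ℕ.<ᵇ⇒< _ _ (Equivalence.from Bool.T-≡ lt))
            (trans (sym (sound* C (reachB-sound m i j rj))) (proj₁ (proj₂ (first c)))))
    h-cls : ∀ c → cls C (proj₁ (h c)) ≡ c
    h-cls c = proj₁ (proj₂ (first c))

  comps-classes : Classes (bool-rel R) (compsFin m R)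
  comps-classes with classes Fin↔Fin {bool-rel R} (λ a b → R a b Bool.≟ true)
  ... | k , C = subst (Classes (bool-rel R)) (sym (compsFin-classes C)) C

-- Orbits of an injection, and the two orientations at a vertex

iter-comm : {A : Set} (f : A → A) (i : ℕ) (a : A) → f (iter f i a) ≡ iter f i (f a)
iter-comm f zero a = refl
iter-comm f (suc i) a = cong f (iter-comm f i a)

iter-+ : {A : Set} (f : A → A) (i j : ℕ) (a : A) → iter f (i + j) a ≡ iter f i (iter f j a)
iter-+ f zero j a = refl
iter-+ f (suc i) j a = cong f (iter-+ f i j a)

module _ {A : Set} {m : ℕ} (F : A ↔ Fin m) {f : A → A} (inj : ∀ {a b} → f a ≡ f b → a ≡ b) where

  iter-injective : ∀ i {a b} → iter f i a ≡ iter f i b → a ≡ b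
  iter-injective zero e = e
  iter-injective (suc i) e = iter-injective i (inj e)

  -- Two of the iterates number `0` to `m` agree; cancelling the smaller number of steps leads back
  -- to `a`.
  iter-back : ∀ a → ∃[ i ] iter f i (f a) ≡ a
  iter-back a with Fin.pigeonhole (ℕ.n<1+n m) (λ j → Inverse.to F (iter f (toℕ j) a))
  ... | j , k , j<k , e with ℕ.m≤n⇒∃[o]m+o≡n j<k
  ...   | o , eq = o , sym (iter-injective (toℕ j) (trans (to-injective F e)
          (trans (cong (λ t → iter f t a) (trans (sym eq) (sym (ℕ.+-suc (toℕ j) o)))) (trans (iter-+ f (toℕ j) (suc o) a)
            (cong (iter f (toℕ j)) (iter-comm f o a))))))

  -- A backward step is replaced by going around the cycle, so forward iteration reaches the whole
  -- class.
  iter-closure : ∀ {a b} → EqClosure (gr f) a b → ∃[ i ] iter f i a ≡ b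
  iter-closure ε = 0 , refl
  iter-closure {a} (fwd refl ◅ r) with iter-closure r
  ... | i , e = suc i , trans (iter-comm f i a) e
  iter-closure {a} (_◅_ {j = b} (bwd refl) r) with iter-back b | iter-closure r
  ... | j , e | i , e′ = i + j , trans (iter-+ f i j a) (trans (cong (iter f i) e) e′)

-- A rotation agreeing with the reflection S at a point would give a fixed point of a
-- conjugate of S or N.
module _ {A : Set} {S N : A → A} (IS : FPFInvolution S) (IN : FPFInvolution N) where

  rotation≢reflection : ∀ i a → iter (N ∘ S) i a ≢ S a
  rotation≢reflection zero a e = fpf IS a (sym e)
  rotation≢reflection (suc zero) a e = fpf IN (S a) e
  rotation≢reflection (suc (suc i)) a e = rotation≢reflection i (N (S a))
    (invol-injective IS (trans (flip′ (trans (sym (cong (N ∘ S) (iter-comm (N ∘ S) i a))) e)) (sym (invol IS _))))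
    where
    flip′ : ∀ {b} → N b ≡ S a → b ≡ N (S a)
    flip′ e = sym (flip IN e)

  module _ {m : ℕ} (F : A ↔ Fin m) where
    private
      Cv = proj₂ (classes₂ F S N)
      Cσ = proj₂ (classes₁ F (N ∘ S))
      σ-inj : ∀ {a b} → N (S a) ≡ N (S b) → a ≡ b
      σ-inj e = invol-injective IS (invol-injective IN e)
      base : A → A
      base a = rep Cv (cls Cv a)
      -- A class of `S` and `N` consists of the orbit of its representative under `N ∘ S` and the
      -- image of that orbit under `S`.
      either : ∀ a → EqClosure (gr (N ∘ S)) (base a) a ⊎ EqClosure (gr (N ∘ S)) (base a) (S a)
      either a = cl-pred P step back (rep-cls Cv a) (inj₁ ε)
        where
        P : A → Set
        P b = EqClosure (gr (N ∘ S)) (base a) b ⊎ EqClosure (gr (N ∘ S)) (base a) (S b)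
        pS : ∀ {b c} → S b ≡ c → P b → P c
        pS refl (inj₁ r) = inj₂ (subst (EqClosure _ _) (sym (invol IS _)) r)
        pS refl (inj₂ r) = inj₁ r
        pN : ∀ {b c} → N b ≡ c → P b → P c
        pN {b} refl (inj₁ r) = inj₂ (r ◅◅ cl-sym (Eq.return (trans (cong N (invol IS (N b))) (invol IN b))))
        pN {b} refl (inj₂ r) = inj₁ (r ◅◅ Eq.return (cong N (invol IS b)))
        step : ∀ {b c} → (gr S ∪ gr N) b c → P b → P c
        step (inj₁ e) = pS e
        step (inj₂ e) = pN e
        back : ∀ {b c} → (gr S ∪ gr N) b c → P c → P b
        back (inj₁ e) = pS (flip IS e)
        back (inj₂ e) = pN (flip IN e)
      exclusive : ∀ a → ¬ EqClosure (gr (N ∘ S)) a (S a)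
      exclusive a r with iter-closure F σ-inj r
      ... | i , e = rotation≢reflection i a e
      base-S : ∀ a → base (S a) ≡ base a
      base-S a = cong (rep Cv) (sym (sound Cv (inj₁ refl)))
      base-N : ∀ a → base (N a) ≡ base a
      base-N a = cong (rep Cv) (sym (sound Cv (inj₂ refl)))

    opaque
      -- The two orbits of `N ∘ S` in a class are the two directions of rotation at a vertex. The
      -- colour tells them apart, with `false` on the orbit of the representative; this is what
      -- orients a vertex when a rotation is read off from matchings.
      colour : A → Bool
      colour a = not (does (related? Cσ (base a) a))

      colour-S : ∀ a → colour (S a) ≡ not (colour a)
      colour-S a rewrite base-S a with related? Cσ (base a) a | related? Cσ (base a) (S a) | either a
      ... | yes r | yes s | _ = ⊥-elim (exclusive a (cl-sym r ◅◅ s))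
      ... | yes _ | no _ | _ = refl
      ... | no _ | yes _ | _ = refl
      ... | no ¬r | no ¬s | inj₁ r = ⊥-elim (¬r r)
      ... | no ¬r | no ¬s | inj₂ s = ⊥-elim (¬s s)

      -- N a = (N S)(S a)
      colour-N : ∀ a → colour (N a) ≡ not (colour a)
      colour-N a = trans same (colour-S a)
        where
        step : EqClosure (gr (N ∘ S)) (S a) (N a)
        step = Eq.return (cong N (invol IS a))
        same : colour (N a) ≡ colour (S a)
        same rewrite base-S a | base-N a with related? Cσ (base a) (N a) | related? Cσ (base a) (S a)
        ... | yes _ | yes _ = refl
        ... | no _ | no _ = refl
        ... | yes r | no ¬s = ⊥-elim (¬s (r ◅◅ cl-sym step))
        ... | no ¬r | yes s = ⊥-elim (¬r (s ◅◅ step))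

      colour-orbit : ∀ a b → EqClosure (gr S ∪ gr N) a b → colour a ≡ false → colour b ≡ false →
        ∃[ i ] iter (N ∘ S) i a ≡ b
      colour-orbit a b r ca cb = iter-closure F σ-inj
        (cl-sym (true⇒ (related? Cσ (base a) a) (not-false ca)) ◅◅
         subst (λ t → EqClosure _ t b) (cong (rep Cv) (sym (sound* Cv r))) (true⇒ (related? Cσ (base b) b) (not-false cb)))

-- Counting darts, edges and flags

sumF : ∀ {m} → (Fin m → ℕ) → ℕ
sumF {zero} g = 0
sumF {suc m} g = g zero + sumF (g ∘ suc)

sumL-tabulate : {A : Set} (g : A → ℕ) {m : ℕ} (f : Fin m → A) → sumL g (tabulate f) ≡ sumF (g ∘ f)
sumL-tabulate g {zero} f = refl
sumL-tabulate g {suc m} f = cong (g (f zero) +_) (sumL-tabulate g (f ∘ suc))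

sumF-cong : ∀ {m} {g h : Fin m → ℕ} → (∀ i → g i ≡ h i) → sumF g ≡ sumF h
sumF-cong {zero} e = refl
sumF-cong {suc m} e = cong₂ _+_ (e zero) (sumF-cong (e ∘ suc))

Pairs : ∀ {m k} → (Fin m → Fin k → Bool) → Set
Pairs p = Sub (λ vu → p (proj₁ vu) (proj₂ vu))

Pairs-size : ∀ {m k} (p : Fin m → Fin k → Bool) → Pairs p ↔ Fin (sumF (countF ∘ p))
Pairs-size {zero} p = mk↔ₛ′ (λ { ((() , _) , _) }) (λ ()) (λ ()) (λ { ((() , _) , _) })
Pairs-size {suc m} p = mk↔ₛ′ to from to∘from from∘to ↔∘ ⊎-size (Sub-Fin (p zero)) (Pairs-size (p ∘ suc))
  where
  to : Pairs p → Sub (p zero) ⊎ Pairs (p ∘ suc)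
  to ((zero , u) , e) = inj₁ (u , e)
  to ((suc v , u) , e) = inj₂ ((v , u) , e)
  from : Sub (p zero) ⊎ Pairs (p ∘ suc) → Pairs p
  from (inj₁ (u , e)) = (zero , u) , e
  from (inj₂ ((v , u) , e)) = (suc v , u) , e
  to∘from : ∀ s → to (from s) ≡ s
  to∘from (inj₁ _) = refl
  to∘from (inj₂ _) = refl
  from∘to : ∀ s → from (to s) ≡ s
  from∘to ((zero , _) , _) = refl
  from∘to ((suc _ , _) , _) = refl

==-true : ∀ {m} {u v : Fin m} → u ≡ v → (u == v) ≡ true
==-true {u = u} {v} e = dec-true (u ≟ v) e

==-false : ∀ {m} {u v : Fin m} → u ≢ v → (u == v) ≡ false
==-false {u = u} {v} e = dec-false (u ≟ v) e

true-== : ∀ {m} {u v : Fin m} → (u == v) ≡ true → u ≡ v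
true-== {u = u} {v} e = true⇒ (u ≟ v) e

==-sym : ∀ {m} (u v : Fin m) → (u == v) ≡ (v == u)
==-sym u v with u ≟ v
... | yes e = sym (==-true (sym e))
... | no ¬e = sym (==-false (λ e → ¬e (sym e)))

E-sym : ∀ Γ u v → E Γ u v ≡ E Γ v u
E-sym Γ u v = cong₂ (λ s t → not s ∧ t) (==-sym u v) (Bool.∨-comm (adj Γ u v) (adj Γ v u))

E-≢ : ∀ Γ {u v} → E Γ u v ≡ true → u ≢ v
E-≢ Γ {u} {v} e u≡v = true≢false (==-true u≡v) (not-true (proj₁ (∧-true e)))

E-adj : ∀ Γ {u v} → E Γ u v ≡ true → adj Γ u v ≡ true ⊎ adj Γ v u ≡ true
E-adj Γ {u} {v} e = ∨-true (proj₂ (∧-true {not (u == v)} e))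

E-intro : ∀ Γ {u v} → u ≢ v → adj Γ u v ≡ true ⊎ adj Γ v u ≡ true → E Γ u v ≡ true
E-intro Γ {u} {v} u≢v a = cong₂ (λ s t → not s ∧ t) (==-false u≢v) (lem a)
  where
  lem : adj Γ u v ≡ true ⊎ adj Γ v u ≡ true → adj Γ u v ∨ adj Γ v u ≡ true
  lem (inj₁ p) = ∨-true₁ p
  lem (inj₂ p) = ∨-true₂ {adj Γ u v} p

bool-≡ : ∀ {a b} → (a ≡ true → b ≡ true) → (b ≡ true → a ≡ true) → a ≡ b
bool-≡ {true} {b} f g = sym (f refl)
bool-≡ {false} {false} f g = refl
bool-≡ {false} {true} f g = g refl

isFlag : (Γ : Graph) → Flag Γ → Bool
isFlag Γ (v , u , _) = E Γ v u

record Flg (Γ : Graph) : Set where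
  constructor flg
  field
    vert head : Fin (n Γ)
    side      : Bool
    is-edge   : E Γ vert head ≡ true

open Flg public

triple : {Γ : Graph} → Flg Γ → Flag Γ
triple (flg v u b _) = v , u , b

module _ {Γ : Graph} where

  Flg-≡ : {a b : Flg Γ} → vert a ≡ vert b → head a ≡ head b → side a ≡ side b → a ≡ b
  Flg-≡ {flg v u b e} {flg _ _ _ e′} refl refl refl = cong (flg v u b) (uip e e′)

  flipS : Flg Γ → Flg Γ
  flipS (flg v u b e) = flg v u (not b) e

  flipS-FPF : FPFInvolution flipS
  flipS-FPF = record
    { invol = λ a → Flg-≡ refl refl (Bool.not-involutive (side a))
    ; fpf = λ a e → Bool.not-¬ refl (sym (cong side e)) }

  same-edge : ∀ {a b : Flg Γ} → vert a ≡ vert b → head a ≡ head b → b ≡ a ⊎ b ≡ flipS a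
  same-edge {flg v u true _} {flg _ _ true _} refl refl = inj₁ (Flg-≡ refl refl refl)
  same-edge {flg v u true _} {flg _ _ false _} refl refl = inj₂ (Flg-≡ refl refl refl)
  same-edge {flg v u false _} {flg _ _ true _} refl refl = inj₂ (Flg-≡ refl refl refl)
  same-edge {flg v u false _} {flg _ _ false _} refl refl = inj₁ (Flg-≡ refl refl refl)

module _ (Γ : Graph) where

  -- Reversal pairs off the darts, so the degree sum is even and the rounding in `numEdges` loses
  -- nothing.
  Dart-size : Pairs (E Γ) ↔ Fin (numEdges Γ + numEdges Γ)
  Dart-size = subst (λ k → Pairs (E Γ) ↔ Fin k) eq (Pairs-size (E Γ))
    where
    rev : Pairs (E Γ) → Pairs (E Γ)
    rev ((v , u) , e) = (u , v) , trans (E-sym Γ u v) e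
    rev-FPF : FPFInvolution rev
    rev-FPF = record
      { invol = λ _ → Sub-≡ refl
      ; fpf = λ { ((v , u) , e) eq → E-≢ Γ e (sym (cong (proj₁ ∘ proj₁) eq)) } }
    C = classes₁ (Pairs-size (E Γ)) rev
    d = sumF (countF ∘ E Γ)
    k+k≡d : proj₁ C + proj₁ C ≡ d
    k+k≡d = involution-size rev-FPF (Pairs-size (E Γ)) (proj₂ C)
    num : numEdges Γ ≡ proj₁ C
    num = trans (cong ⌊_/2⌋ (trans (sumL-tabulate (λ u → countB (E Γ u) (allFin (n Γ))) id)
      (trans (sumF-cong (λ v → countB-tabulate (E Γ v) id)) (sym k+k≡d)))) (sym (ℕ.n≡⌊n+n/2⌋ (proj₁ C)))
    eq : d ≡ numEdges Γ + numEdges Γ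
    eq = trans (sym k+k≡d) (sym (cong₂ _+_ num num))

  opaque
    Flg-size : Flg Γ ↔ Fin ((numEdges Γ + numEdges Γ) + (numEdges Γ + numEdges Γ))
    Flg-size = mk↔ₛ′ to from to∘from from∘to ↔∘ ⊎-size Dart-size Dart-size
      where
      to : Flg Γ → Pairs (E Γ) ⊎ Pairs (E Γ)
      to (flg v u true e) = inj₁ ((v , u) , e)
      to (flg v u false e) = inj₂ ((v , u) , e)
      from : Pairs (E Γ) ⊎ Pairs (E Γ) → Flg Γ
      from (inj₁ ((v , u) , e)) = flg v u true e
      from (inj₂ ((v , u) , e)) = flg v u false e
      to∘from : ∀ s → to (from s) ≡ s
      to∘from (inj₁ _) = refl
      to∘from (inj₂ _) = refl
      from∘to : ∀ s → from (to s) ≡ s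
      from∘to (flg _ _ true _) = refl
      from∘to (flg _ _ false _) = refl

  ∈-flags : (a : Flg Γ) → triple a ∈ flags Γ
  ∈-flags (flg v u b e) = ∈.∈-concatMap⁺ _ (AnyP.tabulate⁺ v (∈.∈-concatMap⁺ _ (AnyP.tabulate⁺ u (inner (E Γ v u) e b))))
    where
    inner : ∀ t → t ≡ true → ∀ b → (v , u , b) ∈ (if t then (v , u , true) ∷ (v , u , false) ∷ [] else [])
    inner true _ true = here refl
    inner true _ false = there (here refl)

  flags-∈ : ∀ {a} → a ∈ flags Γ → isFlag Γ a ≡ true
  flags-∈ i with AnyP.tabulate⁻ (∈.∈-concatMap⁻ _ i)
  ... | v , j with AnyP.tabulate⁻ (∈.∈-concatMap⁻ _ j)
  ...   | u , k = inner (E Γ v u) refl k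
    where
    inner : ∀ t → E Γ v u ≡ t → ∀ {a} → a ∈ (if t then (v , u , true) ∷ (v , u , false) ∷ [] else []) → isFlag Γ a ≡ true
    inner true e (here refl) = e
    inner true e (there (here refl)) = e

-- Embedding schemes as pairs of matchings, and back

module Faces (Γ : Graph) (rot : Fin (n Γ) → Fin (n Γ) → Fin (n Γ)) (sig : Fin (n Γ) → Fin (n Γ) → Bool) where

  across : Fin (n Γ) → Fin (n Γ) → Bool → Bool
  across v u b = if positive Γ sig v u then not b else b

  faceB : Flg Γ → Flg Γ → Bool
  faceB a b = faceAdj Γ rot sig (triple a) (triple b)

  Across Corner : Flg Γ → Flg Γ → Set
  Across a b = vert b ≡ head a × head b ≡ vert a × side b ≡ across (vert a) (head a) (side a)
  Corner a b = vert b ≡ vert a × side a ≡ true × side b ≡ false × head b ≡ rot (vert a) (head a)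

  private
    boolEq⇒ : ∀ {a b} → boolEq a b ≡ true → a ≡ b
    boolEq⇒ {true} e = sym e
    boolEq⇒ {false} e = sym (not-true e)
    ⇒boolEq : ∀ {a b} → a ≡ b → boolEq a b ≡ true
    ⇒boolEq {true} refl = refl
    ⇒boolEq {false} refl = refl

  faceB⇒ : ∀ {a b} → faceB a b ≡ true → Across a b ⊎ Corner a b
  faceB⇒ {flg v u b _} {flg v′ u′ b′ _} e with ∨-true {v′ == u ∧ u′ == v ∧ boolEq b′ (across v u b)} e
  ... | inj₁ e₁ with ∧-true {v′ == u} e₁
  ...   | p , e₂ with ∧-true {u′ == v} e₂
  ...     | q , r = inj₁ (true-== p , true-== q , boolEq⇒ {b′} r)
  faceB⇒ {flg v u b _} {flg v′ u′ b′ _} e | inj₂ e₁ with ∧-true {v′ == v} e₁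
  ...   | p , e₂ with ∧-true {b} e₂
  ...     | q , e₃ with ∧-true {not b′} e₃
  ...       | r , s = inj₂ (true-== p , q , not-true r , true-== s)

  ⇒faceB : ∀ {a b} → Across a b ⊎ Corner a b → faceB a b ≡ true
  ⇒faceB {flg v u b _} {flg v′ u′ b′ _} (inj₁ (p , q , r)) =
    ∨-true₁ (cong₂ _∧_ (==-true p) (cong₂ _∧_ (==-true q) (⇒boolEq {b′} r)))
  ⇒faceB {flg v u b _} {flg v′ u′ b′ _} (inj₂ (p , q , r , s)) =
    ∨-true₂ {v′ == u ∧ u′ == v ∧ boolEq b′ (across v u b)}
      (cong₂ _∧_ (==-true p) (cong₂ _∧_ q (cong₂ _∧_ (cong not r) (==-true s))))

  -- Repetitions in the list of flags would be harmless: equal flags have a common neighbour.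
  flags-classes : ∀ {k} → Classes (bool-rel faceB) k →
    compsFin (length (flags Γ)) (λ i j → faceAdj Γ rot sig (lookup (flags Γ) i) (lookup (flags Γ) j)) ≡ k
  flags-classes C = compsFin-classes _ R (classes-transport h s h-resp s-resp sh hs C)
    where
    R : Fin (length (flags Γ)) → Fin (length (flags Γ)) → Bool
    R i j = faceAdj Γ rot sig (lookup (flags Γ) i) (lookup (flags Γ) j)
    h : Flg Γ → Fin (length (flags Γ))
    h a = Any.index (∈-flags Γ a)
    look-h : ∀ a → lookup (flags Γ) (h a) ≡ triple a
    look-h a = sym (AnyP.lookup-index (∈-flags Γ a))
    unpack : (a : Flag Γ) → isFlag Γ a ≡ true → Flg Γ
    unpack (v , u , b) e = flg v u b e
    s : Fin (length (flags Γ)) → Flg Γ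
    s i = unpack (lookup (flags Γ) i) (flags-∈ Γ (∈.∈-lookup {xs = flags Γ} i))
    h-resp : ∀ {a b} → bool-rel faceB a b → EqClosure (bool-rel R) (h a) (h b)
    h-resp {a} {b} e = Eq.return (trans (cong₂ (faceAdj Γ rot sig) (look-h a) (look-h b)) e)
    s-resp : ∀ {i j} → bool-rel R i j → EqClosure (bool-rel faceB) (s i) (s j)
    s-resp e = Eq.return e
    sh : ∀ a → EqClosure (bool-rel faceB) (s (h a)) a
    sh a = cl-refl (Flg-≡ (cong proj₁ (look-h a)) (cong (proj₁ ∘ proj₂) (look-h a)) (cong (proj₂ ∘ proj₂) (look-h a)))
    opposite : Flg Γ → Flg Γ
    opposite (flg v u b e) = flg u v (across v u b) (trans (E-sym Γ u v) e)
    hs : ∀ i → EqClosure (bool-rel R) (h (s i)) i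
    hs i = Eq.return (trans (cong₂ (faceAdj Γ rot sig) (look-h (s i)) (look-h o)) adj-o) ◅◅
      cl-sym (Eq.return (trans (cong (faceAdj Γ rot sig (lookup (flags Γ) i)) (look-h o)) adj-o))
      where
      o = opposite (s i)
      adj-o : faceB (s i) o ≡ true
      adj-o = ⇒faceB {s i} {o} (inj₁ (refl , refl , refl))

-- An embedding as a pair of matchings on the flags: N joins the two flags of a corner,
-- M the two flags on the same side of an edge; the faces are the cycles of M and N.
record MapOn (Γ : Graph) (f : ℕ) : Set where
  field
    N M    : Flg Γ → Flg Γ
    N-FPF  : FPFInvolution N
    N-vert : ∀ a → vert (N a) ≡ vert a
    N-conn : ∀ a b → vert a ≡ vert b → EqClosure (gr flipS ∪ gr N) a b
    M-inv  : ∀ a → M (M a) ≡ a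
    M-vert : ∀ a → vert (M a) ≡ head a
    M-head : ∀ a → head (M a) ≡ vert a
    M-flip : ∀ a → M (flipS a) ≡ flipS (M a)
    faces  : Classes (gr M ∪ gr N) f

  M-FPF : FPFInvolution M
  M-FPF = record { invol = M-inv ; fpf = λ a e → E-≢ Γ (is-edge a) (trans (sym (cong vert e)) (M-vert a)) }

facesOf : (Γ : Graph) → (Fin (n Γ) → Fin (n Γ) → Fin (n Γ)) → (Fin (n Γ) → Fin (n Γ) → Bool) → ℕ
facesOf Γ rot sig = compsFin (length (flags Γ))
  (λ i j → faceAdj Γ rot sig (lookup (flags Γ) i) (lookup (flags Γ) j))

module FromRotation (Γ : Graph) (rot : Fin (n Γ) → Fin (n Γ) → Fin (n Γ)) (isRot : IsRotation Γ rot)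
  (sig : Fin (n Γ) → Fin (n Γ) → Bool) where
  open Faces Γ rot sig

  private
    next : ∀ v → Sub (E Γ v) → Sub (E Γ v)
    next v (u , e) = rot v u , proj₁ (isRot v) u e

    iter-next : ∀ v i s → proj₁ (iter (next v) i s) ≡ iter (rot v) i (proj₁ s)
    iter-next v zero s = refl
    iter-next v (suc i) s = cong (rot v) (iter-next v i s)

    cyclic : ∀ v s t → ∃[ i ] iter (next v) i s ≡ t
    cyclic v s t with proj₂ (isRot v) (proj₁ s) (proj₁ t) (proj₂ s) (proj₂ t)
    ... | i , e = i , Sub-≡ (trans (iter-next v i s) e)

    -- Cyclicity leads from the successor of `s` back to `s`; the same number of steps taken from
    -- `s` stops just before `s`.
    prev : ∀ v → Sub (E Γ v) → Sub (E Γ v)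
    prev v s = iter (next v) (proj₁ (cyclic v (next v s) s)) s

    next-prev : ∀ v s → next v (prev v s) ≡ s
    next-prev v s = trans (iter-comm (next v) (proj₁ (cyclic v (next v s) s)) s) (proj₂ (cyclic v (next v s) s))

    -- The number of steps in `prev` depends on its argument, so this side is obtained by counting:
    -- `prev` is injective by `next-prev`, hence surjective.
    prev-next : ∀ v s → prev v (next v s) ≡ s
    prev-next v s with injective⇒surjective (Sub-Fin (E Γ v)) (prev v)
        (λ {a} {b} e → trans (sym (next-prev v a)) (trans (cong (next v) e) (next-prev v b))) s
    ... | t , refl = cong (prev v) (next-prev v t)

    -- The corner between `u` and its successor lies on side `true` of `u` and on side `false` of
    -- the successor.
    N : Flg Γ → Flg Γ
    N (flg v u true e) = flg v (proj₁ (next v (u , e))) false (proj₂ (next v (u , e)))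
    N (flg v u false e) = flg v (proj₁ (prev v (u , e))) true (proj₂ (prev v (u , e)))

    N-FPF : FPFInvolution N
    N-FPF = record { invol = inv ; fpf = λ { (flg _ _ true _) e → Bool.not-¬ refl (cong side e)
                                           ; (flg _ _ false _) e → Bool.not-¬ refl (cong side e) } }
      where
      inv : ∀ a → N (N a) ≡ a
      inv (flg v u true e) = Flg-≡ refl (cong proj₁ (prev-next v (u , e))) refl
      inv (flg v u false e) = Flg-≡ refl (cong proj₁ (next-prev v (u , e))) refl

    N-vert : ∀ a → vert (N a) ≡ vert a
    N-vert (flg _ _ true _) = refl
    N-vert (flg _ _ false _) = refl

    N-conn : ∀ a b → vert a ≡ vert b → EqClosure (gr flipS ∪ gr N) a b
    N-conn (flg v u c e) (flg _ u′ c′ e′) refl = to-false c ◅◅ around (proj₁ cyc) ◅◅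
      cl-refl (Flg-≡ refl (cong proj₁ (proj₂ cyc)) refl) ◅◅ cl-sym (to-false c′)
      where
      cyc = cyclic v (u , e) (u′ , e′)
      to-false : ∀ {w} {ew : E Γ v w ≡ true} c → EqClosure (gr flipS ∪ gr N) (flg v w c ew) (flg v w false ew)
      to-false true = cl₁ refl
      to-false false = ε
      at : Sub (E Γ v) → Flg Γ
      at (w , ew) = flg v w false ew
      around : ∀ i → EqClosure (gr flipS ∪ gr N) (flg v u false e) (at (iter (next v) i (u , e)))
      around zero = ε
      around (suc i) = around i ◅◅ cl₁ refl ◅◅ cl₂ refl

    positive-sym : ∀ v u → positive Γ sig v u ≡ positive Γ sig u v
    positive-sym v u = Bool.∧-comm (sig v u) (sig u v)

    M : Flg Γ → Flg Γ
    M (flg v u b e) = flg u v (across v u b) (trans (E-sym Γ u v) e)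

    across-inv : ∀ v u b → across u v (across v u b) ≡ b
    across-inv v u b rewrite positive-sym u v with positive Γ sig v u
    ... | true = Bool.not-involutive b
    ... | false = refl

    across-not : ∀ v u b → across v u (not b) ≡ not (across v u b)
    across-not v u b with positive Γ sig v u
    ... | true = refl
    ... | false = refl

    to-faces : ∀ {a b} → (gr M ∪ gr N) a b → EqClosure (bool-rel faceB) a b
    to-faces {a} {b} (inj₁ refl) = Eq.return (⇒faceB {a} {b} (inj₁ (refl , refl , refl)))
    to-faces {a@(flg v u true e)} {b} (inj₂ refl) = Eq.return (⇒faceB {a} {b} (inj₂ (refl , refl , refl , refl)))
    to-faces {a@(flg v u false e)} {b} (inj₂ refl) = cl-sym (Eq.return (⇒faceB {b} {a}
      (inj₂ (refl , refl , refl , sym (cong proj₁ (next-prev v (u , e)))))))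

    from-faces : ∀ {a b} → bool-rel faceB a b → EqClosure (gr M ∪ gr N) a b
    from-faces {a} {b} e with faceB⇒ {a} {b} e
    from-faces {flg v u b e} {flg _ _ _ _} _ | inj₁ (refl , refl , refl) = cl₁ (Flg-≡ refl refl refl)
    from-faces {flg v u true e} {flg _ _ _ _} _ | inj₂ (refl , refl , refl , refl) = cl₂ (Flg-≡ refl refl refl)

  toMap : MapOn Γ (facesOf Γ rot sig)
  toMap with classes₂ (Flg-size Γ) M N
  ... | k , C = record
    { N = N ; M = M ; N-FPF = N-FPF ; N-vert = N-vert ; N-conn = N-conn
    ; M-inv = λ a → Flg-≡ refl refl (across-inv (vert a) (head a) (side a))
    ; M-vert = λ _ → refl ; M-head = λ _ → refl
    ; M-flip = λ a → Flg-≡ refl refl (across-not (vert a) (head a) (side a))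
    ; faces = subst (Classes _) (sym (flags-classes (classes-cong to-faces from-faces C))) C }

module ToRotation {Γ : Graph} {f : ℕ} (μ : MapOn Γ f) where
  open MapOn μ

  private
    FΓ = Flg-size Γ
    o : Flg Γ → Bool
    o = colour flipS-FPF N-FPF FΓ
    o-S : ∀ a → o (flipS a) ≡ not (o a)
    o-S = colour-S flipS-FPF N-FPF FΓ
    o-N : ∀ a → o (N a) ≡ not (o a)
    o-N = colour-N flipS-FPF N-FPF FΓ

    -- Chooses from the two flags of a dart by colour. In a `MapOn` the sides are mere labels; the
    -- colours follow the corners consistently around each vertex and take over their role.
    colour-with : Bool → Flg Γ → Flg Γ
    colour-with c a = if o a xor c then flipS a else a

    with-vert : ∀ c a → vert (colour-with c a) ≡ vert a
    with-vert c a with o a xor c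
    ... | true = refl
    ... | false = refl
    with-head : ∀ c a → head (colour-with c a) ≡ head a
    with-head c a with o a xor c
    ... | true = refl
    ... | false = refl
    xor-true : ∀ {a b} → a xor b ≡ true → not a ≡ b
    xor-true {true} e = sym (not-true e)
    xor-true {false} e = sym e
    with-o : ∀ c a → o (colour-with c a) ≡ c
    with-o c a with o a xor c in e
    ... | true = trans (o-S a) (xor-true e)
    ... | false = xor-false e

    determined : ∀ {a b} → vert a ≡ vert b → head a ≡ head b → o a ≡ o b → a ≡ b
    determined {a} {b} p q r with same-edge p q
    ... | inj₁ e = sym e
    ... | inj₂ refl = ⊥-elim (Bool.not-¬ refl (trans r (o-S a)))

    -- As `N` changes the colour, the rotation leaves an edge at its flag of colour `true` and
    -- enters the next at its flag of colour `false`.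
    exit entry : ∀ {v u} → E Γ v u ≡ true → Flg Γ
    exit e = colour-with true (flg _ _ true e)
    entry e = colour-with false (flg _ _ true e)

    rot-at : ∀ v u t → E Γ v u ≡ t → Fin (n Γ)
    rot-at v u true e = head (N (exit e))
    rot-at v u false e = u

    -- An edge is positive when `M` changes the colour, just as `across` changes the side along
    -- positive edges.
    sig-at : ∀ v u t → E Γ v u ≡ t → Bool
    sig-at v u true e = o (M (flg v u true e)) xor o (flg v u true e)
    sig-at v u false e = true

    rot-at-true : ∀ v u t (e : E Γ v u ≡ t) (e′ : E Γ v u ≡ true) → rot-at v u t e ≡ head (N (exit e′))
    rot-at-true v u true e e′ = cong (head ∘ N) (cong exit (uip e e′))
    rot-at-true v u false e e′ = true≢false e′ e

    sig-at-true : ∀ v u t (e : E Γ v u ≡ t) (e′ : E Γ v u ≡ true) →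
      sig-at v u t e ≡ o (M (flg v u true e′)) xor o (flg v u true e′)
    sig-at-true v u true e e′ = cong (λ e → o (M (flg v u true e)) xor o (flg v u true e)) (uip e e′)
    sig-at-true v u false e e′ = true≢false e′ e

  rot : Fin (n Γ) → Fin (n Γ) → Fin (n Γ)
  rot v u = rot-at v u (E Γ v u) refl

  sig : Fin (n Γ) → Fin (n Γ) → Bool
  sig v u = sig-at v u (E Γ v u) refl

  private
    rot-exit : ∀ a → o a ≡ true → rot (vert a) (head a) ≡ head (N a)
    rot-exit a oa = trans (rot-at-true _ _ _ refl (is-edge a)) (cong (head ∘ N)
      (determined (with-vert true _) (with-head true _) (trans (with-o true _) (sym oa))))

    twist : Flg Γ → Bool
    twist a = o (M a) xor o a

    twist-S : ∀ a → twist (flipS a) ≡ twist a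
    twist-S a = trans (cong₂ _xor_ (trans (cong o (M-flip a)) (o-S (M a))) (o-S a)) (lem (o (M a)) (o a))
      where
      lem : ∀ s t → not s xor not t ≡ s xor t
      lem true true = refl
      lem true false = refl
      lem false true = refl
      lem false false = refl

    sig-twist : ∀ a → sig (vert a) (head a) ≡ twist a
    sig-twist a with same-edge {a = a} {b = flg (vert a) (head a) true (is-edge a)} refl refl
    ... | inj₁ e = trans (sig-at-true _ _ _ refl (is-edge a)) (cong twist e)
    ... | inj₂ e = trans (sig-at-true _ _ _ refl (is-edge a)) (trans (cong twist e) (twist-S a))

    twist-M : ∀ a → twist (M a) ≡ twist a
    twist-M a = trans (cong (λ b → o b xor o (M a)) (M-inv a)) (Bool.xor-comm (o a) (o (M a)))

    positive-twist : ∀ a → positive Γ sig (vert a) (head a) ≡ twist a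
    positive-twist a = trans (cong₂ _∧_ (sig-twist a) (trans (cong₂ sig (sym (M-vert a)) (sym (M-head a)))
      (trans (sig-twist (M a)) (twist-M a)))) (Bool.∧-idem (twist a))

  isRotation : IsRotation Γ rot
  isRotation v = nbr , around
    where
    nbr : ∀ u → E Γ v u ≡ true → E Γ v (rot v u) ≡ true
    nbr u e = subst₂ (λ s t → E Γ s t ≡ true) (trans (N-vert (exit e)) (with-vert true _))
      (sym (rot-at-true v u _ refl e)) (is-edge (N (exit e)))
    -- On flags of colour `false`, one turn of `rot` is `N ∘ flipS`.
    orbit : ∀ i a → vert a ≡ v → o a ≡ false →
      let b = iter (N ∘ flipS) i a in vert b ≡ v × o b ≡ false × head b ≡ iter (rot v) i (head a)
    orbit zero a va oa = va , oa , refl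
    orbit (suc i) a va oa with orbit i a va oa
    ... | vb , ob , hb = trans (N-vert _) vb , trans (o-N _) (cong not ox) , (begin
        head (N (flipS b)) ≡⟨ sym (rot-exit (flipS b) ox) ⟩
        rot (vert b) (head b) ≡⟨ cong₂ rot vb hb ⟩
        rot v (iter (rot v) i (head a)) ∎)
      where
      open ≡-Reasoning
      b = iter (N ∘ flipS) i a
      ox : o (flipS b) ≡ true
      ox = trans (o-S b) (cong not ob)
    around : ∀ u w → E Γ v u ≡ true → E Γ v w ≡ true → ∃[ i ] iter (rot v) i u ≡ w
    around u w eu ew with colour-orbit flipS-FPF N-FPF FΓ (entry eu) (entry ew)
      (N-conn _ _ (trans (with-vert false _) (sym (with-vert false _)))) (with-o false _) (with-o false _)
    ... | i , e = i , trans (cong (iter (rot v) i) (sym (with-head false (flg v u true eu))))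
      (trans (sym (proj₂ (proj₂ (orbit i (entry eu) (with-vert false _) (with-o false _)))))
        (trans (cong head e) (with-head false _)))

  private
    open Faces Γ rot sig
    recolour : Flg Γ → Flg Γ
    recolour a = flg (vert a) (head a) (o a) (is-edge a)
    uncolour : Flg Γ → Flg Γ
    uncolour a = colour-with (side a) a

    un-re : ∀ a → uncolour (recolour a) ≡ a
    un-re a = determined (with-vert _ _) (with-head _ _) (with-o _ _)
    re-un : ∀ a → recolour (uncolour a) ≡ a
    re-un a = Flg-≡ (with-vert _ _) (with-head _ _) (with-o _ _)

    across-M : ∀ a → o (M a) ≡ across (vert a) (head a) (o a)
    across-M a rewrite positive-twist a with o (M a) | o a
    ... | true | true = refl
    ... | true | false = refl
    ... | false | true = refl
    ... | false | false = refl

    re-resp : ∀ {a b} → (gr M ∪ gr N) a b → EqClosure (bool-rel faceB) (recolour a) (recolour b)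
    re-resp {a} (inj₁ refl) = Eq.return (⇒faceB {recolour a} {recolour (M a)} (inj₁ (M-vert a , M-head a , across-M a)))
    re-resp {a} (inj₂ refl) = go (o a) refl
      where
      go : ∀ c → o a ≡ c → EqClosure (bool-rel faceB) (recolour a) (recolour (N a))
      go true oa = Eq.return (⇒faceB {recolour a} {recolour (N a)}
        (inj₂ (N-vert a , oa , trans (o-N a) (cong not oa) , sym (rot-exit a oa))))
      go false oa = cl-sym (Eq.return (⇒faceB {recolour (N a)} {recolour a}
        (inj₂ (sym (N-vert a) , oN , oa , sym (trans (rot-exit (N a) oN) (cong head (invol N-FPF a)))))))
        where
        oN = trans (o-N a) (cong not oa)

    un-resp : ∀ {a b} → bool-rel faceB a b → EqClosure (gr M ∪ gr N) (uncolour a) (uncolour b)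
    un-resp {a} {b} e with faceB⇒ {a} {b} e
    ... | inj₁ (p , q , r) = cl₁ (determined
        (trans (M-vert _) (trans (with-head _ _) (trans (sym p) (sym (with-vert _ _)))))
        (trans (M-head _) (trans (with-vert _ _) (trans (sym q) (sym (with-head _ _)))))
        (trans (across-M _) (trans (trans (cong₂ (λ s t → across s t (o (uncolour a))) (with-vert (side a) a) (with-head (side a) a))
          (cong (across (vert a) (head a)) (with-o (side a) a))) (trans (sym r) (sym (with-o _ _))))))
    ... | inj₂ (p , q , r , s) = cl₂ (determined
        (trans (N-vert _) (trans (with-vert _ _) (trans (sym p) (sym (with-vert _ _)))))
        (trans (sym (rot-exit (uncolour a) (trans (with-o _ _) q))) (trans (cong₂ rot (with-vert _ _) (with-head _ _))
          (trans (sym s) (sym (with-head _ _)))))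
        (trans (o-N _) (trans (cong not (trans (with-o _ _) q)) (trans (sym r) (sym (with-o _ _))))))

  faces≡ : facesOf Γ rot sig ≡ f
  faces≡ = flags-classes (classes-transport recolour uncolour re-resp un-resp
    (λ a → cl-refl (un-re a)) (λ a → cl-refl (re-un a)) faces)

-- The Euler bound and the nonnegativity of the Euler genus

isolatedCount : Graph → ℕ
isolatedCount Γ = countB (isolated Γ) (allFin (n Γ))

EulerBound : Graph → ℕ → ℕ → Set
EulerBound Γ k f = 2 * numComps Γ + numEdges Γ ≤ k + n Γ + (f + isolatedCount Γ)

embeds⇒map : ∀ {Γ k} → EmbedsIn Γ k → ∃[ f ] (MapOn Γ f × EulerBound Γ k f)
embeds⇒map {Γ} (rot , isRot , sig , bound) = facesOf Γ rot sig , FromRotation.toMap Γ rot isRot sig , bound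

map⇒embeds : ∀ {Γ k f} → MapOn Γ f → EulerBound Γ k f → EmbedsIn Γ k
map⇒embeds {Γ} {k} μ bound = rot , isRotation , sig , subst (EulerBound Γ k) (sym faces≡) bound
  where open ToRotation μ

isolated⇒ : ∀ Γ {v u} → isolated Γ v ≡ true → E Γ v u ≡ true → ⊥
isolated⇒ Γ {v} {u} i e = true≢false (⇒any (E Γ v) (∈.∈-allFin u) e) (not-true i)

isolated-false : ∀ Γ {v} → isolated Γ v ≡ false → ∃[ u ] E Γ v u ≡ true
isolated-false Γ {v} i = any⇒ (E Γ v) (allFin (n Γ)) (not-false i)

⇒isolated : ∀ Γ {v} → (∀ u → E Γ v u ≡ true → ⊥) → isolated Γ v ≡ true
⇒isolated Γ {v} h = go (isolated Γ v) refl
  where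
  go : ∀ b → isolated Γ v ≡ b → isolated Γ v ≡ true
  go true e = e
  go false e = ⊥-elim (h _ (proj₂ (isolated-false Γ e)))

isolated-size : ∀ Γ → Sub (isolated Γ) ↔ Fin (isolatedCount Γ)
isolated-size Γ = subst (λ k → Sub (isolated Γ) ↔ Fin k) (sym (countB-tabulate (isolated Γ) id)) (Sub-Fin (isolated Γ))

comps : (Γ : Graph) → Classes (bool-rel (E Γ)) (numComps Γ)
comps Γ = comps-classes (n Γ) (E Γ)

module _ {Γ : Graph} {f : ℕ} (μ : MapOn Γ f) where
  open MapOn μ

  -- `euler-inequality` for `M`, `flipS` and `N`: the cycles of `M` and `N` are the faces, those of
  -- `M` and `flipS` the edges, those of `flipS` and `N` the vertices that have an edge, and `M` has
  -- two pairs per edge. An isolated vertex carries no flag and enters separately, as one vertex,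
  -- one face and one component.
  euler-≤ : n Γ + (f + isolatedCount Γ) ≤ 2 * numComps Γ + numEdges Γ
  euler-≤ = arith (n Γ) f iso e (numComps Γ) (proj₁ CSN) (proj₁ CMS) (proj₁ CM) (proj₁ C₃)
    n≤ e≤ (involution-size M-FPF FΓ (proj₂ CM)) c≤
    (euler-inequality FΓ M-FPF flipS-FPF (proj₂ CM) (proj₂ CMS) (proj₁ CM) N-FPF faces (proj₂ CSN) (proj₂ C₃)
      (ℕ.m≤n+m (proj₁ CM) f))
    where
    FΓ = Flg-size Γ
    iso = isolatedCount Γ
    e = numEdges Γ
    CM = classes₁ FΓ M
    CSN = classes₂ FΓ flipS N
    CMS = classes₂ FΓ M flipS
    C₃ = classes₃ FΓ M flipS N

    n≤ : n Γ ≤ proj₁ CSN + iso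
    n≤ = injective⇒≤ Fin↔Fin (⊎-size Fin↔Fin (isolated-size Γ)) g (g-inj _ _)
      where
      at : ∀ v t → isolated Γ v ≡ t → Fin (proj₁ CSN) ⊎ Sub (isolated Γ)
      at v true i = inj₂ (v , i)
      at v false i = inj₁ (cls (proj₂ CSN) (flg v _ true (proj₂ (isolated-false Γ i))))
      g : Fin (n Γ) → Fin (proj₁ CSN) ⊎ Sub (isolated Γ)
      g v = at v (isolated Γ v) refl
      at-inj : ∀ v w s t (i : isolated Γ v ≡ s) (j : isolated Γ w ≡ t) → at v s i ≡ at w t j → v ≡ w
      at-inj v w true true i j eq = cong proj₁ (Sum.inj₂-injective eq)
      at-inj v w false false i j eq = cl-inv {φ = vert}
        (λ { (inj₁ refl) → refl ; (inj₂ refl) → sym (N-vert _) })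
        (complete (proj₂ CSN) (Sum.inj₁-injective eq))
      at-inj v w true false i j ()
      at-inj v w false true i j ()
      g-inj : ∀ v w → g v ≡ g w → v ≡ w
      g-inj v w = at-inj v w _ _ refl refl

    e≤ : e ≤ proj₁ CMS
    e≤ = subst (_≤ proj₁ CMS) half (classes-≤ (proj₂ CR) (proj₂ CMS) (λ { ((v , u) , p) → flg v u true p })
        (cl-map (λ a → (vert a , head a) , is-edge a)
          (λ { {a} (inj₁ refl) → Eq.return (Sub-≡ (cong₂ _,_ (sym (M-vert a)) (sym (M-head a)))) ; (inj₂ refl) → ε })))
      where
      rev : Pairs (E Γ) → Pairs (E Γ)
      rev ((v , u) , p) = (u , v) , trans (E-sym Γ u v) p
      rev-FPF : FPFInvolution rev
      rev-FPF = record { invol = λ _ → Sub-≡ refl ; fpf = λ { ((v , u) , p) eq → E-≢ Γ p (sym (cong (proj₁ ∘ proj₁) eq)) } }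
      CR = classes₁ (Dart-size Γ) rev
      half : proj₁ CR ≡ e
      half = trans (ℕ.n≡⌊n+n/2⌋ (proj₁ CR)) (trans (cong ⌊_/2⌋ (involution-size rev-FPF (Dart-size Γ) (proj₂ CR))) (sym (ℕ.n≡⌊n+n/2⌋ e)))

    c≤ : proj₁ C₃ + iso ≤ numComps Γ
    c≤ = injective⇒≤ (⊎-size Fin↔Fin (isolated-size Γ)) Fin↔Fin g (g-inj _ _)
      where
      R₃ : Rel (Flg Γ) 0ℓ
      R₃ = (gr M ∪ gr flipS) ∪ gr N
      g : Fin (proj₁ C₃) ⊎ Sub (isolated Γ) → Fin (numComps Γ)
      g (inj₁ i) = cls (comps Γ) (vert (rep (proj₂ C₃) i))
      g (inj₂ (v , _)) = cls (comps Γ) v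
      same-vert : ∀ a b → vert a ≡ vert b → EqClosure R₃ a b
      same-vert a b p = cl-map id (λ { (inj₁ r) → cl₁ (inj₂ r) ; (inj₂ r) → cl₂ r }) (N-conn a b p)
      lift : ∀ a {w} → EqClosure (bool-rel (E Γ)) (vert a) w → ∀ b → vert b ≡ w → EqClosure R₃ a b
      lift a r = cl-pred (λ w → ∀ b → vert b ≡ w → EqClosure R₃ a b) (λ {v} {w} → step {v} {w})
          (λ {v} {w} p → step {w} {v} (trans (E-sym Γ w v) p)) r (λ b p → same-vert a b (sym p))
        where
        step : ∀ {v w} → E Γ v w ≡ true → (∀ b → vert b ≡ v → EqClosure R₃ a b) → ∀ b → vert b ≡ w → EqClosure R₃ a b
        step {v} {w} p h b q = h (flg v w true p) refl ◅◅ cl₁ (inj₁ refl) ◅◅ same-vert _ b (trans (M-vert _) (sym q))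
      alone : ∀ {v w} → isolated Γ v ≡ true → EqClosure (bool-rel (E Γ)) v w → w ≡ v
      alone {v} i r = cl-pred (_≡ v) (λ { p refl → ⊥-elim (isolated⇒ Γ i p) })
        (λ { {a} {b} p refl → ⊥-elim (isolated⇒ Γ i (trans (E-sym Γ b a) p)) }) r refl
      g-inj : ∀ s t → g s ≡ g t → s ≡ t
      g-inj (inj₁ i) (inj₁ j) eq = cong inj₁ (trans (sym (cls-rep (proj₂ C₃) i)) (trans
        (sound* (proj₂ C₃) (lift _ (complete (comps Γ) eq) _ refl)) (cls-rep (proj₂ C₃) j)))
      g-inj (inj₁ i) (inj₂ (v , iv)) eq = ⊥-elim (isolated⇒ Γ
        (subst (λ w → isolated Γ w ≡ true) (sym (alone iv (complete (comps Γ) (sym eq)))) iv) (is-edge (rep (proj₂ C₃) i)))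
      g-inj (inj₂ (v , iv)) (inj₁ i) eq = ⊥-elim (isolated⇒ Γ
        (subst (λ w → isolated Γ w ≡ true) (sym (alone iv (complete (comps Γ) eq))) iv) (is-edge (rep (proj₂ C₃) i)))
      g-inj (inj₂ (v , iv)) (inj₂ (w , iw)) eq = cong inj₂ (Sub-≡ (sym (alone iv (complete (comps Γ) eq))))

    arith : ∀ n f i e c a b K d → n ≤ a + i → e ≤ b → K + K ≡ (e + e) + (e + e) → d + i ≤ c →
      (f + a) + b ≤ K + (d + d) → n + (f + i) ≤ 2 * c + e
    arith n f i e c a b K d h₁ h₂ h₃ h₄ h₅ = ℕ.+-cancelʳ-≤ (a + b + e + (d + d) + i) _ _
      (ℕ.≤-trans (subst₂ _≤_ (lem₁ n f i e a b d) (lem₂ i e c a b K d)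
        (≤-sum (≤-sum h₁ h₂) (≤-sum h₅ (≤-sum h₄ h₄))))
        (ℕ.≤-reflexive (trans (cong (λ t → t + (a + i) + b + (d + d) + (c + c)) K≡) (lem₃ i e c a b d))))
      where
      K≡ : K ≡ e + e
      K≡ = trans (ℕ.n≡⌊n+n/2⌋ K) (trans (cong ⌊_/2⌋ h₃) (sym (ℕ.n≡⌊n+n/2⌋ (e + e))))
      lem₁ : ∀ n f i e a b d → (n + e) + (((f + a) + b) + ((d + i) + (d + i))) ≡ n + (f + i) + (a + b + e + (d + d) + i)
      lem₁ = solve-∀
      lem₂ : ∀ i e c a b K d → ((a + i) + b) + ((K + (d + d)) + (c + c)) ≡ K + (a + i) + b + (d + d) + (c + c)
      lem₂ = solve-∀
      lem₃ : ∀ i e c a b d → (e + e) + (a + i) + b + (d + d) + (c + c) ≡ 2 * c + e + (a + b + e + (d + d) + i)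
      lem₃ = solve-∀

-- Separating a matching into two parts

Restrict : {A : Set} (part : A → Bool) (i : Bool) → Set
Restrict part i = Sub (λ a → not (part a xor i))

part⇒ : ∀ {b i} → not (b xor i) ≡ true → b ≡ i
part⇒ e = xor-false (not-true e)

⇒part : ∀ {b i} → b ≡ i → not (b xor i) ≡ true
⇒part e = cong not (xor-self e)

-- With ends of edges as points, `X` as the terminal and `part` as the summand, the fields say that
-- `S` and `B` form one cycle at each terminal of each summand, which is what a rotation there
-- requires.
record Separated {A : Set} (X part : A → Bool) (S M N : A → A) : Set where
  field
    B       : A → A
    B-FPF   : FPFInvolution B
    B-X     : ∀ a → X (B a) ≡ X a
    B-part  : ∀ a → part (B a) ≡ part a
    B-conn  : ∀ a b → X a ≡ X b → part a ≡ part b → EqClosure (gr S ∪ gr B) a b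
    faces-≤ : ∀ {f f′} → Classes (gr M ∪ gr N) f → Classes (gr M ∪ gr B) f′ → f ≤ f′

-- Given N whose faces with M may run through both parts, the matching can be rebuilt inside
-- each part without losing faces.
module Separate {A : Set} {m : ℕ} (F : A ↔ Fin m) (X part : A → Bool)
  {S : A → A} (IS : FPFInvolution S) (XS : ∀ a → X (S a) ≡ X a) (partS : ∀ a → part (S a) ≡ part a)
  {M : A → A} (IM : FPFInvolution M) (partM : ∀ a → part (M a) ≡ part a)
  {N : A → A} (IN : FPFInvolution N) (XN : ∀ a → X (N a) ≡ X a)
  (conn : ∀ a b → X a ≡ X b → EqClosure (gr S ∪ gr N) a b)
  (crosses : ∀ i → ∃[ p ] (part p ≡ i × X p ≡ true × X (M p) ≡ false)) where

  private
    open Crossing F X IS XS IM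

    module Part (i : Bool) where
      A′ : Set
      A′ = Restrict part i

      restrict : (f : A → A) → (∀ a → part (f a) ≡ part a) → A′ → A′
      restrict f h (a , e) = f a , ⇒part (trans (h a) (part⇒ e))

      restrict-FPF : ∀ {f} (h : ∀ a → part (f a) ≡ part a) → FPFInvolution f → FPFInvolution (restrict f h)
      restrict-FPF h I = record { invol = λ { (a , _) → Sub-≡ (invol I a) } ; fpf = λ { (a , _) e → fpf I a (cong proj₁ e) } }

      M′ = restrict M partM
      IS′ = restrict-FPF partS IS
      IM′ = restrict-FPF partM IM
      F′ = proj₂ (Sub-finite F (λ a → not (part a xor i)))
      X′ : A′ → Bool
      X′ = X ∘ proj₁
      module C = Crossing F′ X′ IS′ (XS ∘ proj₁) IM′
      Cκ = C.path-classes
      Ck = classes₁ F′ M′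
      FT = Sub-finite F′ C.crossingX
      p₀ : A
      p₀ = proj₁ (crosses i)
      e₀ : not (part p₀ xor i) ≡ true
      e₀ = ⇒part (proj₁ (proj₂ (crosses i)))
      X₀ : X p₀ ≡ true × X (M p₀) ≡ false
      X₀ = proj₂ (proj₂ (crosses i))
      s₀ : Sub C.crossingX
      s₀ = (p₀ , e₀) , C.⇒crossingX {p₀ , e₀} (proj₁ X₀) (proj₂ X₀)
      module R = Rematch F′ X′ IS′ (XS ∘ proj₁) M′
      result : R.Rematching (λ f′ → (proj₁ Ck + proj₁ Ck) + proj₁ FT ≤ (f′ + f′) + (proj₁ Cκ + proj₁ Cκ))
      -- The rebuilding starts from `M` itself: `M ∪ M` has one class per pair, so the bound reads
      -- `2k₀ + T ≤ 2f′ + 2κ`.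
      result = R.rematch (p₀ , e₀) (M′ (p₀ , e₀)) (proj₁ X₀) (proj₂ X₀) (proj₁ FT) IM′ (proj₂ Cκ)
        (classes-cong cl₁ (λ { (inj₁ r) → Eq.return r ; (inj₂ r) → Eq.return r }) (proj₂ Ck)) (proj₂ FT) s₀ ℕ.≤-refl
      open R.Rematching result public

    module P = Part

    h : Restrict part true ⊎ Restrict part false → A
    h (inj₁ a) = proj₁ a
    h (inj₂ a) = proj₁ a

    s-at : ∀ a b → part a ≡ b → Restrict part true ⊎ Restrict part false
    s-at a true e = inj₁ (a , ⇒part e)
    s-at a false e = inj₂ (a , ⇒part e)

    s : A → Restrict part true ⊎ Restrict part false
    s a = s-at a (part a) refl

    hs : ∀ a → h (s a) ≡ a
    hs a = go (part a) refl
      where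
      go : ∀ b (e : part a ≡ b) → h (s-at a b e) ≡ a
      go true e = refl
      go false e = refl

    s-true : ∀ (a : Restrict part true) → s (proj₁ a) ≡ inj₁ a
    s-true (a , e) = go (part a) refl
      where
      go : ∀ b (q : part a ≡ b) → s-at a b q ≡ inj₁ (a , e)
      go true q = cong inj₁ (Sub-≡ refl)
      go false q = true≢false (part⇒ e) q

    s-false : ∀ (a : Restrict part false) → s (proj₁ a) ≡ inj₂ a
    s-false (a , e) = go (part a) refl
      where
      go : ∀ b (q : part a ≡ b) → s-at a b q ≡ inj₂ (a , e)
      go true q = true≢false q (part⇒ e)
      go false q = cong inj₂ (Sub-≡ refl)

    sh : ∀ t → s (h t) ≡ t
    sh (inj₁ a) = s-true a
    sh (inj₂ a) = s-false a

    combine : ∀ {R : Rel A 0ℓ} {Rt : Rel (Restrict part true) 0ℓ} {Rf : Rel (Restrict part false) 0ℓ} {j k} →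
      (∀ {a b} → Rt a b → EqClosure R (proj₁ a) (proj₁ b)) → (∀ {a b} → Rf a b → EqClosure R (proj₁ a) (proj₁ b)) →
      (∀ {a b} → R (proj₁ a) (proj₁ b) → EqClosure Rt a b) → (∀ {a b} → R (proj₁ a) (proj₁ b) → EqClosure Rf a b) →
      (∀ {a b} → R a b → part a ≡ part b) → Classes Rt j → Classes Rf k → Classes R (j + k)
    combine {R} {Rt} {Rf} t f rt rf pres C D = classes-transport h s h-resp s-resp
      (λ a → cl-refl (sh a)) (λ a → cl-refl (hs a)) (classes-⊎ C D)
      where
      h-resp : ∀ {a b} → Pointwise Rt Rf a b → EqClosure R (h a) (h b)
      h-resp (inj₁ r) = t r
      h-resp (inj₂ r) = f r
      s-resp : ∀ {a b} → R a b → EqClosure (Pointwise Rt Rf) (s a) (s b)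
      s-resp {a} {b} r = go (part a) (part b) refl refl (pres r)
        where
        go : ∀ c d (p : part a ≡ c) (q : part b ≡ d) → part a ≡ part b → EqClosure (Pointwise Rt Rf) (s-at a c p) (s-at b d q)
        go true true p q e = cl-map inj₁ (Eq.return ∘ inj₁) (rt r)
        go false false p q e = cl-map inj₂ (Eq.return ∘ inj₂) (rf r)
        go true false p q e = true≢false p (trans e q)
        go false true p q e = true≢false q (trans (sym e) p)

    sum : Restrict part true ⊎ Restrict part false → Restrict part true ⊎ Restrict part false
    sum (inj₁ a) = inj₁ (P.B true a)
    sum (inj₂ a) = inj₂ (P.B false a)

    sum-invol : ∀ t → sum (sum t) ≡ t
    sum-invol (inj₁ a) = cong inj₁ (invol (P.B-FPF true) a)
    sum-invol (inj₂ a) = cong inj₂ (invol (P.B-FPF false) a)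

    sum-fpf : ∀ t → sum t ≢ t
    sum-fpf (inj₁ a) e = fpf (P.B-FPF true) a (Sum.inj₁-injective e)
    sum-fpf (inj₂ a) e = fpf (P.B-FPF false) a (Sum.inj₂-injective e)

    B : A → A
    B a = h (sum (s a))

    B-true : ∀ (a : Restrict part true) → B (proj₁ a) ≡ proj₁ (P.B true a)
    B-true a = cong (h ∘ sum) (s-true a)
    B-false : ∀ (a : Restrict part false) → B (proj₁ a) ≡ proj₁ (P.B false a)
    B-false a = cong (h ∘ sum) (s-false a)

    by-part : (Q : A → Set) → (∀ (a : Restrict part true) → Q (proj₁ a)) → (∀ (a : Restrict part false) → Q (proj₁ a)) → ∀ a → Q a
    by-part Q t f a = go (part a) refl
      where
      go : ∀ b → part a ≡ b → Q a
      go true e = t (a , ⇒part e)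
      go false e = f (a , ⇒part e)

    B-FPF : FPFInvolution B
    B-FPF = record
      { invol = λ a → trans (cong (h ∘ sum) (sh (sum (s a)))) (trans (cong h (sum-invol (s a))) (hs a))
      ; fpf = λ a e → sum-fpf (s a) (trans (sym (sh (sum (s a)))) (cong s e)) }

    B-X : ∀ a → X (B a) ≡ X a
    B-X = by-part _ (λ a → trans (cong X (B-true a)) (P.B-X true a)) (λ a → trans (cong X (B-false a)) (P.B-X false a))

    B-part : ∀ a → part (B a) ≡ part a
    B-part = by-part _ (λ a → trans (cong part (B-true a)) (trans (part⇒ (proj₂ (P.B true a))) (sym (part⇒ (proj₂ a)))))
      (λ a → trans (cong part (B-false a)) (trans (part⇒ (proj₂ (P.B false a))) (sym (part⇒ (proj₂ a)))))

    B-conn : ∀ a b → X a ≡ X b → part a ≡ part b → EqClosure (gr S ∪ gr B) a b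
    B-conn a b xe pe = go (part a) refl
      where
      go : ∀ c → part a ≡ c → EqClosure (gr S ∪ gr B) a b
      go true e = cl-map proj₁ (λ { (inj₁ refl) → cl₁ refl ; {a} (inj₂ refl) → cl₂ (B-true a) })
        (P.B-conn true (a , ⇒part e) (b , ⇒part (trans (sym pe) e)) xe)
      go false e = cl-map proj₁ (λ { (inj₁ refl) → cl₁ refl ; {a} (inj₂ refl) → cl₂ (B-false a) })
        (P.B-conn false (a , ⇒part e) (b , ⇒part (trans (sym pe) e)) xe)

    -- `crossing-bound` is applied to the whole and the rematchings to the parts. As `κ`, `k₀` and
    -- `T` add up over the parts, the sum of the three inequalities leaves `2f ≤ 2f′`.
    faces-≤ : ∀ {f f′} → Classes (gr M ∪ gr N) f → Classes (gr M ∪ gr B) f′ → f ≤ f′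
    faces-≤ {f} {f′} Cf Cf′ = arith f f′ (κ true) (κ false) (k₀ true) (k₀ false) (T true) (T false) (P.f true) (P.f false)
      (crossing-bound F X IS XS IM IN XN conn Cf Cκ Ck FT p₀) (P.B-bnd true) (P.B-bnd false)
      (classes-unique CB Cf′)
      where
      κ k₀ T : Bool → ℕ
      κ i = proj₁ (P.Cκ i)
      k₀ i = proj₁ (P.Ck i)
      T i = proj₁ (P.FT i)
      CB : Classes (gr M ∪ gr B) (P.f true + P.f false)
      CB = combine
        (λ { (inj₁ refl) → cl₁ refl ; {a} (inj₂ refl) → cl₂ (B-true a) })
        (λ { (inj₁ refl) → cl₁ refl ; {a} (inj₂ refl) → cl₂ (B-false a) })
        (λ { (inj₁ e) → cl₁ (Sub-≡ e) ; {a} (inj₂ e) → cl₂ (Sub-≡ (trans (sym (B-true a)) e)) })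
        (λ { (inj₁ e) → cl₁ (Sub-≡ e) ; {a} (inj₂ e) → cl₂ (Sub-≡ (trans (sym (B-false a)) e)) })
        (λ { {a} (inj₁ refl) → sym (partM a) ; {a} (inj₂ refl) → sym (B-part a) })
        (P.B-cls true) (P.B-cls false)
      Ck : Classes (gr M) (k₀ true + k₀ false)
      Ck = combine (λ { refl → Eq.return refl }) (λ { refl → Eq.return refl }) (λ e → Eq.return (Sub-≡ e)) (λ e → Eq.return (Sub-≡ e))
        (λ { {a} refl → sym (partM a) }) (proj₂ (P.Ck true)) (proj₂ (P.Ck false))
      Cκ : Classes paths (κ true + κ false)
      Cκ = combine
        (λ { (inj₁ refl) → cl₁ refl ; (inj₂ (c , refl)) → cl₂ (c , refl) })
        (λ { (inj₁ refl) → cl₁ refl ; (inj₂ (c , refl)) → cl₂ (c , refl) })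
        (λ { (inj₁ e) → cl₁ (Sub-≡ e) ; (inj₂ (c , e)) → cl₂ (c , Sub-≡ e) })
        (λ { (inj₁ e) → cl₁ (Sub-≡ e) ; (inj₂ (c , e)) → cl₂ (c , Sub-≡ e) })
        (λ { {a} (inj₁ refl) → sym (partS a) ; {a} (inj₂ (c , refl)) → sym (partM a) })
        (proj₂ (P.Cκ true)) (proj₂ (P.Cκ false))
      p₀ : Sub crossingX
      p₀ = P.p₀ true , ⇒crossingX (proj₁ (P.X₀ true)) (proj₂ (P.X₀ true))
      FT : Sub crossingX ↔ Fin (T true + T false)
      FT = mk↔ₛ′ to from to∘from from∘to ↔∘ ⊎-size (proj₂ (P.FT true)) (proj₂ (P.FT false))
        where
        to-at : (d : Sub crossingX) → ∀ b → part (proj₁ d) ≡ b → Sub (P.C.crossingX true) ⊎ Sub (P.C.crossingX false)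
        to-at (a , d) true e = inj₁ ((a , ⇒part e) , d)
        to-at (a , d) false e = inj₂ ((a , ⇒part e) , d)
        to : Sub crossingX → Sub (P.C.crossingX true) ⊎ Sub (P.C.crossingX false)
        to d = to-at d _ refl
        from : Sub (P.C.crossingX true) ⊎ Sub (P.C.crossingX false) → Sub crossingX
        from (inj₁ ((a , _) , d)) = a , d
        from (inj₂ ((a , _) , d)) = a , d
        to∘from : ∀ t → to (from t) ≡ t
        to∘from (inj₁ ((a , e) , d)) = go _ refl
          where
          go : ∀ b (q : part a ≡ b) → to-at (a , d) b q ≡ inj₁ ((a , e) , d)
          go true q = cong inj₁ (Sub-≡ (Sub-≡ refl))
          go false q = true≢false (part⇒ e) q
        to∘from (inj₂ ((a , e) , d)) = go _ refl
          where
          go : ∀ b (q : part a ≡ b) → to-at (a , d) b q ≡ inj₂ ((a , e) , d)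
          go true q = true≢false q (part⇒ e)
          go false q = cong inj₂ (Sub-≡ (Sub-≡ refl))
        from∘to : ∀ d → from (to d) ≡ d
        from∘to (a , d) = go _ refl
          where
          go : ∀ b (q : part a ≡ b) → from (to-at (a , d) b q) ≡ (a , d)
          go true q = refl
          go false q = refl
      arith : ∀ f f′ κ κ₂ k k₂ T T₂ g g₂ → (f + f) + ((κ + κ₂) + (κ + κ₂)) ≤ ((k + k₂) + (k + k₂)) + (T + T₂) →
        (k + k) + T ≤ (g + g) + (κ + κ) → (k₂ + k₂) + T₂ ≤ (g₂ + g₂) + (κ₂ + κ₂) → g + g₂ ≡ f′ → f ≤ f′
      arith f _ κ κ₂ k k₂ T T₂ g g₂ h₁ h₂ h₃ refl = ℕ.*-cancelˡ-≤ 2 (ℕ.+-cancelʳ-≤ (((k + k₂) + (k + k₂)) + (T + T₂) + ((κ + κ₂) + (κ + κ₂))) _ _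
        (subst₂ _≤_ (lem₁ f κ κ₂ k k₂ T T₂) (lem₂ κ κ₂ k k₂ T T₂ g g₂) (≤-sum h₁ (≤-sum h₂ h₃))))
        where
        lem₁ : ∀ f κ κ₂ k k₂ T T₂ → ((f + f) + ((κ + κ₂) + (κ + κ₂))) + (((k + k) + T) + ((k₂ + k₂) + T₂)) ≡
          2 * f + (((k + k₂) + (k + k₂)) + (T + T₂) + ((κ + κ₂) + (κ + κ₂)))
        lem₁ = solve-∀
        lem₂ : ∀ κ κ₂ k k₂ T T₂ g g₂ → (((k + k₂) + (k + k₂)) + (T + T₂)) + (((g + g) + (κ + κ)) + ((g₂ + g₂) + (κ₂ + κ₂))) ≡
          2 * (g + g₂) + (((k + k₂) + (k + k₂)) + (T + T₂) + ((κ + κ₂) + (κ + κ₂)))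
        lem₂ = solve-∀

  opaque
    separate : Separated X part S M N
    separate = record { B = B ; B-FPF = B-FPF ; B-X = B-X ; B-part = B-part ; B-conn = B-conn ; faces-≤ = faces-≤ }

-- Gluing along an edge

module _ {A : Bool → Set} where

  Σ↔⊎ : Σ Bool A ↔ (A true ⊎ A false)
  Σ↔⊎ = mk↔ₛ′ (λ { (true , a) → inj₁ a ; (false , a) → inj₂ a })
    (λ { (inj₁ a) → true , a ; (inj₂ a) → false , a })
    (λ { (inj₁ _) → refl ; (inj₂ _) → refl }) (λ { (true , _) → refl ; (false , _) → refl })

  Σ-size : {m : Bool → ℕ} → (∀ i → A i ↔ Fin (m i)) → Σ Bool A ↔ Fin (m true + m false)
  Σ-size F = Σ↔⊎ ↔∘ ⊎-size (F true) (F false)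

  data Over (R : ∀ i → Rel (A i) 0ℓ) : Rel (Σ Bool A) 0ℓ where
    over : ∀ {i a b} → R i a b → Over R (i , a) (i , b)

  over-index : ∀ {R : ∀ i → Rel (A i) 0ℓ} {s t} → Over R s t → proj₁ s ≡ proj₁ t
  over-index (over _) = refl

  classes-Σ : ∀ {R : ∀ i → Rel (A i) 0ℓ} {k : Bool → ℕ} → (∀ i → Classes (R i) (k i)) → Classes (Over R) (k true + k false)
  classes-Σ {R} C = classes-transport (Inverse.from Σ↔⊎) (Inverse.to Σ↔⊎) h-resp s-resp
    (λ { (inj₁ _) → ε ; (inj₂ _) → ε }) (λ { (true , _) → ε ; (false , _) → ε }) (classes-⊎ (C true) (C false))
    where
    h-resp : ∀ {a b} → Pointwise (R true) (R false) a b → EqClosure (Over R) (Inverse.from Σ↔⊎ a) (Inverse.from Σ↔⊎ b)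
    h-resp (inj₁ r) = Eq.return (over r)
    h-resp (inj₂ r) = Eq.return (over r)
    s-resp : ∀ {a b} → Over R a b → EqClosure (Pointwise (R true) (R false)) (Inverse.to Σ↔⊎ a) (Inverse.to Σ↔⊎ b)
    s-resp (over {true} r) = Eq.return (inj₁ r)
    s-resp (over {false} r) = Eq.return (inj₂ r)

not-≢ : ∀ {i} → not i ≢ i
not-≢ e = Bool.not-¬ refl (sym e)

≢-not : ∀ {i j : Bool} → i ≢ j → j ≡ not i
≢-not i≢j = Bool.¬-not (λ e → i≢j (sym e))

-- Two graphs glued along an edge; the graphs are indexed by Bool and so are the two
-- ends of the common edge.
record Amalgam : Set where
  field
    K       : Graph
    Kᵢ      : Bool → Graph
    t       : Bool → Fin (n K)
    tᵢ      : ∀ i → Bool → Fin (n (Kᵢ i))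
    φ       : ∀ i → Fin (n (Kᵢ i)) → Fin (n K)
    φ-inj   : ∀ i {a b} → φ i a ≡ φ i b → a ≡ b
    φ-t     : ∀ i c → φ i (tᵢ i c) ≡ t c
    cover   : ∀ v → ∃[ i ] ∃[ a ] φ i a ≡ v
    common : ∀ i a b → φ i a ≡ φ (not i) b → ∃[ c ] (a ≡ tᵢ i c × b ≡ tᵢ (not i) c)
    E-φ     : ∀ i {a b} → E (Kᵢ i) a b ≡ true → E K (φ i a) (φ i b) ≡ true
    E-cover : ∀ {u v} → E K u v ≡ true → ∃[ i ] ∃[ a ] ∃[ b ] (φ i a ≡ u × φ i b ≡ v × E (Kᵢ i) a b ≡ true)
    e-edge  : ∀ i → E (Kᵢ i) (tᵢ i true) (tᵢ i false) ≡ true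

module AmalgamCounts (𝒜 : Amalgam) where
  open Amalgam 𝒜

  Vᵢ : Bool → Set
  Vᵢ i = Fin (n (Kᵢ i))

  ee : ∀ i c → E (Kᵢ i) (tᵢ i c) (tᵢ i (not c)) ≡ true
  ee i true = e-edge i
  ee i false = trans (E-sym (Kᵢ i) (tᵢ i false) (tᵢ i true)) (e-edge i)

  tᵢ-≢ : ∀ i c → tᵢ i c ≢ tᵢ i (not c)
  tᵢ-≢ i c = E-≢ (Kᵢ i) (ee i c)

  tᵢ-inj : ∀ i {c d} → tᵢ i c ≡ tᵢ i d → c ≡ d
  tᵢ-inj i {c} {d} e with c Bool.≟ d
  ... | yes p = p
  ... | no ¬p = ⊥-elim (tᵢ-≢ i c (trans e (cong (tᵢ i) (≢-not ¬p))))

  t-inj : ∀ {c d} → t c ≡ t d → c ≡ d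
  t-inj {c} {d} e = tᵢ-inj true (φ-inj true (trans (φ-t true c) (trans e (sym (φ-t true d)))))

  -- Lists the ways in which two vertices can have the same image, in a form that turns an equation
  -- in `K` into equations in the summands by matching.
  data Meet : ∀ i j → Vᵢ i → Vᵢ j → Set where
    same : ∀ {i a} → Meet i i a a
    term : ∀ {i j} c → Meet i j (tᵢ i c) (tᵢ j c)

  meet : ∀ i j a b → φ i a ≡ φ j b → Meet i j a b
  meet i j a b e with i Bool.≟ j
  ... | yes refl with refl ← φ-inj i e = same
  ... | no i≢j with refl ← ≢-not i≢j with common i a b e
  ...   | c , refl , refl = term c

  VΣ : Set
  VΣ = Σ Bool Vᵢ

  glueV : VΣ → Fin (n K)
  glueV (i , a) = φ i a

  pickV : Fin (n K) → VΣ
  pickV v = proj₁ (cover v) , proj₁ (proj₂ (cover v))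

  glue-pick : ∀ v → glueV (pickV v) ≡ v
  glue-pick v = proj₂ (proj₂ (cover v))

  private
    xt xf yt yf : VΣ
    xt = true , tᵢ true true
    xf = false , tᵢ false true
    yt = true , tᵢ true false
    yf = false , tᵢ false false

    yt≢ : xt ≢ yt
    yt≢ p = tᵢ-≢ true true (φ-inj true (cong glueV p))

    pick-related : ∀ {Q : Rel VΣ 0ℓ} → (∀ i j c → EqClosure Q (i , tᵢ i c) (j , tᵢ j c)) →
      ∀ s s′ → glueV s ≡ glueV s′ → EqClosure Q s s′
    pick-related q (i , a) (j , b) e with meet i j a b e
    ... | same = ε
    ... | term c = q i j c

  -- In the disjoint union, link the two copies of each terminal. The first link joins the parts;
  -- the second has an end untouched by the first; so each lowers the count by one.
  vertices : n K + 2 ≡ n (Kᵢ true) + n (Kᵢ false)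
  vertices with add-edge (discrete (Σ-size {A = Vᵢ} (λ i → Fin↔Fin))) xt xf
  ... | inj₁ (r , _) with () ← cl-inv {φ = proj₁} (λ ()) r
  ... | inj₂ (_ , k , e , D) with add-edge D yt yf
  ...   | inj₁ (r , _) with () ← cong proj₁ (cl-pred (_≡ yt)
            (λ { (inj₂ (refl , _)) p → ⊥-elim (yt≢ p) })
            (λ { (inj₂ (_ , refl)) () }) r refl)
  ...   | inj₂ (_ , k′ , refl , D′) = trans (ℕ.+-comm (n K) 2) (trans (cong (2 +_) (sym k′≡)) (sym e))
    where
    Q : Rel VΣ 0ℓ
    Q = ((λ _ _ → ⊥) ∪ edge xt xf) ∪ edge yt yf
    q : ∀ i j c → EqClosure Q (i , tᵢ i c) (j , tᵢ j c)
    q true true c = ε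
    q false false c = ε
    q true false true = cl₁ (inj₂ (refl , refl))
    q true false false = cl₂ (refl , refl)
    q false true true = cl-sym (cl₁ (inj₂ (refl , refl)))
    q false true false = cl-sym (cl₂ (refl , refl))
    k′≡ : k′ ≡ n K
    k′≡ = classes-unique (classes-transport {Q = λ _ _ → ⊥} glueV pickV
      (λ { (inj₁ (inj₂ (refl , refl))) → cl-refl (trans (φ-t true true) (sym (φ-t false true)))
         ; (inj₂ (refl , refl)) → cl-refl (trans (φ-t true false) (sym (φ-t false false))) })
      (λ ()) (λ s → pick-related q _ s (glue-pick (glueV s))) (λ v → cl-refl (glue-pick v)) D′) (discrete Fin↔Fin)

  -- One link suffices here, since the common edge already joins the two terminals in each summand.
  components : numComps K + 1 ≡ numComps (Kᵢ true) + numComps (Kᵢ false)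
  components with add-edge (classes-Σ {A = Vᵢ} (λ i → comps (Kᵢ i))) xt xf
  ... | inj₁ (r , _) with () ← cl-inv {φ = proj₁} over-index r
  ... | inj₂ (_ , k , e , D) = trans (ℕ.+-comm (numComps K) 1) (trans (cong suc (sym k≡)) (sym e))
    where
    Q : Rel VΣ 0ℓ
    Q = Over (λ i → bool-rel (E (Kᵢ i))) ∪ edge xt xf
    xy : ∀ i → EqClosure Q (i , tᵢ i false) (i , tᵢ i true)
    xy i = cl-sym (cl₁ (over (e-edge i)))
    q : ∀ i j c → EqClosure Q (i , tᵢ i c) (j , tᵢ j c)
    q true true c = ε
    q false false c = ε
    q true false true = cl₂ (refl , refl)
    q false true true = cl-sym (cl₂ (refl , refl))
    q true false false = xy true ◅◅ cl₂ (refl , refl) ◅◅ cl-sym (xy false)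
    q false true false = xy false ◅◅ cl-sym (cl₂ (refl , refl)) ◅◅ cl-sym (xy true)
    k≡ : k ≡ numComps K
    k≡ = classes-unique (classes-transport {Q = bool-rel (E K)} glueV pickV
      (λ { (inj₁ (over {i} r)) → Eq.return (E-φ i r) ; (inj₂ (refl , refl)) → cl-refl (trans (φ-t true true) (sym (φ-t false true))) })
      s-resp (λ s → pick-related q _ s (glue-pick (glueV s))) (λ v → cl-refl (glue-pick v)) D) (comps K)
      where
      s-resp : ∀ {u v} → E K u v ≡ true → EqClosure Q (pickV u) (pickV v)
      s-resp {u} {v} p with E-cover p
      ... | i , a , b , refl , refl , r = pick-related q _ (i , a) (glue-pick (φ i a)) ◅◅ cl₁ (over r) ◅◅
        pick-related q (i , b) _ (sym (glue-pick (φ i b)))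

  terminal-not-isolated : ∀ i c → isolated (Kᵢ i) (tᵢ i c) ≡ true → ⊥
  terminal-not-isolated i c iso = isolated⇒ (Kᵢ i) iso (ee i c)

  -- The common edge keeps the terminals from being isolated, so no isolated vertex is counted
  -- twice.
  isolated-sum : isolatedCount K ≡ isolatedCount (Kᵢ true) + isolatedCount (Kᵢ false)
  isolated-sum = ℕ.≤-antisym
    (injective⇒≤ (isolated-size K) FΣ down (λ {a} {b} e → Sub-≡ (trans (sym (glue-pick (proj₁ a)))
      (trans (cong (λ { (i , a , _) → φ i a }) e) (glue-pick (proj₁ b))))))
    (injective⇒≤ FΣ (isolated-size K) up (up-inj _ _))
    where
    IΣ : Set
    IΣ = Σ Bool (λ i → Sub (isolated (Kᵢ i)))
    FΣ = Σ-size (λ i → isolated-size (Kᵢ i))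
    down : Sub (isolated K) → IΣ
    down (v , iso) = proj₁ (pickV v) , proj₂ (pickV v) , ⇒isolated (Kᵢ _)
      (λ u e → isolated⇒ K (subst (λ w → isolated K w ≡ true) (sym (glue-pick v)) iso) (E-φ _ e))
    up : IΣ → Sub (isolated K)
    up (i , a , iso) = φ i a , ⇒isolated K no-edge
      where
      no-edge : ∀ u → E K (φ i a) u ≡ true → ⊥
      no-edge u e with E-cover e
      ... | j , b , b′ , p , q , r with meet j i b a p
      ...   | same = isolated⇒ (Kᵢ i) iso r
      ...   | term c = terminal-not-isolated i c iso
    up-inj : ∀ s s′ → up s ≡ up s′ → s ≡ s′
    up-inj (i , a , p) (j , b , q) e with meet i j a b (cong proj₁ e)
    ... | same = cong (i ,_) (Sub-≡ refl)
    ... | term c = ⊥-elim (terminal-not-isolated i c p)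

module AmalgamFlags (𝒜 : Amalgam) where
  open Amalgam 𝒜 public
  open AmalgamCounts 𝒜 public

  Φ : Set
  Φ = Σ Bool (λ i → Flg (Kᵢ i))

  Φ-finite : Φ ↔ Fin _
  Φ-finite = Σ-size (λ i → Flg-size (Kᵢ i))

  S : Φ → Φ
  S (i , a) = i , flipS a

  ν : Φ → Fin (n K)
  ν (i , a) = φ i (vert a)

  lift : (∀ i → Flg (Kᵢ i) → Flg (Kᵢ i)) → Φ → Φ
  lift f (i , a) = i , f i a

  Σ-inj : ∀ {i : Bool} {a b : Flg (Kᵢ i)} → _≡_ {A = Φ} (i , a) (i , b) → a ≡ b
  Σ-inj refl = refl

  lift-FPF : ∀ {f} → (∀ i → FPFInvolution (f i)) → FPFInvolution (lift f)
  lift-FPF I = record { invol = λ { (i , a) → cong (i ,_) (invol (I i) a) } ; fpf = λ { (i , a) e → fpf (I i) a (Σ-inj e) } }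

  S-FPF : FPFInvolution S
  S-FPF = lift-FPF (λ i → flipS-FPF)

  gF : ∀ i → Flg (Kᵢ i) → Flg K
  gF i (flg v u b e) = flg (φ i v) (φ i u) b (E-φ i e)

  eK : ∀ c → E K (t c) (t (not c)) ≡ true
  eK c = subst₂ (λ u v → E K u v ≡ true) (φ-t true c) (φ-t true (not c)) (E-φ true (ee true c))

  eflag : ∀ i → Bool → Bool → Flg (Kᵢ i)
  eflag i c b = flg (tᵢ i c) (tᵢ i (not c)) b (ee i c)

  eflagK : Bool → Bool → Flg K
  eflagK c b = flg (t c) (t (not c)) b (eK c)

  gF-eflag : ∀ i c b → gF i (eflag i c b) ≡ eflagK c b
  gF-eflag i c b = Flg-≡ (φ-t i c) (φ-t i (not c)) refl

  -- In the amalgam the common edge of K is doubled, which creates a digon. Of the two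
  -- copies of a flag of this edge with side b, the one in part b corresponds to the flag
  -- of K, the other one is a flag of the digon.
  Four : Set
  Four = Bool × Bool

  W : Set
  W = Flg K ⊎ Four

  inn : Four → Φ
  inn (i , c) = i , eflag i c (not i)

  Inner : Φ → Set
  Inner (i , a) = ∃[ c ] a ≡ eflag i c (not i)

  Inner? : ∀ s → Dec (Inner s)
  Inner? (i , a) with decEq (Flg-size (Kᵢ i)) a (eflag i true (not i)) | decEq (Flg-size (Kᵢ i)) a (eflag i false (not i))
  ... | yes p | _ = yes (true , p)
  ... | no _ | yes p = yes (false , p)
  ... | no p | no q = no λ { (true , r) → p r ; (false , r) → q r }

  private
    θ-at : ∀ s → Dec (Inner s) → W
    θ-at (i , a) (yes (c , _)) = inj₂ (i , c)
    θ-at (i , a) (no _) = inj₁ (gF i a)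

  opaque
    θ : Φ → W
    θ s = θ-at s (Inner? s)

    θ-inner : ∀ i c → θ (inn (i , c)) ≡ inj₂ (i , c)
    θ-inner i c with Inner? (inn (i , c))
    ... | yes (d , e) = cong (λ c → inj₂ (i , c)) (tᵢ-inj i (sym (cong vert e)))
    ... | no ¬p = ⊥-elim (¬p (c , refl))

    θ-outer : ∀ i a → ¬ Inner (i , a) → θ (i , a) ≡ inj₁ (gF i a)
    θ-outer i a ¬p with Inner? (i , a)
    ... | yes p = ⊥-elim (¬p p)
    ... | no _ = refl

  data View (s : Φ) : Set where
    inner : ∀ i c → s ≡ inn (i , c) → θ s ≡ inj₂ (i , c) → View s
    outer : ∀ i a → s ≡ (i , a) → ¬ Inner (i , a) → θ s ≡ inj₁ (gF i a) → View s

  view : ∀ s → View s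
  view (i , a) with Inner? (i , a)
  ... | yes (c , refl) = inner i c refl (θ-inner i c)
  ... | no ¬p = outer i a refl ¬p (θ-outer i a ¬p)

  not-inner : ∀ i c → ¬ Inner (i , eflag i c i)
  not-inner i c (d , e) = not-≢ (sym (cong side e))

  θ-eflag : ∀ i c → θ (i , eflag i c i) ≡ inj₁ (eflagK c i)
  θ-eflag i c = trans (θ-outer i _ (not-inner i c)) (cong inj₁ (gF-eflag i c i))

  inj₁≢inj₂ : ∀ {ℓ} {V : Set ℓ} {A B : Set} {a : A} {b : B} → _≡_ {A = A ⊎ B} (inj₁ a) (inj₂ b) → V
  inj₁≢inj₂ ()

  private
    outer-index : ∀ {i c b} → ¬ Inner (i , eflag i c b) → b ≡ i
    outer-index {i} {c} {b} ¬p with b Bool.≟ i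
    ... | yes e = e
    ... | no b≢i = ⊥-elim (¬p (c , cong (eflag i c) (Bool.¬-not b≢i)))

    outer-inj : ∀ i a j b → ¬ Inner (i , a) → ¬ Inner (j , b) → gF i a ≡ gF j b → _≡_ {A = Φ} (i , a) (j , b)
    outer-inj i (flg v u s p) j (flg v′ u′ s′ p′) ¬a ¬b e
      with meet i j v v′ (cong vert e) | meet i j u u′ (cong head e)
    ... | same | m = cong (i ,_) (Flg-≡ refl (φ-inj i (cong head e)) (cong side e))
    ... | term c | same = cong (i ,_) (Flg-≡ (φ-inj i (cong vert e)) refl (cong side e))
    ... | term c | term d with c Bool.≟ d
    ...   | yes refl = ⊥-elim (E-≢ (Kᵢ i) p refl)
    ...   | no c≢d with refl ← ≢-not c≢d with refl ← cong side e
          with refl ← uip p (ee i c) with refl ← uip p′ (ee j c) = same-part (trans (sym (outer-index ¬a)) (outer-index ¬b))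
      where
      same-part : i ≡ j → _≡_ {A = Φ} (i , eflag i c s) (j , eflag j c s)
      same-part refl = refl

    θ-inj : ∀ {s s′} → θ s ≡ θ s′ → s ≡ s′
    θ-inj {s} {s′} e with view s | view s′
    ... | inner i c p q | inner j d p′ q′ = trans p (trans (cong inn (Sum.inj₂-injective (trans (sym q) (trans e q′)))) (sym p′))
    ... | inner i c p q | outer j b p′ _ q′ = inj₁≢inj₂ (trans (sym q′) (trans (sym e) q))
    ... | outer i a p _ q | inner j d p′ q′ = inj₁≢inj₂ (trans (sym q) (trans e q′))
    ... | outer i a p ¬a q | outer j b p′ ¬b q′ = trans p (trans
        (outer-inj i a j b ¬a ¬b (Sum.inj₁-injective (trans (sym q) (trans e q′)))) (sym p′))

    θ-surj : ∀ w → ∃[ s ] θ s ≡ w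
    θ-surj (inj₂ (i , c)) = inn (i , c) , θ-inner i c
    θ-surj (inj₁ (flg v u b p)) with E-cover p
    ... | i , a , a′ , refl , refl , q with Inner? (i , flg a a′ b q)
    ...   | no ¬p = (i , flg a a′ b q) , trans (θ-outer i _ ¬p) (cong inj₁ (Flg-≡ refl refl refl))
    -- The copy found in part `i` belongs to the digon; the copy in part `not i` is the one that
    -- stands for this flag of `K`.
    ...   | yes (c , refl) = (not i , eflag (not i) c (not i)) , trans (θ-eflag (not i) c)
          (cong inj₁ (Flg-≡ (sym (φ-t i c)) (sym (φ-t i (not c))) refl))

  opaque
    back : W → Φ
    back w = proj₁ (θ-surj w)

    θ-back : ∀ w → θ (back w) ≡ w
    θ-back w = proj₂ (θ-surj w)

  back-θ : ∀ s → back (θ s) ≡ s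
  back-θ s = θ-inj (θ-back (θ s))

  νW : W → Fin (n K)
  νW (inj₁ h) = vert h
  νW (inj₂ (i , c)) = t c

  ν-θ : ∀ s → νW (θ s) ≡ ν s
  ν-θ s with view s
  ... | inner i c refl q = trans (cong νW q) (sym (φ-t i c))
  ... | outer i a refl _ q = cong νW q

  W-finite : W ↔ Fin _
  W-finite = ⊎-size (Flg-size K) (Σ-size {A = λ _ → Bool} {m = λ _ → 2} (λ _ → Symm.inverse Fin.2↔Bool))

  -- Four flags per edge, and four more from the digon: one additional edge.
  edges : numEdges K + 1 ≡ numEdges (Kᵢ true) + numEdges (Kᵢ false)
  edges = arith (numEdges K) (numEdges (Kᵢ true)) (numEdges (Kᵢ false)) (size-unique W-finite Φ-finite
      (mk↔ₛ′ back θ back-θ θ-back))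
    where
    arith : ∀ e a b → ((e + e) + (e + e)) + (2 + 2) ≡ ((a + a) + (a + a)) + ((b + b) + (b + b)) → e + 1 ≡ a + b
    arith e a b h = ℕ.*-cancelˡ-≡ (e + 1) (a + b) 4 (trans (lem₁ e) (trans h (lem₂ a b)))
      where
      lem₁ : ∀ e → 4 * (e + 1) ≡ ((e + e) + (e + e)) + (2 + 2)
      lem₁ = solve-∀
      lem₂ : ∀ a b → ((a + a) + (a + a)) + ((b + b) + (b + b)) ≡ 4 * (a + b)
      lem₂ = solve-∀

  -- Around the digon, `m4` passes to the other end of the same edge and `n4` to the other edge at
  -- the same terminal.
  m4 n4 : Four → Four
  m4 (i , c) = i , not c
  n4 (i , c) = not i , c

  mapW : (Flg K → Flg K) → (Four → Four) → W → W
  mapW σ τ (inj₁ h) = inj₁ (σ h)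
  mapW σ τ (inj₂ d) = inj₂ (τ d)

  digon : Classes (gr m4 ∪ gr n4) 1
  digon = record
    { cls = λ _ → zero ; rep = λ _ → true , true ; cls-rep = λ { zero → refl } ; sound = λ _ → refl
    ; complete = λ {a} {b} _ → to-tt a ◅◅ cl-sym (to-tt b) }
    where
    to-tt : ∀ d → EqClosure (gr m4 ∪ gr n4) d (true , true)
    to-tt (true , true) = ε
    to-tt (true , false) = cl₁ refl
    to-tt (false , true) = cl₂ refl
    to-tt (false , false) = cl₁ refl ◅◅ cl₂ refl

  -- The digon is a face of its own, whence the `+ 1`.
  θ-faces : ∀ {σ τ : Φ → Φ} {σK τK : Flg K → Flg K} {f} →
    (∀ s → θ (σ s) ≡ mapW σK m4 (θ s)) → (∀ s → θ (τ s) ≡ mapW τK n4 (θ s)) →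
    Classes (gr σK ∪ gr τK) f → Classes (gr σ ∪ gr τ) (f + 1)
  θ-faces {σ} {τ} {σK} {τK} hσ hτ C = classes-transport back θ b-resp θ-resp (λ w → cl-refl (θ-back w)) (λ s → cl-refl (back-θ s))
    (classes-⊎ C digon)
    where
    R : Rel W 0ℓ
    R = Pointwise (gr σK ∪ gr τK) (gr m4 ∪ gr n4)
    σ-step : ∀ w → σ (back w) ≡ back (mapW σK m4 w)
    σ-step w = trans (sym (back-θ _)) (cong back (trans (hσ (back w)) (cong (mapW σK m4) (θ-back w))))
    τ-step : ∀ w → τ (back w) ≡ back (mapW τK n4 w)
    τ-step w = trans (sym (back-θ _)) (cong back (trans (hτ (back w)) (cong (mapW τK n4) (θ-back w))))
    b-resp : ∀ {a b} → R a b → EqClosure (gr σ ∪ gr τ) (back a) (back b)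
    b-resp (inj₁ {a} (inj₁ refl)) = cl₁ (σ-step (inj₁ a))
    b-resp (inj₁ {a} (inj₂ refl)) = cl₂ (τ-step (inj₁ a))
    b-resp (inj₂ {a} (inj₁ refl)) = cl₁ (σ-step (inj₂ a))
    b-resp (inj₂ {a} (inj₂ refl)) = cl₂ (τ-step (inj₂ a))
    σ-R : ∀ w → EqClosure R w (mapW σK m4 w)
    σ-R (inj₁ _) = Eq.return (inj₁ (inj₁ refl))
    σ-R (inj₂ _) = Eq.return (inj₂ (inj₁ refl))
    τ-R : ∀ w → EqClosure R w (mapW τK n4 w)
    τ-R (inj₁ _) = Eq.return (inj₁ (inj₂ refl))
    τ-R (inj₂ _) = Eq.return (inj₂ (inj₂ refl))
    θ-resp : ∀ {a b} → (gr σ ∪ gr τ) a b → EqClosure R (θ a) (θ b)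
    θ-resp {a} (inj₁ refl) = σ-R (θ a) ◅◅ cl-refl (sym (hσ a))
    θ-resp {a} (inj₂ refl) = τ-R (θ a) ◅◅ cl-refl (sym (hτ a))

  -- `M` keeps the side along the common edge. Then it maps the flags in `Four` to each other, and
  -- they can close up to a digon.
  Untwisted : ∀ i → (Flg (Kᵢ i) → Flg (Kᵢ i)) → Set
  Untwisted i M = ∀ c b → M (eflag i c b) ≡ eflag i (not c) b

  lift-inner : ∀ {M : ∀ i → Flg (Kᵢ i) → Flg (Kᵢ i)} → (∀ i → Untwisted i (M i)) →
    ∀ d → lift M (inn d) ≡ inn (m4 d)
  lift-inner u (i , c) = cong (i ,_) (u i c (not i))

  module _ {τ : Φ → Φ} (τ-index : ∀ s → proj₁ (τ s) ≡ proj₁ s) where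

    component : ∀ i → Flg (Kᵢ i) → Flg (Kᵢ i)
    component i a = subst (λ j → Flg (Kᵢ j)) (τ-index (i , a)) (proj₂ (τ (i , a)))

    component-≡ : ∀ i a → τ (i , a) ≡ (i , component i a)
    component-≡ i a = move (τ (i , a)) (τ-index (i , a))
      where
      move : ∀ {j} (s : Φ) (e : proj₁ s ≡ j) → s ≡ (j , subst (λ j → Flg (Kᵢ j)) e (proj₂ s))
      move s refl = refl

    component-FPF : FPFInvolution τ → ∀ i → FPFInvolution (component i)
    component-FPF I i = record
      { invol = λ a → Σ-inj (trans (sym (component-≡ i (component i a)))
          (trans (cong τ (sym (component-≡ i a))) (invol I (i , a))))
      ; fpf = λ a e → fpf I (i , a) (trans (component-≡ i a) (cong (i ,_) e)) }

  project : ∀ {σ τ : Φ → Φ} {f g : ∀ i → Flg (Kᵢ i) → Flg (Kᵢ i)} →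
    (∀ i a → σ (i , a) ≡ (i , f i a)) → (∀ i a → τ (i , a) ≡ (i , g i a)) →
    ∀ {i a b} → EqClosure (gr σ ∪ gr τ) (i , a) (i , b) → EqClosure (gr (f i) ∪ gr (g i)) a b
  project {σ} {τ} {f} {g} hσ hτ {i} {a} {b} r = finish (cl-pred P fw bw r (a , refl , ε))
    where
    P : Φ → Set
    P s = ∃[ b ] (s ≡ (i , b) × EqClosure (gr (f i) ∪ gr (g i)) a b)
    finish : P (i , b) → EqClosure (gr (f i) ∪ gr (g i)) a b
    finish (_ , refl , q) = q
    fw : ∀ {s s′} → (gr σ ∪ gr τ) s s′ → P s → P s′
    fw (inj₁ refl) (b , refl , q) = f i b , hσ i b , (q ◅◅ cl₁ refl)
    fw (inj₂ refl) (b , refl , q) = g i b , hτ i b , (q ◅◅ cl₂ refl)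
    index : ∀ {s s′} → (gr σ ∪ gr τ) s s′ → proj₁ s ≡ proj₁ s′
    index {j , c} (inj₁ refl) = sym (cong proj₁ (hσ j c))
    index {j , c} (inj₂ refl) = sym (cong proj₁ (hτ j c))
    bw : ∀ {s s′} → (gr σ ∪ gr τ) s s′ → P s′ → P s
    bw {j , c} e (b , refl , q) with refl ← index e = c , refl , (q ◅◅ cl-sym (step e))
      where
      step : (gr σ ∪ gr τ) (i , c) (i , b) → EqClosure (gr (f i) ∪ gr (g i)) c b
      step (inj₁ e) = cl₁ (Σ-inj (trans (sym (hσ i c)) e))
      step (inj₂ e) = cl₂ (Σ-inj (trans (sym (hτ i c)) e))

  classes-lift : ∀ {σ τ : Φ → Φ} {f g : ∀ i → Flg (Kᵢ i) → Flg (Kᵢ i)} {k : Bool → ℕ} →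
    (∀ i a → σ (i , a) ≡ (i , f i a)) → (∀ i a → τ (i , a) ≡ (i , g i a)) →
    (∀ i → Classes (gr (f i) ∪ gr (g i)) (k i)) → Classes (gr σ ∪ gr τ) (k true + k false)
  classes-lift hσ hτ C = classes-cong
    (λ { (over {i} {a} (inj₁ refl)) → cl₁ (hσ i a) ; (over {i} {a} (inj₂ refl)) → cl₂ (hτ i a) })
    (λ { {i , a} (inj₁ refl) → Eq.return (over (inj₁ refl)) ◅◅ cl-refl (sym (hσ i a))
       ; {i , a} (inj₂ refl) → Eq.return (over (inj₂ refl)) ◅◅ cl-refl (sym (hτ i a)) })
    (classes-Σ C)

-- From an embedding of the amalgam to embeddings of its parts

module LowerBound (𝒜 : Amalgam) {f : ℕ} (μ : MapOn (Amalgam.K 𝒜) f) where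
  open AmalgamFlags 𝒜
  open MapOn μ renaming (N to NK; M to MK; N-FPF to NK-FPF; N-vert to NK-vert; N-conn to NK-conn;
    M-inv to MK-inv; M-vert to MK-vert; M-head to MK-head; M-flip to MK-flip; faces to facesK; M-FPF to MK-FPF)

  module _ (untwisted : ∀ c b → MK (eflagK c b) ≡ eflagK (not c) b) where
    private
      gF-inj : ∀ i {a b} → gF i a ≡ gF i b → a ≡ b
      gF-inj i e = Flg-≡ (φ-inj i (cong vert e)) (φ-inj i (cong head e)) (cong side e)

      Mᵢ : ∀ i → Flg (Kᵢ i) → Flg (Kᵢ i)
      Mᵢ i a = flg (head a) (vert a) (side (MK (gF i a))) (trans (E-sym (Kᵢ i) (head a) (vert a)) (is-edge a))

      gF-M : ∀ i a → gF i (Mᵢ i a) ≡ MK (gF i a)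
      gF-M i a = Flg-≡ (sym (MK-vert (gF i a))) (sym (MK-head (gF i a))) refl

      Mᵢ-inv : ∀ i a → Mᵢ i (Mᵢ i a) ≡ a
      Mᵢ-inv i a = gF-inj i (trans (gF-M i (Mᵢ i a)) (trans (cong MK (gF-M i a)) (MK-inv (gF i a))))

      Mᵢ-flip : ∀ i a → Mᵢ i (flipS a) ≡ flipS (Mᵢ i a)
      Mᵢ-flip i a = Flg-≡ refl refl (cong side (MK-flip (gF i a)))

      Mᵢ-FPF : ∀ i → FPFInvolution (Mᵢ i)
      Mᵢ-FPF i = record { invol = Mᵢ-inv i ; fpf = λ a e → E-≢ (Kᵢ i) (is-edge a) (sym (cong vert e)) }

      Mᵢ-untwisted : ∀ i → Untwisted i (Mᵢ i)
      Mᵢ-untwisted i c b = gF-inj i (trans (gF-M i _) (trans (cong MK (gF-eflag i c b))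
        (trans (untwisted c b) (sym (gF-eflag i (not c) b)))))

      M : Φ → Φ
      M = lift Mᵢ
      M-FPF : FPFInvolution M
      M-FPF = lift-FPF Mᵢ-FPF

      θ-M : ∀ s → θ (M s) ≡ mapW MK m4 (θ s)
      θ-M s with view s
      ... | inner i c refl q = trans (cong θ (lift-inner {Mᵢ} Mᵢ-untwisted (i , c))) (trans (θ-inner i (not c)) (cong (mapW MK m4) (sym q)))
      ... | outer i a refl ¬p q = trans (θ-outer i (Mᵢ i a) ¬p′) (trans (cong inj₁ (gF-M i a)) (cong (mapW MK m4) (sym q)))
        where
        ¬p′ : ¬ Inner (i , Mᵢ i a)
        ¬p′ (c , e) = ¬p (not c , trans (sym (Mᵢ-inv i a)) (trans (cong (Mᵢ i) e) (Mᵢ-untwisted i c (not i))))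

      n4-invol : ∀ d → n4 (n4 d) ≡ d
      n4-invol (i , c) = cong (_, c) (Bool.not-involutive i)

      NW : W → W
      NW = mapW NK n4
      NW-invol : ∀ w → NW (NW w) ≡ w
      NW-invol (inj₁ h) = cong inj₁ (invol NK-FPF h)
      NW-invol (inj₂ d) = cong inj₂ (n4-invol d)
      NW-fpf : ∀ w → NW w ≢ w
      NW-fpf (inj₁ h) e = fpf NK-FPF h (Sum.inj₁-injective e)
      NW-fpf (inj₂ d) e = not-≢ (cong proj₁ (Sum.inj₂-injective e))

      N : Φ → Φ
      N s = back (NW (θ s))
      θ-N : ∀ s → θ (N s) ≡ NW (θ s)
      θ-N s = θ-back (NW (θ s))
      N-FPF : FPFInvolution N
      N-FPF = record
        { invol = λ s → trans (cong (back ∘ NW) (θ-N s)) (trans (cong back (NW-invol (θ s))) (back-θ s))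
        ; fpf = λ s e → NW-fpf (θ s) (trans (sym (θ-N s)) (cong θ e)) }

      N-ν : ∀ s → ν (N s) ≡ ν s
      N-ν s = trans (sym (ν-θ (N s))) (trans (cong νW (θ-N s)) (trans (pres (θ s)) (ν-θ s)))
        where
        pres : ∀ w → νW (NW w) ≡ νW w
        pres (inj₁ h) = NK-vert h
        pres (inj₂ d) = refl

      N-inner : ∀ i c → N (inn (i , c)) ≡ inn (not i , c)
      N-inner i c = trans (cong (back ∘ NW) (θ-inner i c)) (trans (cong back (sym (θ-inner (not i) c))) (back-θ _))

      facesΦ : Classes (gr M ∪ gr N) (f + 1)
      facesΦ = θ-faces θ-M θ-N facesK

      SN : Rel Φ 0ℓ
      SN = gr S ∪ gr N

      flip-inn : ∀ i c → S (inn (i , c)) ≡ (i , eflag i c i)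
      flip-inn i c = cong (λ b → i , eflag i c b) (Bool.not-involutive i)

      -- Where the edge was doubled, a side change in K is made through the digon.
      SN-flip : ∀ h → EqClosure SN (back (inj₁ h)) (back (inj₁ (flipS h)))
      SN-flip h with view (back (inj₁ h)) | θ-back (inj₁ h)
      ... | inner i c _ q | r = inj₁≢inj₂ (trans (sym r) q)
      ... | outer i a p ¬p q | r with refl ← Sum.inj₁-injective (trans (sym q) r) with Inner? (i , flipS a)
      ...   | no ¬p′ = cl-refl p ◅◅ cl₁ refl ◅◅ cl-refl (trans (sym (back-θ _)) (cong back (θ-outer i (flipS a) ¬p′)))
      ...   | yes (c , e) = cl-refl p ◅◅ cl₁ refl ◅◅ cl-refl (cong (i ,_) e) ◅◅ cl₂ (N-inner i c) ◅◅ cl₁ (flip-inn (not i) c) ◅◅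
              cl-refl (trans (sym (back-θ _)) (cong back (trans (θ-eflag (not i) c)
                (cong inj₁ (trans (sym (gF-eflag i c (not i))) (cong (gF i) (sym e)))))))

      SN-K : ∀ h h′ → vert h ≡ vert h′ → EqClosure SN (back (inj₁ h)) (back (inj₁ h′))
      SN-K h h′ e = cl-map (back ∘ inj₁)
        (λ { {a} (inj₁ refl) → SN-flip a
           ; {a} (inj₂ refl) → cl₂ (cong (back ∘ NW) (θ-back (inj₁ a))) }) (NK-conn h h′ e)

      to-outer : ∀ s → ∃[ h ] (vert h ≡ ν s × EqClosure SN s (back (inj₁ h)))
      to-outer s with view s
      ... | outer i a refl _ q = gF i a , refl , cl-refl (trans (sym (back-θ s)) (cong back q))
      ... | inner i c refl q = eflagK c i , sym (φ-t i c) ,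
        cl₁ (flip-inn i c) ◅◅ cl-refl (trans (sym (back-θ _)) (cong back (θ-eflag i c)))

      SN-conn : ∀ s s′ → ν s ≡ ν s′ → EqClosure SN s s′
      SN-conn s s′ e with to-outer s | to-outer s′
      ... | h , p , r | h′ , p′ , r′ = r ◅◅ SN-K h h′ (trans p (trans e (sym p′))) ◅◅ cl-sym r′

      isX : Φ → Bool
      isX s = ν s == t true
      isEnd : Φ → Bool
      isEnd s = isX s ∨ (ν s == t false)

      end-ν : ∀ s → isEnd s ≡ true → ν s ≡ t (isX s)
      end-ν s e = go (isX s) refl
        where
        go : ∀ b → isX s ≡ b → ν s ≡ t (isX s)
        go true p = trans (true-== p) (cong t (sym p))
        go false p with ∨-true {isX s} e
        ... | inj₁ q = true≢false q p
        ... | inj₂ q = trans (true-== q) (cong t (sym p))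

      ν-end : ∀ s c → ν s ≡ t c → isEnd s ≡ true
      ν-end s true e = ∨-true₁ (==-true e)
      ν-end s false e = ∨-true₂ {isX s} (==-true e)

      isX-t : ∀ s c → ν s ≡ t c → isX s ≡ c
      isX-t s true e = ==-true e
      isX-t s false e = ==-false (λ e′ → Bool.not-¬ {true} refl (t-inj (trans (sym e′) e)))

      same-ν-end : ∀ s s′ → ν s ≡ ν s′ → isEnd s ≡ isEnd s′
      same-ν-end s s′ e = cong (λ v → (v == t true) ∨ (v == t false)) e

      -- Away from the terminals the images of the two graphs are disjoint, so a corner there stays
      -- in its part; all mixing happens at the ends.
      N-index : ∀ s → isEnd s ≡ false → proj₁ (N s) ≡ proj₁ s
      N-index s e = go (N s) (N-ν s)
        where
        go : ∀ s′ → ν s′ ≡ ν s → proj₁ s′ ≡ proj₁ s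
        go (j , b) p with meet j (proj₁ s) (vert b) (vert (proj₂ s)) p
        ... | m = from-meet m refl refl
          where
          from-meet : ∀ {j i v w} → Meet j i v w → i ≡ proj₁ s → φ i w ≡ ν s → j ≡ proj₁ s
          from-meet same q _ = q
          from-meet {i = i} (term c) _ r = true≢false (ν-end s c (trans (sym r) (φ-t i c))) e

      module EE = Ends Φ-finite M-FPF isEnd N (λ s e → trans (same-ν-end (N s) s (N-ν s)) e) (λ s _ → invol N-FPF s) (λ s _ → fpf N-FPF s)
      open EE using (End; mate; mate-FPF; mate-related; mate-unique; close; close-end; close-inner; close-FPF; close-classes; closed-cycles; paths)

      FE = proj₂ (Sub-finite Φ-finite isEnd)

      onEnd : (σ : Φ → Φ) → (∀ s → ν (σ s) ≡ ν s) → End → End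
      onEnd σ h (s , e) = σ s , trans (same-ν-end (σ s) s (h s)) e
      onEnd-FPF : ∀ {σ} (h : ∀ s → ν (σ s) ≡ ν s) → FPFInvolution σ → FPFInvolution (onEnd σ h)
      onEnd-FPF h I = record { invol = λ { (s , _) → Sub-≡ (invol I s) } ; fpf = λ { (s , _) e → fpf I s (cong proj₁ e) } }

      SE NE : End → End
      SE = onEnd S (λ _ → refl)
      NE = onEnd N N-ν

      XE partE : End → Bool
      XE = isX ∘ proj₁
      partE = proj₁ ∘ proj₁

      -- A path uses no corner at a terminal, so a face walk between two ends stays in one part.
      partM : ∀ e → partE (mate e) ≡ partE e
      partM e = sym (cl-inv {φ = proj₁} (λ { (inj₁ refl) → refl ; {s} (inj₂ (q , refl)) → sym (N-index s q) }) (mate-related e))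

      connE : ∀ a b → XE a ≡ XE b → EqClosure (gr SE ∪ gr NE) a b
      connE a b e = finish (cl-pred P fw bw (SN-conn (proj₁ a) (proj₁ b)
          (trans (end-ν (proj₁ a) (proj₂ a)) (trans (cong t e) (sym (end-ν (proj₁ b) (proj₂ b)))))) (a , refl , ε))
        where
        P : Φ → Set
        P s = Σ End λ c → proj₁ c ≡ s × EqClosure (gr SE ∪ gr NE) a c
        finish : P (proj₁ b) → EqClosure (gr SE ∪ gr NE) a b
        finish (c , q , r) = r ◅◅ cl-refl (Sub-≡ q)
        fw : ∀ {s s′} → SN s s′ → P s → P s′
        fw (inj₁ refl) (c , refl , r) = SE c , refl , (r ◅◅ cl₁ refl)
        fw (inj₂ refl) (c , refl , r) = NE c , refl , (r ◅◅ cl₂ refl)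
        bw : ∀ {s s′} → SN s s′ → P s′ → P s
        bw (inj₁ q) p = fw (inj₁ (flip S-FPF q)) p
        bw (inj₂ q) p = fw (inj₂ (flip N-FPF q)) p

      -- In each part the common edge is a face walk from `x` to `y`. The side `i` is the one that
      -- does not bound the digon.
      crosses : ∀ i → Σ End λ p → partE p ≡ i × XE p ≡ true × XE (mate p) ≡ false
      crosses i = p , refl , isX-t (i , eflag i true i) true (φ-t i true) , trans (cong XE (sym m)) (isX-t (i , eflag i false i) false (φ-t i false))
        where
        p q : End
        p = (i , eflag i true i) , ν-end (i , eflag i true i) true (φ-t i true)
        q = (i , eflag i false i) , ν-end (i , eflag i false i) false (φ-t i false)
        m : q ≡ mate p
        m with mate-unique p q (cl₁ (cong (i ,_) (Mᵢ-untwisted i true i)))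
        ... | inj₁ e = ⊥-elim (tᵢ-≢ i true (φ-inj i (cong (ν ∘ proj₁) (sym e))))
        ... | inj₂ e = e

      sepE : Separated XE partE SE mate NE
      sepE = Separate.separate FE XE partE (onEnd-FPF (λ _ → refl) S-FPF) (λ _ → refl) (λ _ → refl)
        mate-FPF partM (onEnd-FPF N-ν N-FPF) (λ e → cong (_== t true) (N-ν (proj₁ e))) connE crosses
      module Sep = Separated sepE

      N′ : Φ → Φ
      N′ = close Sep.B

      N′-index : ∀ s → proj₁ (N′ s) ≡ proj₁ s
      N′-index s = go (isEnd s) refl
        where
        go : ∀ b → isEnd s ≡ b → proj₁ (N′ s) ≡ proj₁ s
        go true e = trans (cong proj₁ (close-end Sep.B (s , e))) (Sep.B-part (s , e))
        go false e = trans (cong proj₁ (close-inner Sep.B e)) (N-index s e)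

      N′-ν : ∀ s → ν (N′ s) ≡ ν s
      N′-ν s = go (isEnd s) refl
        where
        go : ∀ b → isEnd s ≡ b → ν (N′ s) ≡ ν s
        go true e = trans (cong ν (close-end Sep.B (s , e))) (trans (end-ν (proj₁ (Sep.B (s , e))) (proj₂ (Sep.B (s , e))))
          (trans (cong t (Sep.B-X (s , e))) (sym (end-ν s e))))
        go false e = trans (cong ν (close-inner Sep.B e)) (N-ν s)

      SN′-conn : ∀ s s′ → proj₁ s ≡ proj₁ s′ → ν s ≡ ν s′ → EqClosure (gr S ∪ gr N′) s s′
      SN′-conn s s′ i v = go (isEnd s) refl
        where
        go : ∀ b → isEnd s ≡ b → EqClosure (gr S ∪ gr N′) s s′
        go true e = cl-map proj₁ (λ { (inj₁ refl) → cl₁ refl ; {c} (inj₂ refl) → cl₂ (close-end Sep.B c) })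
          (Sep.B-conn (s , e) (s′ , trans (sym (same-ν-end s s′ v)) e) (cong (_== t true) v) i)
        go false e = proj₂ (cl-pred P fw (λ { (inj₁ q) → fw (inj₁ (flip S-FPF q)) ; (inj₂ q) → fw (inj₂ (flip N-FPF q)) })
            (SN-conn s s′ v) (e , ε))
          where
          P : Φ → Set
          P c = isEnd c ≡ false × EqClosure (gr S ∪ gr N′) s c
          fw : ∀ {c d} → SN c d → P c → P d
          fw (inj₁ refl) (q , r) = q , (r ◅◅ cl₁ refl)
          fw {c} (inj₂ refl) (q , r) = trans (same-ν-end (N c) c (N-ν c)) q , (r ◅◅ cl₂ (close-inner Sep.B q))

      N′ᵢ : ∀ i → Flg (Kᵢ i) → Flg (Kᵢ i)
      N′ᵢ = component {N′} N′-index

      Cᵢ : ∀ i → ∃[ k ] Classes (gr (Mᵢ i) ∪ gr (N′ᵢ i)) k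
      Cᵢ i = classes₂ (Flg-size (Kᵢ i)) (Mᵢ i) (N′ᵢ i)

      -- `close-classes` writes both face numbers as the same `closed-cycles` plus a count on the
      -- ends, so the comparison reduces to `faces-≤` there.
      total : f + 1 ≤ proj₁ (Cᵢ true) + proj₁ (Cᵢ false)
      total = subst₂ _≤_ (classes-unique (classes-cong to-N from-N (close-classes CN)) facesΦ)
          (classes-unique (close-classes CB) (classes-lift {M} {N′} {Mᵢ} {N′ᵢ} (λ _ _ → refl) (component-≡ {N′} N′-index) (λ i → proj₂ (Cᵢ i))))
          (ℕ.+-monoʳ-≤ closed-cycles (Sep.faces-≤ CN CB))
        where
        CN : Classes (gr mate ∪ gr NE) (proj₁ (classes₂ FE mate NE))
        CN = proj₂ (classes₂ FE mate NE)
        CB : Classes (gr mate ∪ gr Sep.B) (proj₁ (classes₂ FE mate Sep.B))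
        CB = proj₂ (classes₂ FE mate Sep.B)
        close-NE : ∀ s → close NE s ≡ N s
        close-NE s = go (isEnd s) refl
          where
          go : ∀ b → isEnd s ≡ b → close NE s ≡ N s
          go true e = close-end NE (s , e)
          go false e = close-inner NE e
        to-N : ∀ {a b} → (gr M ∪ gr (close NE)) a b → EqClosure (gr M ∪ gr N) a b
        to-N (inj₁ r) = cl₁ r
        to-N {a} (inj₂ r) = cl₂ (trans (sym (close-NE a)) r)
        from-N : ∀ {a b} → (gr M ∪ gr N) a b → EqClosure (gr M ∪ gr (close NE)) a b
        from-N (inj₁ r) = cl₁ r
        from-N {a} (inj₂ r) = cl₂ (trans (close-NE a) r)

    lower : Σ (Bool → ℕ) λ fᵢ → (∀ i → MapOn (Kᵢ i) (fᵢ i)) × f + 1 ≤ fᵢ true + fᵢ false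
    lower = (λ i → proj₁ (Cᵢ i)) , (λ i → record
      { N = N′ᵢ i ; M = Mᵢ i ; N-FPF = component-FPF {N′} N′-index (close-FPF Sep.B-FPF) i
      ; N-vert = λ a → φ-inj i (trans (cong ν (sym (component-≡ {N′} N′-index i a))) (N′-ν (i , a)))
      ; N-conn = λ a b e → project (λ _ _ → refl) (component-≡ {N′} N′-index) (SN′-conn (i , a) (i , b) refl (cong (φ i) e))
      ; M-inv = Mᵢ-inv i ; M-vert = λ _ → refl ; M-head = λ _ → refl ; M-flip = Mᵢ-flip i
      ; faces = proj₂ (Cᵢ i) }) , total

-- From embeddings of the parts to an embedding of the amalgam

module UpperBound (𝒜 : Amalgam) {f : Bool → ℕ} (μ : ∀ i → MapOn (Amalgam.Kᵢ 𝒜 i) (f i)) where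
  open AmalgamFlags 𝒜

  private
    Mᵢ Nᵢ : ∀ i → Flg (Kᵢ i) → Flg (Kᵢ i)
    Mᵢ i = MapOn.M (μ i)
    Nᵢ i = MapOn.N (μ i)

  module _ (untwisted : ∀ i → Untwisted i (Mᵢ i)) where
    private
      M N₀ : Φ → Φ
      M = lift Mᵢ
      N₀ = lift Nᵢ
      M-FPF : FPFInvolution M
      M-FPF = lift-FPF (λ i → MapOn.M-FPF (μ i))
      N₀-FPF : FPFInvolution N₀
      N₀-FPF = lift-FPF (λ i → MapOn.N-FPF (μ i))
      N₀-ν : ∀ s → ν (N₀ s) ≡ ν s
      N₀-ν (i , a) = cong (φ i) (MapOn.N-vert (μ i) a)

      p q : Bool → Φ
      p c = inn (true , c)
      q c = inn (false , c)
      ν-p : ∀ c → ν (p c) ≡ t c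
      ν-p c = φ-t true c
      ν-q : ∀ c → ν (q c) ≡ t c
      ν-q c = φ-t false c

      true≢false′ : true ≢ false
      true≢false′ ()
      tx≢ty : ∀ {s} → ν s ≡ t true → ν s ≡ t false → ⊥
      tx≢ty a b = true≢false′ (t-inj (trans (sym a) b))

      -- At `x` the corners next to the doubled edge are recombined, which joins the rotations of
      -- the two parts. This may cost one face.
      module W₁ = Swap Φ-finite N₀-FPF (p true) (q true) (λ e → true≢false′ (cong proj₁ e)) (λ e → true≢false′ (sym (cong proj₁ e)))

      N₁ : Φ → Φ
      N₁ = W₁.swap
      N₁-ν : ∀ s → ν (N₁ s) ≡ ν s
      N₁-ν = W₁.swap-preserves {φ = ν} N₀-ν (trans (ν-p true) (sym (ν-q true)))
      N₁-else : ∀ s → ν s ≢ t true → N₁ s ≡ N₀ s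
      N₁-else s ≢x = W₁.swap-else
        (λ e → ≢x (trans (cong ν e) (ν-p true))) (λ e → ≢x (trans (cong ν e) (ν-q true)))
        (λ e → ≢x (trans (cong ν e) (trans (N₀-ν (p true)) (ν-p true))))
        (λ e → ≢x (trans (cong ν e) (trans (N₀-ν (q true)) (ν-q true))))
      N₁-py : N₁ (p false) ≡ N₀ (p false)
      N₁-py = N₁-else (p false) (λ e → tx≢ty {p false} e (ν-p false))

      -- At `y` the same exchange closes off the digon as a face of its own, which makes up for the
      -- face lost at `x`.
      module W₂ = Swap Φ-finite W₁.swap-FPF (p false) (q false) (λ e → true≢false′ (cong proj₁ e))
        (λ e → true≢false′ (sym (cong proj₁ (trans e N₁-py))))

      N : Φ → Φ
      N = W₂.swap
      N-FPF : FPFInvolution N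
      N-FPF = W₂.swap-FPF
      N-ν : ∀ s → ν (N s) ≡ ν s
      N-ν = W₂.swap-preserves {φ = ν} N₁-ν (trans (ν-p false) (sym (ν-q false)))
      N-else : ∀ s → ν s ≢ t false → N s ≡ N₁ s
      N-else s ≢y = W₂.swap-else
        (λ e → ≢y (trans (cong ν e) (ν-p false))) (λ e → ≢y (trans (cong ν e) (ν-q false)))
        (λ e → ≢y (trans (cong ν e) (trans (N₁-ν (p false)) (ν-p false))))
        (λ e → ≢y (trans (cong ν e) (trans (N₁-ν (q false)) (ν-q false))))

      N-inner : ∀ d → N (inn d) ≡ inn (n4 d)
      N-inner (true , false) = W₂.swap-p
      N-inner (false , false) = W₂.swap-q
      N-inner (true , true) = trans (N-else (p true) (λ e → tx≢ty {p true} (ν-p true) e)) W₁.swap-p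
      N-inner (false , true) = trans (N-else (q true) (λ e → tx≢ty {q true} (ν-q true) e)) W₁.swap-q

      M-inner : ∀ d → M (inn d) ≡ inn (m4 d)
      M-inner = lift-inner {Mᵢ} untwisted

      digon-closed : ∀ {s} → EqClosure (gr M ∪ gr N) (p false) s → ∃[ d ] s ≡ inn d
      digon-closed r = cl-pred (λ s → ∃[ d ] s ≡ inn d) fw
          (λ { (inj₁ e) → fw (inj₁ (flip M-FPF e)) ; (inj₂ e) → fw (inj₂ (flip N-FPF e)) }) r ((true , false) , refl)
        where
        fw : ∀ {s s′} → (gr M ∪ gr N) s s′ → (∃[ d ] s ≡ inn d) → ∃[ d ] s′ ≡ inn d
        fw (inj₁ refl) (d , refl) = m4 d , M-inner d
        fw (inj₂ refl) (d , refl) = n4 d , N-inner d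

      CN : ∃[ k ] Classes (gr M ∪ gr N) k
      CN = classes₂ Φ-finite M N
      CN₁ : ∃[ k ] Classes (gr M ∪ gr N₁) k
      CN₁ = classes₂ Φ-finite M N₁

      p≁N₁p : ¬ EqClosure (gr M ∪ gr N) (p false) (N₁ (p false))
      p≁N₁p r = go (proj₁ (digon-closed r)) (proj₂ (digon-closed r))
        where
        go : ∀ d → N₁ (p false) ≡ inn d → ⊥
        go (true , true) e = tx≢ty {p true} (ν-p true) (trans (cong ν (sym e)) (trans (N₁-ν (p false)) (ν-p false)))
        go (false , true) e = tx≢ty {q true} (ν-q true) (trans (cong ν (sym e)) (trans (N₁-ν (p false)) (ν-p false)))
        go (true , false) e = fpf W₁.swap-FPF (p false) e
        go (false , false) e = true≢false′ (cong proj₁ (trans (sym N₁-py) e))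

      -- Before the exchange at `y` the digon is open there, and `p false` and `q false` lie on one
      -- face; afterwards it is separated from `N₁ (p false)`.
      faces-N₁ : proj₁ CN₁ + 1 ≤ proj₁ CN
      faces-N₁ = go (add-edge (proj₂ CN) (p false) (N₁ (p false)))
        where
        p∼q : EqClosure (gr M ∪ gr N₁) (p false) (q false)
        p∼q = cl₁ (M-inner (true , false)) ◅◅ cl₂ W₁.swap-p ◅◅ cl₁ (M-inner (false , true))
        R : Rel Φ 0ℓ
        R = (gr M ∪ gr N) ∪ edge (p false) (N₁ (p false))
        go : (EqClosure (gr M ∪ gr N) (p false) (N₁ (p false)) × Classes R (proj₁ CN)) ⊎
          (¬ EqClosure (gr M ∪ gr N) (p false) (N₁ (p false)) × ∃[ k′ ] (proj₁ CN ≡ suc k′ × Classes R k′)) →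
          proj₁ CN₁ + 1 ≤ proj₁ CN
        go (inj₁ (r , _)) = ⊥-elim (p≁N₁p r)
        go (inj₂ (_ , d , e , D)) = subst₂ _≤_ (ℕ.+-comm 1 (proj₁ CN₁)) (sym e) (s≤s (classes-antitone D (proj₂ CN₁)
          λ { (inj₁ (inj₁ r)) → cl₁ r ; (inj₁ (inj₂ r)) → W₂.swap⊆ cl₂ p∼q r ; (inj₂ (refl , refl)) → cl₂ refl }))

      faces-N₀ : f true + f false ≤ proj₁ CN
      faces-N₀ = ℕ.≤-trans (W₁.swap-classes (classes-lift {M} {N₀} {Mᵢ} {Nᵢ} (λ _ _ → refl) (λ _ _ → refl) (λ i → MapOn.faces (μ i))) (proj₂ CN₁))
        (subst (_≤ proj₁ CN) (ℕ.+-comm (proj₁ CN₁) 1) faces-N₁)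

      -- A matching that preserves the digon flags preserves their complement, which is the set of
      -- flags of `K`.
      module Descend {σ : Φ → Φ} (I : FPFInvolution σ) (δ : Four → Four) (σ-inner : ∀ d → σ (inn d) ≡ inn (δ d)) where
        opaque
          outer-out : ∀ s h → θ s ≡ inj₁ h → ∃[ h′ ] θ (σ s) ≡ inj₁ h′
          outer-out s h e with view (σ s)
          ... | outer i a _ _ r = gF i a , r
          ... | inner i c r _ = inj₁≢inj₂ (trans (sym e) (trans (cong θ (trans (sym (flip I r)) (σ-inner (i , c)))) (θ-inner _ _)))
        σK : Flg K → Flg K
        σK h = proj₁ (outer-out (back (inj₁ h)) h (θ-back (inj₁ h)))
        θ-σ : ∀ s → θ (σ s) ≡ mapW σK δ (θ s)
        θ-σ s with view s
        ... | inner i c refl r = trans (cong θ (σ-inner (i , c))) (trans (θ-inner _ _) (cong (mapW σK δ) (sym r)))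
        ... | outer i a refl _ r = trans (trans (cong (θ ∘ σ) (trans (sym (back-θ s)) (cong back r)))
          (proj₂ (outer-out (back (inj₁ (gF i a))) (gF i a) (θ-back (inj₁ (gF i a)))))) (cong (mapW σK δ) (sym r))
        σ-back : ∀ h → θ (σ (back (inj₁ h))) ≡ inj₁ (σK h)
        σ-back h = trans (θ-σ (back (inj₁ h))) (cong (mapW σK δ) (θ-back (inj₁ h)))
        σK-FPF : FPFInvolution σK
        σK-FPF = record
          { invol = λ h → Sum.inj₁-injective (trans (sym (σ-back (σK h)))
              (trans (cong (θ ∘ σ) (trans (cong back (sym (σ-back h))) (back-θ _))) (trans (cong θ (invol I _)) (θ-back _))))
          ; fpf = λ h e → fpf I (back (inj₁ h)) (trans (sym (back-θ _)) (cong back (trans (σ-back h) (cong inj₁ e)))) }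

      module DM = Descend M-FPF m4 M-inner
      module DN = Descend N-FPF n4 N-inner
      MK NK : Flg K → Flg K
      MK = DM.σK
      NK = DN.σK

      MK-outer : ∀ i a → ¬ Inner (i , a) → MK (gF i a) ≡ gF i (Mᵢ i a)
      MK-outer i a ¬p = Sum.inj₁-injective (trans (cong (mapW MK m4) (sym (θ-outer i a ¬p)))
        (trans (sym (DM.θ-σ (i , a))) (θ-outer i (Mᵢ i a) ¬p′)))
        where
        ¬p′ : ¬ Inner (i , Mᵢ i a)
        ¬p′ (c , e) = ¬p (not c , trans (sym (MapOn.M-inv (μ i) a)) (trans (cong (Mᵢ i) e) (untwisted i c (not i))))

      MK-e : ∀ c i → MK (eflagK c i) ≡ eflagK (not c) i
      MK-e c i = trans (cong MK (sym (gF-eflag i c i))) (trans (MK-outer i _ (not-inner i c))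
        (trans (cong (gF i) (untwisted i c i)) (gF-eflag i (not c) i)))

      data Outer (h : Flg K) : Set where
        mk : ∀ i a → ¬ Inner (i , a) → h ≡ gF i a → Outer h

      outer-view : ∀ h → Outer h
      outer-view h with view (back (inj₁ h))
      ... | outer i a _ ¬p r = mk i a ¬p (Sum.inj₁-injective (trans (sym (θ-back (inj₁ h))) r))
      ... | inner i c _ r = inj₁≢inj₂ (trans (sym (θ-back (inj₁ h))) r)

      inner-flip : ∀ {i a c} → flipS a ≡ eflag i c (not i) → a ≡ eflag i c i
      inner-flip {i} {a} {c} e = trans (sym (invol flipS-FPF a)) (trans (cong flipS e) (Flg-≡ refl refl (Bool.not-involutive i)))

      MK-vert : ∀ h → vert (MK h) ≡ head h
      MK-vert h with outer-view h
      ... | mk i a ¬p refl = trans (cong vert (MK-outer i a ¬p)) (cong (φ i) (MapOn.M-vert (μ i) a))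

      MK-head : ∀ h → head (MK h) ≡ vert h
      MK-head h with outer-view h
      ... | mk i a ¬p refl = trans (cong head (MK-outer i a ¬p)) (cong (φ i) (MapOn.M-head (μ i) a))

      MK-flip : ∀ h → MK (flipS h) ≡ flipS (MK h)
      MK-flip h with outer-view h
      ... | mk i a ¬p refl with Inner? (i , flipS a)
      ...   | no ¬p′ = trans (MK-outer i (flipS a) ¬p′) (trans (cong (gF i) (MapOn.M-flip (μ i) a)) (cong flipS (sym (MK-outer i a ¬p))))
      ...   | yes (c , e) with refl ← inner-flip e = trans (cong (MK ∘ flipS) (gF-eflag i c i))
              (trans (MK-e c (not i)) (cong flipS (trans (sym (MK-e c i)) (cong MK (sym (gF-eflag i c i))))))

      NK-vert : ∀ h → vert (NK h) ≡ vert h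
      NK-vert h = trans (cong νW (sym (DN.σ-back h))) (trans (ν-θ _) (trans (N-ν _) (trans (sym (ν-θ _)) (cong νW (θ-back (inj₁ h))))))

      SN : Rel Φ 0ℓ
      SN = gr S ∪ gr N

      -- The exchange involves two different cycles of `S` and `N₀`, one in each part, and by
      -- `merge` it joins them into one.
      N₀⊆N₁ : ∀ {s s′} → EqClosure (gr S ∪ gr N₀) s s′ → EqClosure (gr S ∪ gr N₁) s s′
      N₀⊆N₁ = cl-map id λ { (inj₁ r) → cl₁ r ; (inj₂ r) → W₁.⊆swap cl₂ (W₁.merge S-FPF p≁q) r }
        where
        p≁q : ¬ EqClosure (gr S ∪ gr N₀) (p true) (q true)
        p≁q r = true≢false′ (cl-inv {φ = proj₁} (λ { (inj₁ refl) → refl ; (inj₂ refl) → refl }) r)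

      N₁⊆N : ∀ {s s′} → EqClosure (gr S ∪ gr N₁) s s′ → EqClosure SN s s′
      N₁⊆N = cl-map id λ { (inj₁ r) → cl₁ r ; (inj₂ r) → W₂.⊆swap cl₂ (W₂.merge S-FPF p≁q) r }
        where
        P : Φ → Set
        P s = ν s ≡ t false × proj₁ s ≡ true
        fw : ∀ {s s′} → (gr S ∪ gr N₁) s s′ → P s → P s′
        fw (inj₁ refl) h = h
        fw {s} (inj₂ refl) (v , i) = trans (N₁-ν s) v , trans (cong proj₁ (N₁-else s (λ e → tx≢ty {s} e v))) i
        p≁q : ¬ EqClosure (gr S ∪ gr N₁) (p false) (q false)
        p≁q r = true≢false′ (sym (proj₂ (cl-pred P fw
          (λ { (inj₁ e) → fw (inj₁ (flip S-FPF e)) ; (inj₂ e) → fw (inj₂ (flip W₁.swap-FPF e)) }) r (ν-p false , refl))))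

      part-conn : ∀ i a b → vert a ≡ vert b → EqClosure SN (i , a) (i , b)
      part-conn i a b e = N₁⊆N (N₀⊆N₁ (cl-map (i ,_) (λ { (inj₁ r) → cl₁ (cong (i ,_) r) ; (inj₂ r) → cl₂ (cong (i ,_) r) })
        (MapOn.N-conn (μ i) a b e)))

      inn-conn : ∀ i j c → EqClosure SN (inn (i , c)) (inn (j , c))
      inn-conn true true c = ε
      inn-conn false false c = ε
      inn-conn true false c = cl₂ (N-inner (true , c))
      inn-conn false true c = cl₂ (N-inner (false , c))

      SN-conn : ∀ s s′ → ν s ≡ ν s′ → EqClosure SN s s′
      SN-conn (i , a) (j , b) e = go (meet i j (vert a) (vert b) e) refl refl
        where
        go : ∀ {v w} → Meet i j v w → vert a ≡ v → vert b ≡ w → EqClosure SN (i , a) (j , b)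
        go same e₁ e₂ = part-conn i a b (trans e₁ (sym e₂))
        go (term c) e₁ e₂ = part-conn i a _ e₁ ◅◅ inn-conn i j c ◅◅ part-conn j _ b (sym e₂)

      -- Shrinks the digon: its flags go to the other side of the same copy of the edge, so that a
      -- corner of the digon becomes a change of side in `K`.
      collapseW : W → Flg K
      collapseW (inj₁ h) = h
      collapseW (inj₂ (i , c)) = eflagK c i

      collapse : Φ → Flg K
      collapse = collapseW ∘ θ

      collapse-S : ∀ s → EqClosure (gr flipS ∪ gr NK) (collapse s) (collapse (S s))
      collapse-S s = go (view s)
        where
        R : Rel (Flg K) 0ℓ
        R = gr flipS ∪ gr NK
        outer-case : ∀ i a → θ (i , a) ≡ inj₁ (gF i a) → Dec (Inner (i , flipS a)) →
          EqClosure R (collapse (i , a)) (collapse (i , flipS a))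
        outer-case i a r (no ¬p′) = cl-refl (cong collapseW r) ◅◅ cl₁ refl ◅◅ cl-refl (sym (cong collapseW (θ-outer i (flipS a) ¬p′)))
        outer-case i a r (yes (c , e)) = cl-refl (trans (cong collapseW r) (trans (cong (gF i) (inner-flip e)) (trans (gF-eflag i c i)
              (sym (cong collapseW (trans (cong (λ b → θ (i , b)) e) (θ-inner i c)))))))
        go : View s → EqClosure R (collapse s) (collapse (S s))
        go (inner i c refl r) = cl-refl (trans (cong collapseW r) (sym (cong collapseW
              (trans (cong θ (cong (λ b → (i , eflag i c b)) (Bool.not-involutive i))) (θ-eflag i c)))))
        go (outer i a refl ¬p r) = outer-case i a r (Inner? (i , flipS a))

      collapse-N : ∀ s → EqClosure (gr flipS ∪ gr NK) (collapse s) (collapse (N s))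
      collapse-N s = step (θ s) ◅◅ cl-refl (sym (cong collapseW (DN.θ-σ s)))
        where
        step : ∀ w → EqClosure (gr flipS ∪ gr NK) (collapseW w) (collapseW (mapW NK n4 w))
        step (inj₁ h) = cl₂ refl
        step (inj₂ (i , c)) = cl₁ refl

      NK-conn : ∀ h h′ → vert h ≡ vert h′ → EqClosure (gr flipS ∪ gr NK) h h′
      NK-conn h h′ e = cl-refl (sym (cong collapseW (θ-back (inj₁ h)))) ◅◅
        cl-map collapse (λ { {s} (inj₁ refl) → collapse-S s ; {s} (inj₂ refl) → collapse-N s })
          (SN-conn (back (inj₁ h)) (back (inj₁ h′)) (trans (ν-b h) (trans e (sym (ν-b h′)))))
        ◅◅ cl-refl (cong collapseW (θ-back (inj₁ h′)))
        where
        ν-b : ∀ h → ν (back (inj₁ h)) ≡ vert h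
        ν-b h = trans (sym (ν-θ _)) (cong νW (θ-back (inj₁ h)))

      CK : ∃[ k ] Classes (gr MK ∪ gr NK) k
      CK = classes₂ (Flg-size K) MK NK

    upper : ∃[ k ] (MapOn K k × f true + f false ≤ k + 1)
    upper = proj₁ CK , record
      { N = NK ; M = MK ; N-FPF = DN.σK-FPF ; N-vert = NK-vert ; N-conn = NK-conn
      ; M-inv = invol DM.σK-FPF ; M-vert = MK-vert ; M-head = MK-head ; M-flip = MK-flip ; faces = proj₂ CK } ,
      subst (f true + f false ≤_) (classes-unique (proj₂ CN) (θ-faces {M} {N} {MK} {NK} DM.θ-σ DN.θ-σ (proj₂ CK))) faces-N₀

-- Reversing the local orientation at a vertex

module _ {Γ : Graph} {f : ℕ} (μ : MapOn Γ f) (v : Fin (n Γ)) where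
  open MapOn μ

  private
    at? : (a : Flg Γ) → Dec (vert a ≡ v)
    at? a = vert a ≟ v

    r : Flg Γ → Flg Γ
    r a = if does (at? a) then flipS a else a

    r-vert : ∀ a → vert (r a) ≡ vert a
    r-vert a with does (at? a)
    ... | true = refl
    ... | false = refl

    r-head : ∀ a → head (r a) ≡ head a
    r-head a with does (at? a)
    ... | true = refl
    ... | false = refl

    r-at : ∀ a → vert a ≡ v → r a ≡ flipS a
    r-at a e rewrite dec-true (at? a) e = refl

    r-off : ∀ a → vert a ≢ v → r a ≡ a
    r-off a e rewrite dec-false (at? a) e = refl

    r-invol : ∀ a → r (r a) ≡ a
    r-invol a with vert a ≟ v
    ... | yes e = trans (r-at (flipS a) e) (invol flipS-FPF a)
    ... | no ¬e = r-off a ¬e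

    r-flip : ∀ a → r (flipS a) ≡ flipS (r a)
    r-flip a with vert a ≟ v
    ... | yes e = refl
    ... | no ¬e = refl

    conj : (Flg Γ → Flg Γ) → Flg Γ → Flg Γ
    conj g a = r (g (r a))

    conj-invol : ∀ g → (∀ a → g (g a) ≡ a) → ∀ a → conj g (conj g a) ≡ a
    conj-invol g h a = trans (cong (r ∘ g) (r-invol (g (r a)))) (trans (cong r (h (r a))) (r-invol a))

    to : ∀ (g h : Flg Γ → Flg Γ) {a b} → EqClosure (gr g ∪ gr h) a b → EqClosure (gr (conj g) ∪ gr (conj h)) (r a) (r b)
    to g h = cl-map r λ { {a} (inj₁ refl) → cl₁ (cong (r ∘ g) (r-invol a)) ; {a} (inj₂ refl) → cl₂ (cong (r ∘ h) (r-invol a)) }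

    conj-flip : ∀ a → conj flipS a ≡ flipS a
    conj-flip a = trans (r-flip (r a)) (cong flipS (r-invol a))

  -- Exchanging the sides of all flags at `v` only relabels the map, so the faces persist, but every
  -- edge at `v` changes its twist; `untwist` uses this to straighten one given edge.
  switch : MapOn Γ f
  switch = record
    { N = conj N ; M = conj M
    ; N-FPF = record { invol = conj-invol N (invol N-FPF) ; fpf = λ a e → fpf N-FPF (r a) (trans (sym (r-invol (N (r a)))) (cong r e)) }
    ; N-vert = λ a → trans (r-vert (N (r a))) (trans (N-vert (r a)) (r-vert a))
    ; N-conn = λ a b e → cl-refl (sym (r-invol a)) ◅◅
        cl-map id (λ { {c} (inj₁ q) → cl₁ (trans (sym (conj-flip c)) q) ; (inj₂ q) → cl₂ q })
          (to flipS N (N-conn (r a) (r b) (trans (r-vert a) (trans e (sym (r-vert b)))))) ◅◅ cl-refl (r-invol b)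
    ; M-inv = conj-invol M M-inv
    ; M-vert = λ a → trans (r-vert (M (r a))) (trans (M-vert (r a)) (r-head a))
    ; M-head = λ a → trans (r-head (M (r a))) (trans (M-head (r a)) (r-vert a))
    ; M-flip = λ a → trans (cong (r ∘ M) (r-flip a)) (trans (cong r (M-flip (r a))) (r-flip (M (r a))))
    ; faces = classes-transport r r (λ q → to M N (Eq.return q))
        (λ { {a} (inj₁ refl) → cl₁ (sym (r-invol (M (r a)))) ; {a} (inj₂ refl) → cl₂ (sym (r-invol (N (r a)))) })
        (λ a → cl-refl (r-invol a)) (λ a → cl-refl (r-invol a)) faces }

  switch-M : ∀ a → vert a ≡ v → head a ≢ v → MapOn.M switch a ≡ M (flipS a)
  switch-M a e ne = trans (r-off (M (r a)) (λ q → ne (trans (sym (M-vert-r)) q))) (cong M (r-at a e))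
    where
    M-vert-r : vert (M (r a)) ≡ head a
    M-vert-r = trans (M-vert (r a)) (r-head a)

untwist : ∀ {Γ f} → MapOn Γ f → ∀ {v u} (e : E Γ v u ≡ true) (e′ : E Γ u v ≡ true) →
  Σ (MapOn Γ f) λ μ → ∀ b → MapOn.M μ (flg v u b e) ≡ flg u v b e′ × MapOn.M μ (flg u v b e′) ≡ flg v u b e
untwist {Γ} {f} μ {v} {u} e e′ = go (side (MapOn.M μ (flg v u true e))) refl
  where
  fix : (μ : MapOn Γ f) → side (MapOn.M μ (flg v u true e)) ≡ true →
    ∀ b → MapOn.M μ (flg v u b e) ≡ flg u v b e′ × MapOn.M μ (flg u v b e′) ≡ flg v u b e
  fix μ s b = there′ b , trans (cong M (sym (there′ b))) (M-inv _)
    where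
    open MapOn μ
    there-true : M (flg v u true e) ≡ flg u v true e′
    there-true = Flg-≡ (M-vert _) (M-head _) s
    there′ : ∀ b → M (flg v u b e) ≡ flg u v b e′
    there′ true = there-true
    there′ false = trans (M-flip (flg v u true e)) (cong flipS there-true)
  go : ∀ b → side (MapOn.M μ (flg v u true e)) ≡ b → Σ (MapOn Γ f) λ μ → ∀ b →
    MapOn.M μ (flg v u b e) ≡ flg u v b e′ × MapOn.M μ (flg u v b e′) ≡ flg v u b e
  go true s = μ , fix μ s
  go false s = switch μ v , fix (switch μ v) (trans (cong side (switch-M μ v (flg v u true e) refl (λ q → E-≢ Γ e (sym q))))
    (trans (cong side (MapOn.M-flip μ (flg v u true e))) (cong not s)))

-- Additivity of the Euler genus over a common edge

module Additivity (𝒜 : Amalgam) where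
  open AmalgamFlags 𝒜

  private
    c e iso : Graph → ℕ
    c = numComps
    e = numEdges
    iso = isolatedCount

    untwistᵢ : ∀ i {f} → MapOn (Kᵢ i) f → Σ (MapOn (Kᵢ i) f) λ μ → Untwisted i (MapOn.M μ)
    untwistᵢ i μ with untwist μ (ee i true) (ee i false)
    ... | μ′ , h = μ′ , λ { true b → proj₁ (h b) ; false b → proj₂ (h b) }

    untwistK : ∀ {f} → MapOn K f → Σ (MapOn K f) λ μ → ∀ c b → MapOn.M μ (eflagK c b) ≡ eflagK (not c) b
    untwistK μ with untwist μ (eK true) (eK false)
    ... | μ′ , h = μ′ , λ { true b → proj₁ (h b) ; false b → proj₂ (h b) }

  embeds-sum : (k : Bool → ℕ) → (∀ i → EmbedsIn (Kᵢ i) (k i)) → EmbedsIn K (k true + k false)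
  embeds-sum k em = map⇒embeds {K} {k true + k false} (proj₁ (proj₂ up)) (arith (k true) (k false)
      (c K) (c (Kᵢ true)) (c (Kᵢ false)) (e K) (e (Kᵢ true)) (e (Kᵢ false)) (n K) (n (Kᵢ true)) (n (Kᵢ false))
      (iso K) (iso (Kᵢ true)) (iso (Kᵢ false)) (proj₁ up) (f true) (f false)
      components edges vertices isolated-sum (proj₂ (proj₂ up)) (proj₂ (proj₂ (maps true))) (proj₂ (proj₂ (maps false))))
    where
    maps : ∀ i → ∃[ f ] (MapOn (Kᵢ i) f × EulerBound (Kᵢ i) (k i) f)
    maps i = embeds⇒map {Kᵢ i} {k i} (em i)
    f : Bool → ℕ
    f i = proj₁ (maps i)
    up : ∃[ k ] (MapOn K k × f true + f false ≤ k + 1)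
    up = UpperBound.upper 𝒜 (λ i → proj₁ (untwistᵢ i (proj₁ (proj₂ (maps i))))) (λ i → proj₂ (untwistᵢ i (proj₁ (proj₂ (maps i)))))
    arith : ∀ kt kf c ct cf e et ef n nt nf i it iff F ft ff → c + 1 ≡ ct + cf → e + 1 ≡ et + ef → n + 2 ≡ nt + nf → i ≡ it + iff →
      ft + ff ≤ F + 1 → 2 * ct + et ≤ kt + nt + (ft + it) → 2 * cf + ef ≤ kf + nf + (ff + iff) →
      2 * c + e ≤ kt + kf + n + (F + i)
    -- The excess of the summands is 2·1 + 1 from one component and one edge on the left, and 2 + 1
    -- from two vertices and one face on the right; so 3 cancels.
    arith kt kf c ct cf e et ef n nt nf i it iff F ft ff h₁ h₂ h₃ refl h₅ h₆ h₇ = ℕ.+-cancelʳ-≤ 3 _ _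
      (ℕ.+-cancelʳ-≤ (ft + ff) _ _ (subst₂ _≤_ l r (≤-sum (≤-sum h₆ h₇) h₅)))
      where
      lem₁ : ∀ ct cf et ef s → (2 * ct + et + (2 * cf + ef)) + s ≡ 2 * (ct + cf) + (et + ef) + s
      lem₁ = solve-∀
      lem₂ : ∀ c e s → 2 * (c + 1) + (e + 1) + s ≡ 2 * c + e + 3 + s
      lem₂ = solve-∀
      lem₃ : ∀ kt kf nt nf ft ff it iff F → (kt + nt + (ft + it) + (kf + nf + (ff + iff))) + (F + 1) ≡
        kt + kf + (nt + nf) + (F + (it + iff)) + 1 + (ft + ff)
      lem₃ = solve-∀
      lem₄ : ∀ k n s u → k + (n + 2) + s + 1 + u ≡ k + n + s + 3 + u
      lem₄ = solve-∀
      l = trans (lem₁ ct cf et ef (ft + ff)) (trans (cong₂ (λ s t → 2 * s + t + (ft + ff)) (sym h₁) (sym h₂)) (lem₂ c e (ft + ff)))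
      r = trans (lem₃ kt kf nt nf ft ff it iff F) (trans (cong (λ s → kt + kf + s + (F + (it + iff)) + 1 + (ft + ff)) (sym h₃))
        (lem₄ (kt + kf) n (F + (it + iff)) (ft + ff)))

  embeds-split : ∀ {k} → EmbedsIn K k → Σ (Bool → ℕ) λ kᵢ → (∀ i → EmbedsIn (Kᵢ i) (kᵢ i)) × kᵢ true + kᵢ false ≤ k
  embeds-split {k} em = kᵢ , (λ i → map⇒embeds {Kᵢ i} {kᵢ i} (maps i) (bound i)) ,
    arith (kᵢ true) (kᵢ false) k
      (c K) (c (Kᵢ true)) (c (Kᵢ false)) (e K) (e (Kᵢ true)) (e (Kᵢ false)) (n K) (n (Kᵢ true)) (n (Kᵢ false))
      (iso K) (iso (Kᵢ true)) (iso (Kᵢ false)) F (fᵢ true) (fᵢ false)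
      components edges vertices isolated-sum (proj₂ (proj₂ low)) (exact true) (exact false) (proj₂ (proj₂ (embeds⇒map {K} {k} em)))
    where
    F : ℕ
    F = proj₁ (embeds⇒map {K} {k} em)
    μK : Σ (MapOn K F) λ μ → ∀ c b → MapOn.M μ (eflagK c b) ≡ eflagK (not c) b
    μK = untwistK (proj₁ (proj₂ (embeds⇒map {K} {k} em)))
    low : Σ (Bool → ℕ) λ fᵢ → (∀ i → MapOn (Kᵢ i) (fᵢ i)) × F + 1 ≤ fᵢ true + fᵢ false
    low = LowerBound.lower 𝒜 (proj₁ μK) (proj₂ μK)
    fᵢ : Bool → ℕ
    fᵢ = proj₁ low
    maps : ∀ i → MapOn (Kᵢ i) (fᵢ i)
    maps = proj₁ (proj₂ low)
    kᵢ : Bool → ℕ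
    -- The exact Euler genus of the embedding found; by `euler-≤` the truncated subtraction
    -- truncates nothing.
    kᵢ i = (2 * c (Kᵢ i) + e (Kᵢ i)) ∸ (n (Kᵢ i) + (fᵢ i + iso (Kᵢ i)))
    exact : ∀ i → kᵢ i + (n (Kᵢ i) + (fᵢ i + iso (Kᵢ i))) ≡ 2 * c (Kᵢ i) + e (Kᵢ i)
    exact i = ℕ.m∸n+n≡m (euler-≤ (maps i))
    bound : ∀ i → EulerBound (Kᵢ i) (kᵢ i) (fᵢ i)
    bound i = ℕ.≤-reflexive (trans (sym (exact i)) (sym (ℕ.+-assoc (kᵢ i) (n (Kᵢ i)) _)))
    arith : ∀ kt kf k c ct cf e et ef n nt nf i it iff F ft ff → c + 1 ≡ ct + cf → e + 1 ≡ et + ef → n + 2 ≡ nt + nf → i ≡ it + iff →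
      F + 1 ≤ ft + ff → kt + (nt + (ft + it)) ≡ 2 * ct + et → kf + (nf + (ff + iff)) ≡ 2 * cf + ef →
      2 * c + e ≤ k + n + (F + i) → kt + kf ≤ k
    arith kt kf k c ct cf e et ef n nt nf i it iff F ft ff h₁ h₂ h₃ refl h₅ h₆ h₇ h₈ =
      ℕ.+-cancelʳ-≤ (n + 2 + (ft + ff) + (it + iff)) _ _ (subst₂ _≤_ l r
        (ℕ.≤-trans (ℕ.+-monoʳ-≤ 3 h₈) (ℕ.≤-trans (ℕ.≤-reflexive (lem₅ k n F (it + iff)))
          (ℕ.+-monoʳ-≤ (k + n + (it + iff) + 2) h₅))))
      where
      lem₅ : ∀ k n F i → 3 + (k + n + (F + i)) ≡ k + n + i + 2 + (F + 1)
      lem₅ = solve-∀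
      lem₆ : ∀ k n i f → k + n + i + 2 + f ≡ k + (n + 2 + f + i)
      lem₆ = solve-∀
      lem₇ : ∀ c e → 3 + (2 * c + e) ≡ 2 * (c + 1) + (e + 1)
      lem₇ = solve-∀
      lem₈ : ∀ ct cf et ef → 2 * (ct + cf) + (et + ef) ≡ (2 * ct + et) + (2 * cf + ef)
      lem₈ = solve-∀
      lem₉ : ∀ kt kf nt nf ft ff it iff → (kt + (nt + (ft + it))) + (kf + (nf + (ff + iff))) ≡ kt + kf + (nt + nf + (ft + ff) + (it + iff))
      lem₉ = solve-∀
      l = trans (lem₇ c e) (trans (cong₂ (λ s t → 2 * s + t) h₁ h₂) (trans (lem₈ ct cf et ef) (trans (cong₂ _+_ (sym h₆) (sym h₇))
        (trans (lem₉ kt kf nt nf ft ff it iff) (cong (λ s → kt + kf + (s + (ft + ff) + (it + iff))) (sym h₃))))))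
      r = lem₆ k n (it + iff) (ft + ff)

-- xy-sums

plus-E⇒ : ∀ G {u v} → E (plus G) u v ≡ true → Adj G u v ⊎ IsTerminalEdge G u v
plus-E⇒ G {u} {v} e with E-adj (plus G) e
... | inj₁ p with ∨-true {adj (graph G) u v} p
...   | inj₁ q = inj₁ (E-intro (graph G) (E-≢ (plus G) e) (inj₁ q))
...   | inj₂ q with ∧-true {u == x G} q
...     | r , s = inj₂ (inj₁ (true-== r , true-== s))
plus-E⇒ G {u} {v} e | inj₂ p with ∨-true {adj (graph G) v u} p
...   | inj₁ q = inj₁ (E-intro (graph G) (E-≢ (plus G) e) (inj₂ q))
...   | inj₂ q with ∧-true {v == x G} q
...     | r , s = inj₂ (inj₂ (true-== s , true-== r))

⇒plus-E : ∀ G {u v} → Adj G u v ⊎ IsTerminalEdge G u v → E (plus G) u v ≡ true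
⇒plus-E G (inj₁ e) with E-adj (graph G) e
... | inj₁ p = E-intro (plus G) (E-≢ (graph G) e) (inj₁ (∨-true₁ p))
... | inj₂ p = E-intro (plus G) (E-≢ (graph G) e) (inj₂ (∨-true₁ p))
⇒plus-E G (inj₂ (inj₁ (refl , refl))) = E-intro (plus G) (x≢y G)
  (inj₁ (∨-true₂ {adj (graph G) (x G) (y G)} (cong₂ _∧_ (==-true {u = x G} refl) (==-true {u = y G} refl))))
⇒plus-E G (inj₂ (inj₂ (refl , refl))) = E-intro (plus G) (λ e → x≢y G (sym e))
  (inj₂ (∨-true₂ {adj (graph G) (x G) (y G)} (cong₂ _∧_ (==-true {u = x G} refl) (==-true {u = y G} refl))))

Adj-sym : ∀ G {u v} → Adj G u v → Adj G v u
Adj-sym G {u} {v} e = trans (E-sym (graph G) v u) e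

record XYSum (G G₁ G₂ : TGraph) : Set where
  field
    f₁      : Fin (V G₁) → Fin (V G)
    f₂      : Fin (V G₂) → Fin (V G)
    f₁-inj  : ∀ {a b} → f₁ a ≡ f₁ b → a ≡ b
    f₂-inj  : ∀ {a b} → f₂ a ≡ f₂ b → a ≡ b
    f₁-x    : f₁ (x G₁) ≡ x G
    f₁-y    : f₁ (y G₁) ≡ y G
    f₂-x    : f₂ (x G₂) ≡ x G
    f₂-y    : f₂ (y G₂) ≡ y G
    covers  : ∀ v → (∃[ a ] f₁ a ≡ v) ⊎ (∃[ b ] f₂ b ≡ v)
    meets   : ∀ {a b} → f₁ a ≡ f₂ b → (a ≡ x G₁ × b ≡ x G₂) ⊎ (a ≡ y G₁ × b ≡ y G₂)
    Adj⇒    : ∀ {u v} → Adj G u v → (∃[ a ] ∃[ a′ ] (f₁ a ≡ u × f₁ a′ ≡ v × Adj G₁ a a′)) ⊎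
                (∃[ b ] ∃[ b′ ] (f₂ b ≡ u × f₂ b′ ≡ v × Adj G₂ b b′))
    Adj₁    : ∀ {a a′} → Adj G₁ a a′ → Adj G (f₁ a) (f₁ a′)
    Adj₂    : ∀ {b b′} → Adj G₂ b b′ → Adj G (f₂ b) (f₂ b′)

fromXYSum : ∀ {G G₁ G₂} → IsXYSum G G₁ G₂ → XYSum G G₁ G₂
fromXYSum (f₁ , f₂ , i₁ , i₂ , x₁ , y₁ , x₂ , y₂ , cov , mt , ad) = record
  { f₁ = f₁ ; f₂ = f₂ ; f₁-inj = i₁ ; f₂-inj = i₂ ; f₁-x = x₁ ; f₁-y = y₁ ; f₂-x = x₂ ; f₂-y = y₂
  ; covers = cov ; meets = λ {a} {b} → mt a b ; Adj⇒ = λ {u} {v} → Equivalence.to (ad u v)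
  ; Adj₁ = λ {a} {a′} e → Equivalence.from (ad _ _) (inj₁ (a , a′ , refl , refl , e))
  ; Adj₂ = λ {b} {b′} e → Equivalence.from (ad _ _) (inj₂ (b , b′ , refl , refl , e)) }

toXYSum : ∀ {G G₁ G₂} → XYSum G G₁ G₂ → IsXYSum G G₁ G₂
toXYSum {G} s = f₁ , f₂ , f₁-inj , f₂-inj , f₁-x , f₁-y , f₂-x , f₂-y , covers , (λ a b → meets) , λ u v →
  mk⇔ Adj⇒ λ { (inj₁ (_ , _ , refl , refl , e)) → Adj₁ e ; (inj₂ (_ , _ , refl , refl , e)) → Adj₂ e }
  where open XYSum s

XYSum-sym : ∀ {G G₁ G₂} → XYSum G G₁ G₂ → XYSum G G₂ G₁
XYSum-sym s = record
  { f₁ = f₂ ; f₂ = f₁ ; f₁-inj = f₂-inj ; f₂-inj = f₁-inj ; f₁-x = f₂-x ; f₁-y = f₂-y ; f₂-x = f₁-x ; f₂-y = f₁-y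
  ; covers = λ v → [ inj₂ , inj₁ ]′ (covers v)
  ; meets = λ e → [ (λ { (p , q) → inj₁ (q , p) }) , (λ { (p , q) → inj₂ (q , p) }) ]′ (meets (sym e))
  ; Adj⇒ = λ e → [ inj₂ , inj₁ ]′ (Adj⇒ e) ; Adj₁ = Adj₂ ; Adj₂ = Adj₁ }
  where open XYSum s

-- The edge added between the terminals is the common edge. The Boolean `true` stands for the first
-- summand and for the terminal `x`.
amalgam : ∀ {G G₁ G₂} → XYSum G G₁ G₂ → Amalgam
amalgam {G} {G₁} {G₂} s = record
  { K = plus G
  ; Kᵢ = λ i → plus (Gᵢ i)
  ; t = terminal G
  ; tᵢ = λ i → terminal (Gᵢ i)
  ; φ = φ
  ; φ-inj = λ { true → f₁-inj ; false → f₂-inj }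
  ; φ-t = φ-t
  ; cover = λ v → [ (λ { (a , e) → true , a , e }) , (λ { (b , e) → false , b , e }) ]′ (covers v)
  ; common = common
  ; E-φ = λ i e → ⇒plus-E G (E-φ i (plus-E⇒ (Gᵢ i) e))
  ; E-cover = λ e → E-cover (plus-E⇒ G e)
  ; e-edge = λ i → ⇒plus-E (Gᵢ i) (inj₂ (inj₁ (refl , refl)))
  }
  where
  open XYSum s
  Gᵢ : Bool → TGraph
  Gᵢ true = G₁
  Gᵢ false = G₂
  terminal : (G : TGraph) → Bool → Fin (V G)
  terminal G true = x G
  terminal G false = y G
  φ : ∀ i → Fin (V (Gᵢ i)) → Fin (V G)
  φ true = f₁
  φ false = f₂
  φ-t : ∀ i c → φ i (terminal (Gᵢ i) c) ≡ terminal G c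
  φ-t true true = f₁-x
  φ-t true false = f₁-y
  φ-t false true = f₂-x
  φ-t false false = f₂-y
  common : ∀ i a b → φ i a ≡ φ (not i) b → ∃[ c ] (a ≡ terminal (Gᵢ i) c × b ≡ terminal (Gᵢ (not i)) c)
  common true a b e = [ (λ h → true , h) , (λ h → false , h) ]′ (meets e)
  common false a b e = [ (λ { (p , q) → true , q , p }) , (λ { (p , q) → false , q , p }) ]′ (meets (sym e))
  E-φ : ∀ i {a b} → Adj (Gᵢ i) a b ⊎ IsTerminalEdge (Gᵢ i) a b → Adj G (φ i a) (φ i b) ⊎ IsTerminalEdge G (φ i a) (φ i b)
  E-φ true (inj₁ e) = inj₁ (Adj₁ e)
  E-φ false (inj₁ e) = inj₁ (Adj₂ e)
  E-φ i (inj₂ (inj₁ (refl , refl))) = inj₂ (inj₁ (φ-t i true , φ-t i false))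
  E-φ i (inj₂ (inj₂ (refl , refl))) = inj₂ (inj₂ (φ-t i false , φ-t i true))
  E-cover : ∀ {u v} → Adj G u v ⊎ IsTerminalEdge G u v →
    ∃[ i ] ∃[ a ] ∃[ b ] (φ i a ≡ u × φ i b ≡ v × E (plus (Gᵢ i)) a b ≡ true)
  E-cover (inj₁ e) with Adj⇒ e
  ... | inj₁ (a , a′ , p , q , r) = true , a , a′ , p , q , ⇒plus-E G₁ (inj₁ r)
  ... | inj₂ (a , a′ , p , q , r) = false , a , a′ , p , q , ⇒plus-E G₂ (inj₁ r)
  E-cover (inj₂ (inj₁ (refl , refl))) = true , x G₁ , y G₁ , f₁-x , f₁-y , ⇒plus-E G₁ (inj₂ (inj₁ (refl , refl)))
  E-cover (inj₂ (inj₂ (refl , refl))) = true , y G₁ , x G₁ , f₁-y , f₁-x , ⇒plus-E G₁ (inj₂ (inj₂ (refl , refl)))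

module _ {G G₁ G₂ : TGraph} (s : XYSum G G₁ G₂) where

  opaque
    sum-embeds : ∀ a b → EmbedsIn (plus G₁) a → EmbedsIn (plus G₂) b → EmbedsIn (plus G) (a + b)
    sum-embeds a b p q = Additivity.embeds-sum (amalgam s) (λ { true → a ; false → b }) (λ { true → p ; false → q })

    split-embeds : ∀ k → EmbedsIn (plus G) k → ∃[ a ] ∃[ b ] (EmbedsIn (plus G₁) a × EmbedsIn (plus G₂) b × a + b ≤ k)
    split-embeds k p = repack (Additivity.embeds-split (amalgam s) {k} p)
      where
      repack : Σ (Bool → ℕ) (λ kᵢ → (∀ i → EmbedsIn (Amalgam.Kᵢ (amalgam s) i) (kᵢ i)) × kᵢ true + kᵢ false ≤ k) →
        ∃[ a ] ∃[ b ] (EmbedsIn (plus G₁) a × EmbedsIn (plus G₂) b × a + b ≤ k)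
      repack (kᵢ , em , le) = kᵢ true , kᵢ false , em true , em false , le

  genus-sum : ∀ a b → EulerGenusPlus G₁ a → EulerGenusPlus G₂ b → EulerGenusPlus G (a + b)
  genus-sum a b (p , pmin) (q , qmin) = sum-embeds a b p q , λ j e → go j (split-embeds j e)
    where
    go : ∀ j → ∃[ a ] ∃[ b ] (EmbedsIn (plus G₁) a × EmbedsIn (plus G₂) b × a + b ≤ j) → a + b ≤ j
    go j (a′ , b′ , p′ , q′ , le) = ℕ.≤-trans (ℕ.+-mono-≤ (pmin a′ p′) (qmin b′ q′)) le

  -- The embeddings obtained from a minimal one of G⁺ are minimal themselves: a better one of a
  -- summand, glued to that of the other, would beat `k`. So the genera of the summands are found
  -- without a search.
  genus-split : ∀ k → EulerGenusPlus G k → ∃[ a ] ∃[ b ] (EulerGenusPlus G₁ a × EulerGenusPlus G₂ b × a + b ≡ k)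
  genus-split k (p , pmin) = go (split-embeds k p)
    where
    go : ∃[ a ] ∃[ b ] (EmbedsIn (plus G₁) a × EmbedsIn (plus G₂) b × a + b ≤ k) →
      ∃[ a ] ∃[ b ] (EulerGenusPlus G₁ a × EulerGenusPlus G₂ b × a + b ≡ k)
    go (a , b , pa , pb , le) = a , b ,
      (pa , λ j e → ℕ.+-cancelʳ-≤ b a j (ℕ.≤-trans le (pmin (j + b) (sum-embeds j b e pb)))) ,
      (pb , λ j e → ℕ.+-cancelˡ-≤ a b j (ℕ.≤-trans le (pmin (a + j) (sum-embeds a j pa e)))) ,
      ℕ.≤-antisym le (pmin (a + b) (sum-embeds a b pa pb))

-- Uniqueness and existence of the genus

genus-unique : ∀ Γ a b → EulerGenus Γ a → EulerGenus Γ b → a ≡ b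
genus-unique Γ a b (p , pmin) (q , qmin) = ℕ.≤-antisym (pmin b q) (qmin a p)

-- Embeddability is not decided here, so a least `k` is obtained only under a double negation; this
-- suffices for `critical-genus>0`, whose conclusion is negative.
¬¬genus : ∀ Γ k → EmbedsIn Γ k → ¬ ¬ (∃[ g ] EulerGenus Γ g)
¬¬genus Γ k em none = <-rec (λ k → ¬ EmbedsIn Γ k)
  (λ k ih em → none (k , em , λ j e → ℕ.≮⇒≥ (λ j<k → ih j<k e))) k em

cyclic-suc : ∀ {k} → Fin k → Fin k
cyclic-suc {suc k} i with toℕ i ℕ.<? k
... | yes p = suc (fromℕ< p)
... | no _ = zero

cyclic-suc-injective : ∀ {k} {i j : Fin k} → cyclic-suc i ≡ cyclic-suc j → i ≡ j
cyclic-suc-injective {suc k} {i} {j} e with toℕ i ℕ.<? k | toℕ j ℕ.<? k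
... | yes p | yes q = Fin.toℕ-injective (trans (sym (Fin.toℕ-fromℕ< p)) (trans (cong toℕ (Fin.suc-injective e)) (Fin.toℕ-fromℕ< q)))
... | no ¬p | no ¬q = Fin.toℕ-injective (trans (last i ¬p) (sym (last j ¬q)))
  where
  last : ∀ i → ¬ (toℕ i < k) → toℕ i ≡ k
  last i ¬p = ℕ.≤-antisym (ℕ.≤-pred (Fin.toℕ<n i)) (ℕ.≮⇒≥ ¬p)

cyclic-suc-toℕ : ∀ {k} (i : Fin (suc k)) → toℕ i < k → toℕ (cyclic-suc i) ≡ suc (toℕ i)
cyclic-suc-toℕ {k} i p with toℕ i ℕ.<? k
... | yes q = cong suc (Fin.toℕ-fromℕ< q)
... | no ¬q = ⊥-elim (¬q p)

cyclic-suc-orbit : ∀ {k} (i j : Fin k) → ∃[ m ] iter cyclic-suc m i ≡ j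
cyclic-suc-orbit {suc k} i j = iter-closure Fin↔Fin cyclic-suc-injective (cl-sym (from-zero i) ◅◅ from-zero j)
  where
  reach : ∀ m → m ≤ k → toℕ (iter cyclic-suc m (zero {k})) ≡ m
  reach zero _ = refl
  reach (suc m) lt = trans (cyclic-suc-toℕ _ (subst (_< k) (sym ih) lt)) (cong suc ih)
    where ih = reach m (ℕ.≤-trans (ℕ.n≤1+n m) lt)
  along : ∀ m (i : Fin (suc k)) → EqClosure (gr cyclic-suc) i (iter cyclic-suc m i)
  along zero i = ε
  along (suc m) i = along m i ◅◅ Eq.return refl
  from-zero : ∀ (j : Fin (suc k)) → EqClosure (gr cyclic-suc) (zero {k}) j
  from-zero j = along (toℕ j) zero ◅◅ cl-refl (Fin.toℕ-injective (reach (toℕ j) (ℕ.≤-pred (Fin.toℕ<n j))))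

-- Any cyclic order on each neighbourhood will do, and the left-hand side of Euler's inequality
-- serves as a crude bound on the genus.
some-embedding : ∀ Γ → ∃[ k ] EmbedsIn Γ k
some-embedding Γ = 2 * numComps Γ + numEdges Γ , rot , isRot , (λ _ _ → true) ,
  ℕ.≤-trans (ℕ.m≤m+n _ (n Γ)) (ℕ.m≤m+n _ _)
  where
  next : ∀ v → Sub (E Γ v) → Sub (E Γ v)
  next v s = Inverse.from (Sub-Fin (E Γ v)) (cyclic-suc (Inverse.to (Sub-Fin (E Γ v)) s))
  rot-at : ∀ v u b → E Γ v u ≡ b → Fin (n Γ)
  rot-at v u true e = proj₁ (next v (u , e))
  rot-at v u false e = u
  rot : Fin (n Γ) → Fin (n Γ) → Fin (n Γ)
  rot v u = rot-at v u (E Γ v u) refl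
  rot-next : ∀ v u (e : E Γ v u ≡ true) → rot v u ≡ proj₁ (next v (u , e))
  rot-next v u e = go (E Γ v u) refl
    where
    go : ∀ b (q : E Γ v u ≡ b) → rot-at v u b q ≡ proj₁ (next v (u , e))
    go true q = cong (λ e → proj₁ (next v (u , e))) (uip q e)
    go false q = true≢false e q
  iter-next : ∀ v s i → proj₁ (iter (next v) i s) ≡ iter (rot v) i (proj₁ s)
  iter-next v s zero = refl
  iter-next v s (suc i) = trans (sym (rot-next v _ (proj₂ (iter (next v) i s)))) (cong (rot v) (iter-next v s i))
  iter-to : ∀ v s i → Inverse.to (Sub-Fin (E Γ v)) (iter (next v) i s) ≡ iter cyclic-suc i (Inverse.to (Sub-Fin (E Γ v)) s)
  iter-to v s zero = refl
  iter-to v s (suc i) = trans (to-from (Sub-Fin (E Γ v)) _) (cong cyclic-suc (iter-to v s i))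
  isRot : IsRotation Γ rot
  isRot v = (λ u e → subst (λ w → E Γ v w ≡ true) (sym (rot-next v u e)) (proj₂ (next v (u , e)))) , around
    where
    around : ∀ u w → E Γ v u ≡ true → E Γ v w ≡ true → ∃[ i ] iter (rot v) i u ≡ w
    around u w eu ew with cyclic-suc-orbit (Inverse.to (Sub-Fin (E Γ v)) (u , eu)) (Inverse.to (Sub-Fin (E Γ v)) (w , ew))
    ... | i , q = i , trans (sym (iter-next v (u , eu) i)) (cong proj₁ (to-injective (Sub-Fin (E Γ v))
      (trans (iter-to v (u , eu) i) q)))

-- Minor operations

Pair : {A : Set} → A → A → A → A → Set
Pair u v a b = (a ≡ u × b ≡ v) ⊎ (a ≡ v × b ≡ u)

-- The common form of the two minor operations: φ identifies the pairs in Ker,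
-- and the remaining edges are those in Rem.
record Quotient (G H : TGraph) (Ker Rem : Fin (V G) → Fin (V G) → Set) : Set where
  field
    φ     : Fin (V G) → Fin (V H)
    surj  : ∀ w → ∃[ a ] φ a ≡ w
    φ-x   : φ (x G) ≡ x H
    φ-y   : φ (y G) ≡ y H
    ker⇒  : ∀ {a b} → φ a ≡ φ b → a ≡ b ⊎ Ker a b
    ⇒ker  : ∀ {a b} → Ker a b → φ a ≡ φ b
    adj⇒  : ∀ {u v} → Adj H u v → ∃[ a ] ∃[ b ] (φ a ≡ u × φ b ≡ v × Rem a b)
    ⇒adj  : ∀ {a b} → φ a ≢ φ b → Rem a b → Adj H (φ a) (φ b)

NoKer : {A : Set} → A → A → Set
NoKer _ _ = ⊥

Kept : (G : TGraph) → Fin (V G) → Fin (V G) → Fin (V G) → Fin (V G) → Set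
Kept G u v a b = Adj G a b × ¬ Pair u v a b

delete⇒ : ∀ {G H u v} → DeleteEdge G H u v → Adj G u v × Quotient G H NoKer (Kept G u v)
delete⇒ {G} {H} (e , φ , inj , surj , px , py , ad) = e , record
  { φ = φ ; surj = λ w → proj₁ (surj w) , proj₂ (surj w) refl ; φ-x = px ; φ-y = py
  ; ker⇒ = λ p → inj₁ (inj p) ; ⇒ker = λ () ; adj⇒ = adj⇒
  ; ⇒adj = λ {a} {b} _ r → Equivalence.from (ad a b) r }
  where
  adj⇒ : ∀ {u v} → Adj H u v → ∃[ a ] ∃[ b ] (φ a ≡ u × φ b ≡ v × _)
  adj⇒ {u} {v} r with surj u | surj v
  ... | a , p | b , q = a , b , p refl , q refl , Equivalence.to (ad a b)
    (subst₂ (Adj H) (sym (p refl)) (sym (q refl)) r)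

⇒delete : ∀ {G H u v} → Adj G u v → Quotient G H NoKer (Kept G u v) → DeleteEdge G H u v
⇒delete {G} {H} {u} {v} e Q = e , φ , inj , (λ w → proj₁ (surj w) , λ { refl → proj₂ (surj w) }) , φ-x , φ-y ,
    λ a b → mk⇔ (λ r → back a b (adj⇒ r)) (λ r → ⇒adj (λ p → E-≢ (graph G) (proj₁ r) (inj p)) r)
  where
  open Quotient Q
  inj : ∀ {a b} → φ a ≡ φ b → a ≡ b
  inj p with ker⇒ p
  ... | inj₁ q = q
  back : ∀ a b → ∃[ a′ ] ∃[ b′ ] (φ a′ ≡ φ a × φ b′ ≡ φ b × Kept G u v a′ b′) → Kept G u v a b
  back a b (a′ , b′ , p , q , r) = subst₂ (Kept G u v) (inj p) (inj q) r

contract⇒ : ∀ {G H u v} → ContractEdge G H u v → Adj G u v × Quotient G H (Pair u v) (Adj G)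
contract⇒ {G} {H} (e , _ , φ , surj , px , py , ker , ad) = e , record
  { φ = φ ; surj = λ w → proj₁ (surj w) , proj₂ (surj w) refl ; φ-x = px ; φ-y = py
  ; ker⇒ = λ {a} {b} → Equivalence.to (ker a b) ; ⇒ker = λ {a} {b} k → Equivalence.from (ker a b) (inj₂ k)
  ; adj⇒ = λ {u} {v} r → proj₂ (Equivalence.to (ad u v) r)
  ; ⇒adj = λ {a} {b} ne r → Equivalence.from (ad (φ a) (φ b)) (ne , a , b , refl , refl , r) }

⇒contract : ∀ {G H u v} → Adj G u v → ¬ IsTerminalEdge G u v → Quotient G H (Pair u v) (Adj G) → ContractEdge G H u v
⇒contract {G} {H} {u} {v} e nt Q = e , nt , φ , (λ w → proj₁ (surj w) , λ { refl → proj₂ (surj w) }) , φ-x , φ-y ,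
    (λ a b → mk⇔ ker⇒ (λ { (inj₁ refl) → refl ; (inj₂ k) → ⇒ker k })) ,
    (λ a′ b′ → mk⇔ (λ r → E-≢ (graph H) r , adj⇒ r) (λ { (ne , a , b , refl , refl , r) → ⇒adj ne r }))
  where open Quotient Q

Terminal : (G : TGraph) → Fin (V G) → Set
Terminal G a = a ≡ x G ⊎ a ≡ y G

-- An operation on the summand G₁ together with its effect on the sum.
record Transfer {G G₁ G₂ : TGraph} (s : XYSum G G₁ G₂) (Ker Rem : Fin (V G) → Fin (V G) → Set)
  (Ker₁ Rem₁ : Fin (V G₁) → Fin (V G₁) → Set) : Set where
  open XYSum s
  field
    ker⇒    : ∀ {u v} → Ker u v → ∃[ a ] ∃[ b ] (f₁ a ≡ u × f₁ b ≡ v × Ker₁ a b)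
    ⇒ker    : ∀ {a b} → Ker₁ a b → Ker (f₁ a) (f₁ b)
    ker-sym : ∀ {u v} → Ker u v → Ker v u
    rem⇒    : ∀ {u v} → Rem u v → (∃[ a ] ∃[ b ] (f₁ a ≡ u × f₁ b ≡ v × Rem₁ a b)) ⊎
                (∃[ a ] ∃[ b ] (f₂ a ≡ u × f₂ b ≡ v × Adj G₂ a b))
    ⇒rem₁   : ∀ {a b} → Rem₁ a b → Rem (f₁ a) (f₁ b)
    ⇒rem₂   : ∀ {a b} → Adj G₂ a b → Rem (f₂ a) (f₂ b)
    ker-t   : ∀ {a b} → Ker₁ a b → Terminal G₁ a → Terminal G₁ b → ⊥
    rem-sym : ∀ {a b} → Rem₁ a b → Rem₁ b a
    rem?    : ∀ a b → Dec (Rem₁ a b)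

exists₂ : ∀ {m k} {P : Fin m → Fin k → Set} → (∀ a b → Dec (P a b)) → Dec (∃[ a ] ∃[ b ] P a b)
exists₂ P? = Fin.any? (λ a → Fin.any? (P? a))

relGraph : ∀ {m} {R : Fin m → Fin m → Set} → (∀ a b → Dec (R a b)) → Graph
relGraph {m} R? = record { n = m ; adj = λ a b → does (R? a b) }

relGraph-E : ∀ {m} {R : Fin m → Fin m → Set} (R? : ∀ a b → Dec (R a b)) → (∀ {a b} → R a b → R b a) →
  ∀ {a b} → E (relGraph R?) a b ≡ true → R a b
relGraph-E R? R-sym {a} {b} e with E-adj (relGraph R?) e
... | inj₁ p = true⇒ (R? a b) p
... | inj₂ p = R-sym (true⇒ (R? b a) p)

relGraph-intro : ∀ {m} {R : Fin m → Fin m → Set} (R? : ∀ a b → Dec (R a b)) →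
  ∀ {a b} → a ≢ b → R a b → E (relGraph R?) a b ≡ true
relGraph-intro R? {a} {b} ne r = E-intro (relGraph R?) ne (inj₁ (dec-true (R? a b) r))

module _ {G G₁ G₂ : TGraph} (s : XYSum G G₁ G₂) {Ker Rem : Fin (V G) → Fin (V G) → Set}
  {Ker₁ Rem₁ : Fin (V G₁) → Fin (V G₁) → Set} (T : Transfer s Ker Rem Ker₁ Rem₁) where
  open XYSum s
  open Transfer T

  terminal₁ : ∀ {a b} → f₁ a ≡ f₂ b → Terminal G₁ a
  terminal₁ e with meets e
  ... | inj₁ (p , _) = inj₁ p
  ... | inj₂ (p , _) = inj₂ p

  -- The new summand lives on the image of `G₁` in `H`. The image of `G₂` is a faithful copy: two of
  -- its vertices identified by the operation would both be terminals, which `ker-t` forbids.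
  restrict-quotient : ∀ {H} → Quotient G H Ker Rem → ∃[ H₁ ] (Quotient G₁ H₁ Ker₁ Rem₁ × XYSum H H₁ G₂)
  restrict-quotient {H} Q = H₁ , quot , sum
    where
    module Q = Quotient Q
    image? : ∀ w → Dec (∃[ a ] Q.φ (f₁ a) ≡ w)
    image? w = Fin.any? (λ a → Q.φ (f₁ a) ≟ w)
    k : ℕ
    k = proj₁ (Sub-finite Fin↔Fin (λ w → does (image? w)))
    I : Sub (λ w → does (image? w)) ↔ Fin k
    I = proj₂ (Sub-finite Fin↔Fin (λ w → does (image? w)))
    h₁ : Fin k → Fin (V H)
    h₁ i = proj₁ (Inverse.from I i)
    h₁-inj : ∀ {i j} → h₁ i ≡ h₁ j → i ≡ j
    h₁-inj e = from-injective I (Sub-≡ e)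
    φ₁ : Fin (V G₁) → Fin k
    φ₁ a = Inverse.to I (Q.φ (f₁ a) , dec-true (image? (Q.φ (f₁ a))) (a , refl))
    h-φ : ∀ a → h₁ (φ₁ a) ≡ Q.φ (f₁ a)
    h-φ a = cong proj₁ (from-to I _)
    φ₁-surj : ∀ i → ∃[ a ] φ₁ a ≡ i
    φ₁-surj i with true⇒ (image? (h₁ i)) (proj₂ (Inverse.from I i))
    ... | a , e = a , h₁-inj (trans (h-φ a) e)
    φ₁⇒ : ∀ {a b} → φ₁ a ≡ φ₁ b → Q.φ (f₁ a) ≡ Q.φ (f₁ b)
    φ₁⇒ {a} {b} e = trans (sym (h-φ a)) (trans (cong h₁ e) (h-φ b))
    ⇒φ₁ : ∀ {a b} → Q.φ (f₁ a) ≡ Q.φ (f₁ b) → φ₁ a ≡ φ₁ b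
    ⇒φ₁ {a} {b} e = h₁-inj (trans (h-φ a) (trans e (sym (h-φ b))))
    ker₁⇒ : ∀ {a b} → φ₁ a ≡ φ₁ b → a ≡ b ⊎ Ker₁ a b
    ker₁⇒ e with Q.ker⇒ (φ₁⇒ e)
    ... | inj₁ p = inj₁ (f₁-inj p)
    ... | inj₂ k with ker⇒ k
    ...   | a′ , b′ , p , q , k′ with refl ← f₁-inj p with refl ← f₁-inj q = inj₂ k′
    R : Fin k → Fin k → Set
    R i j = ∃[ a ] ∃[ b ] (φ₁ a ≡ i × φ₁ b ≡ j × Rem₁ a b)
    R? : ∀ i j → Dec (R i j)
    R? i j = exists₂ (λ a b → (φ₁ a ≟ i) ×-dec ((φ₁ b ≟ j) ×-dec rem? a b))
    R-sym : ∀ {i j} → R i j → R j i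
    R-sym (a , b , p , q , r) = b , a , q , p , rem-sym r
    H₁ : TGraph
    H₁ = record { graph = relGraph R? ; x = φ₁ (x G₁) ; y = φ₁ (y G₁)
                ; x≢y = λ e → x≢y H (trans (sym xH) (trans (φ₁⇒ e) yH)) }
      where
      xH : Q.φ (f₁ (x G₁)) ≡ x H
      xH = trans (cong Q.φ f₁-x) Q.φ-x
      yH : Q.φ (f₁ (y G₁)) ≡ y H
      yH = trans (cong Q.φ f₁-y) Q.φ-y
    quot : Quotient G₁ H₁ Ker₁ Rem₁
    quot = record
      { φ = φ₁ ; surj = φ₁-surj ; φ-x = refl ; φ-y = refl ; ker⇒ = ker₁⇒ ; ⇒ker = λ k → ⇒φ₁ (Q.⇒ker (⇒ker k))
      ; adj⇒ = relGraph-E R? R-sym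
      ; ⇒adj = λ {a} {b} ne r → relGraph-intro R? ne (a , b , refl , refl , r) }
    f₂′-inj : ∀ {a b} → Q.φ (f₂ a) ≡ Q.φ (f₂ b) → a ≡ b
    f₂′-inj e with Q.ker⇒ e
    ... | inj₁ p = f₂-inj p
    ... | inj₂ k with ker⇒ k
    ...   | _ , _ , p , q , k′ = ⊥-elim (ker-t k′ (terminal₁ p) (terminal₁ q))
    cov : ∀ w → (∃[ i ] h₁ i ≡ w) ⊎ (∃[ b ] Q.φ (f₂ b) ≡ w)
    cov w with Q.surj w
    ... | v , refl with covers v
    ...   | inj₁ (a , refl) = inj₁ (φ₁ a , h-φ a)
    ...   | inj₂ (b , refl) = inj₂ (b , refl)
    mt : ∀ {i b} → h₁ i ≡ Q.φ (f₂ b) → (i ≡ φ₁ (x G₁) × b ≡ x G₂) ⊎ (i ≡ φ₁ (y G₁) × b ≡ y G₂)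
    mt {i} {b} e with φ₁-surj i
    ... | a , refl with Q.ker⇒ (trans (sym (h-φ a)) e)
    ...   | inj₁ p with meets p
    ...     | inj₁ (refl , q) = inj₁ (refl , q)
    ...     | inj₂ (refl , q) = inj₂ (refl , q)
    mt {i} {b} e | a , refl | inj₂ k with ker⇒ k
    ...     | a′ , b′ , p , q , k′ with refl ← f₁-inj p with meets q
    ...       | inj₁ (refl , r) = inj₁ (⇒φ₁ (Q.⇒ker (⇒ker k′)) , r)
    ...       | inj₂ (refl , r) = inj₂ (⇒φ₁ (Q.⇒ker (⇒ker k′)) , r)
    ad⇒ : ∀ {u v} → Adj H u v → (∃[ a ] ∃[ a′ ] (h₁ a ≡ u × h₁ a′ ≡ v × Adj H₁ a a′)) ⊎
      (∃[ b ] ∃[ b′ ] (Q.φ (f₂ b) ≡ u × Q.φ (f₂ b′) ≡ v × Adj G₂ b b′))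
    ad⇒ {u} {v} e with Q.adj⇒ e
    ... | a , b , p , q , r with rem⇒ r
    ...   | inj₁ (a₁ , b₁ , refl , refl , r₁) = inj₁ (φ₁ a₁ , φ₁ b₁ , trans (h-φ a₁) p , trans (h-φ b₁) q ,
              relGraph-intro R? (λ eq → E-≢ (graph H) e (trans (sym p) (trans (φ₁⇒ eq) q))) (a₁ , b₁ , refl , refl , r₁))
    ...   | inj₂ (a₂ , b₂ , refl , refl , r₂) = inj₂ (a₂ , b₂ , p , q , r₂)
    ad₁ : ∀ {i j} → Adj H₁ i j → Adj H (h₁ i) (h₁ j)
    ad₁ {i} {j} e with relGraph-E R? R-sym e
    ... | a , b , refl , refl , r = subst₂ (Adj H) (sym (h-φ a)) (sym (h-φ b))
      (Q.⇒adj (λ eq → E-≢ (graph H₁) e (⇒φ₁ eq)) (⇒rem₁ r))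
    sum : XYSum H H₁ G₂
    sum = record
      { f₁ = h₁ ; f₂ = Q.φ ∘ f₂ ; f₁-inj = h₁-inj ; f₂-inj = f₂′-inj
      ; f₁-x = trans (h-φ (x G₁)) (trans (cong Q.φ f₁-x) Q.φ-x) ; f₁-y = trans (h-φ (y G₁)) (trans (cong Q.φ f₁-y) Q.φ-y)
      ; f₂-x = trans (cong Q.φ f₂-x) Q.φ-x ; f₂-y = trans (cong Q.φ f₂-y) Q.φ-y
      ; covers = cov ; meets = mt ; Adj⇒ = ad⇒ ; Adj₁ = ad₁
      ; Adj₂ = λ e → Q.⇒adj (λ eq → E-≢ (graph G₂) e (f₂′-inj eq)) (⇒rem₂ e) }

  -- The quotient map of `G₁` and the embedding of `G₂` agree on the terminals, so together they
  -- define a map on the sum.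
  extend-quotient : ∀ {H₁ H} → Quotient G₁ H₁ Ker₁ Rem₁ → XYSum H H₁ G₂ → Quotient G H Ker Rem
  extend-quotient {H₁} {H} Q s′ = record
    { φ = φ ; surj = surj ; φ-x = trans (cong φ (sym f₁-x)) (trans (φ-f₁ (x G₁)) (trans (cong h₁ Q.φ-x) h.f₁-x))
    ; φ-y = trans (cong φ (sym f₁-y)) (trans (φ-f₁ (y G₁)) (trans (cong h₁ Q.φ-y) h.f₁-y))
    ; ker⇒ = λ {u} {v} → kern u v (covers u) (covers v) ; ⇒ker = ⇒kern ; adj⇒ = adj⇒ ; ⇒adj = ⇒adj }
    where
    module Q = Quotient Q
    module h = XYSum s′
    h₁ = h.f₁
    h₂ = h.f₂
    φ-at : ∀ {v} → (∃[ a ] f₁ a ≡ v) ⊎ (∃[ b ] f₂ b ≡ v) → Fin (V H)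
    φ-at (inj₁ (a , _)) = h₁ (Q.φ a)
    φ-at (inj₂ (b , _)) = h₂ b
    φ : Fin (V G) → Fin (V H)
    φ v = φ-at (covers v)
    join : ∀ {a b} → f₁ a ≡ f₂ b → h₁ (Q.φ a) ≡ h₂ b
    join e with meets e
    ... | inj₁ (refl , refl) = trans (cong h₁ Q.φ-x) (trans h.f₁-x (sym h.f₂-x))
    ... | inj₂ (refl , refl) = trans (cong h₁ Q.φ-y) (trans h.f₁-y (sym h.f₂-y))
    φ-f₁ : ∀ a → φ (f₁ a) ≡ h₁ (Q.φ a)
    φ-f₁ a = go (covers (f₁ a))
      where
      go : (c : (∃[ a′ ] f₁ a′ ≡ f₁ a) ⊎ (∃[ b ] f₂ b ≡ f₁ a)) → φ-at c ≡ h₁ (Q.φ a)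
      go (inj₁ (a′ , e)) = cong (h₁ ∘ Q.φ) (f₁-inj e)
      go (inj₂ (b , e)) = sym (join (sym e))
    φ-f₂ : ∀ b → φ (f₂ b) ≡ h₂ b
    φ-f₂ b = go (covers (f₂ b))
      where
      go : (c : (∃[ a′ ] f₁ a′ ≡ f₂ b) ⊎ (∃[ b′ ] f₂ b′ ≡ f₂ b)) → φ-at c ≡ h₂ b
      go (inj₁ (a′ , e)) = join e
      go (inj₂ (b′ , e)) = cong h₂ (f₂-inj e)
    surj : ∀ w → ∃[ v ] φ v ≡ w
    surj w with h.covers w
    ... | inj₂ (b , e) = f₂ b , trans (φ-f₂ b) e
    ... | inj₁ (i , e) with Q.surj i
    ...   | a , refl = f₁ a , trans (φ-f₁ a) e
    -- The two sides meet only in a terminal of `H`; the vertex of `G₁` is then that terminal or was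
    -- contracted into it.
    mixed : ∀ {a b} → h₁ (Q.φ a) ≡ h₂ b → f₁ a ≡ f₂ b ⊎ Ker (f₁ a) (f₂ b)
    mixed {a} {b} e with h.meets e
    ... | inj₁ (p , refl) with Q.ker⇒ (trans p (sym Q.φ-x))
    ...   | inj₁ refl = inj₁ (trans f₁-x (sym f₂-x))
    ...   | inj₂ k = inj₂ (subst (Ker (f₁ a)) (trans f₁-x (sym f₂-x)) (⇒ker k))
    mixed {a} {b} e | inj₂ (p , refl) with Q.ker⇒ (trans p (sym Q.φ-y))
    ...   | inj₁ refl = inj₁ (trans f₁-y (sym f₂-y))
    ...   | inj₂ k = inj₂ (subst (Ker (f₁ a)) (trans f₁-y (sym f₂-y)) (⇒ker k))
    kern : ∀ u v → (∃[ a ] f₁ a ≡ u) ⊎ (∃[ b ] f₂ b ≡ u) → (∃[ a ] f₁ a ≡ v) ⊎ (∃[ b ] f₂ b ≡ v) → φ u ≡ φ v → u ≡ v ⊎ Ker u v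
    kern _ _ (inj₁ (a , refl)) (inj₁ (b , refl)) e with Q.ker⇒ (h.f₁-inj (trans (sym (φ-f₁ a)) (trans e (φ-f₁ b))))
    ... | inj₁ refl = inj₁ refl
    ... | inj₂ k = inj₂ (⇒ker k)
    kern _ _ (inj₁ (a , refl)) (inj₂ (b , refl)) e = mixed (trans (sym (φ-f₁ a)) (trans e (φ-f₂ b)))
    kern _ _ (inj₂ (b , refl)) (inj₁ (a , refl)) e with mixed (trans (sym (φ-f₁ a)) (trans (sym e) (φ-f₂ b)))
    ... | inj₁ p = inj₁ (sym p)
    ... | inj₂ k = inj₂ (ker-sym k)
    kern _ _ (inj₂ (b , refl)) (inj₂ (b′ , refl)) e = inj₁ (cong f₂ (h.f₂-inj (trans (sym (φ-f₂ b)) (trans e (φ-f₂ b′)))))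
    ⇒kern : ∀ {u v} → Ker u v → φ u ≡ φ v
    ⇒kern k with ker⇒ k
    ... | a , b , refl , refl , k₁ = trans (φ-f₁ a) (trans (cong h₁ (Q.⇒ker k₁)) (sym (φ-f₁ b)))
    adj⇒ : ∀ {u v} → Adj H u v → ∃[ a ] ∃[ b ] (φ a ≡ u × φ b ≡ v × Rem a b)
    adj⇒ e with h.Adj⇒ e
    ... | inj₂ (b , b′ , p , q , r) = f₂ b , f₂ b′ , trans (φ-f₂ b) p , trans (φ-f₂ b′) q , ⇒rem₂ r
    ... | inj₁ (i , j , p , q , r) with Q.adj⇒ r
    ...   | a , b , refl , refl , r₁ = f₁ a , f₁ b , trans (φ-f₁ a) p , trans (φ-f₁ b) q , ⇒rem₁ r₁
    ⇒adj : ∀ {a b} → φ a ≢ φ b → Rem a b → Adj H (φ a) (φ b)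
    ⇒adj ne r with rem⇒ r
    ... | inj₁ (a , b , refl , refl , r₁) = subst₂ (Adj H) (sym (φ-f₁ a)) (sym (φ-f₁ b))
      (h.Adj₁ (Q.⇒adj (λ e → ne (trans (φ-f₁ a) (trans (cong h₁ e) (sym (φ-f₁ b))))) r₁))
    ... | inj₂ (a , b , refl , refl , r₂) = subst₂ (Adj H) (sym (φ-f₂ a)) (sym (φ-f₂ b)) (h.Adj₂ r₂)

xy-sum : ∀ H₁ G₂ → ∃[ H ] XYSum H H₁ G₂
xy-sum H₁ G₂ = H , record
  { f₁ = h₁ ; f₂ = h₂ ; f₁-inj = h₁-inj ; f₂-inj = λ {a} {b} → h₂-inj a b ; f₁-x = refl ; f₁-y = refl ; f₂-x = h₂-x ; f₂-y = h₂-y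
  ; covers = cov ; meets = λ {a} {b} → mt a b ; Adj⇒ = relGraph-E R? R-sym
  ; Adj₁ = λ {a} {a′} e → relGraph-intro R? (λ p → E-≢ (graph H₁) e (h₁-inj p)) (inj₁ (a , a′ , refl , refl , e))
  ; Adj₂ = λ {b} {b′} e → relGraph-intro R? (λ p → E-≢ (graph G₂) e (h₂-inj b b′ p)) (inj₂ (b , b′ , refl , refl , e)) }
  where
  inside : Fin (V G₂) → Bool
  inside b = not ((b == x G₂) ∨ (b == y G₂))
  k = proj₁ (Sub-finite Fin↔Fin inside)
  I : (Fin (V H₁) ⊎ Sub inside) ↔ Fin (V H₁ + k)
  I = ⊎-size Fin↔Fin (proj₂ (Sub-finite Fin↔Fin inside))
  h₁ : Fin (V H₁) → Fin (V H₁ + k)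
  h₁ a = Inverse.to I (inj₁ a)
  h₁-inj : ∀ {a b} → h₁ a ≡ h₁ b → a ≡ b
  h₁-inj e = Sum.inj₁-injective (to-injective I e)
  data Place (b : Fin (V G₂)) : Set where
    at-x : b ≡ x G₂ → Place b
    at-y : b ≡ y G₂ → Place b
    in-G₂ : inside b ≡ true → Place b
  place : ∀ b → Place b
  place b = go (b ≟ x G₂) (b ≟ y G₂)
    where
    go : Dec (b ≡ x G₂) → Dec (b ≡ y G₂) → Place b
    go (yes p) _ = at-x p
    go (no _) (yes p) = at-y p
    go (no p) (no q) = in-G₂ (cong not (cong₂ _∨_ (==-false p) (==-false q)))
  put : ∀ {b} → Place b → Fin (V H₁) ⊎ Sub inside
  put (at-x _) = inj₁ (x H₁)
  put (at-y _) = inj₁ (y H₁)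
  put {b} (in-G₂ p) = inj₂ (b , p)
  h₂ : Fin (V G₂) → Fin (V H₁ + k)
  h₂ b = Inverse.to I (put (place b))
  x-out : inside (x G₂) ≡ true → ⊥
  x-out p = true≢false (∨-true₁ {b = x G₂ == y G₂} (==-true {u = x G₂} refl)) (not-true p)
  y-out : inside (y G₂) ≡ true → ⊥
  y-out p = true≢false (∨-true₂ {y G₂ == x G₂} (==-true {u = y G₂} refl)) (not-true p)
  put-inj : ∀ {a b} (p : Place a) (q : Place b) → put p ≡ put q → a ≡ b
  put-inj (at-x refl) (at-x refl) e = refl
  put-inj (at-x refl) (at-y refl) e = ⊥-elim (x≢y H₁ (Sum.inj₁-injective e))
  put-inj (at-y refl) (at-x refl) e = ⊥-elim (x≢y H₁ (sym (Sum.inj₁-injective e)))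
  put-inj (at-y refl) (at-y refl) e = refl
  put-inj (in-G₂ _) (in-G₂ _) e = cong proj₁ (Sum.inj₂-injective e)
  h₂-inj : ∀ a b → h₂ a ≡ h₂ b → a ≡ b
  h₂-inj a b e = put-inj (place a) (place b) (to-injective I e)
  h₂-x : h₂ (x G₂) ≡ h₁ (x H₁)
  h₂-x = cong (Inverse.to I) (go (place (x G₂)))
    where
    go : (p : Place (x G₂)) → put p ≡ inj₁ (x H₁)
    go (at-x _) = refl
    go (at-y e) = ⊥-elim (x≢y G₂ e)
    go (in-G₂ p) = ⊥-elim (x-out p)
  h₂-y : h₂ (y G₂) ≡ h₁ (y H₁)
  h₂-y = cong (Inverse.to I) (go (place (y G₂)))
    where
    go : (p : Place (y G₂)) → put p ≡ inj₁ (y H₁)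
    go (at-x e) = ⊥-elim (x≢y G₂ (sym e))
    go (at-y _) = refl
    go (in-G₂ p) = ⊥-elim (y-out p)
  cov : ∀ w → (∃[ a ] h₁ a ≡ w) ⊎ (∃[ b ] h₂ b ≡ w)
  cov w = go (Inverse.from I w) (to-from I w)
    where
    go : ∀ s → Inverse.to I s ≡ w → (∃[ a ] h₁ a ≡ w) ⊎ (∃[ b ] h₂ b ≡ w)
    go (inj₁ a) e = inj₁ (a , e)
    go (inj₂ (b , i)) e = inj₂ (b , trans (cong (Inverse.to I) (at (place b))) e)
      where
      at : (p : Place b) → put p ≡ inj₂ (b , i)
      at (at-x refl) = ⊥-elim (x-out i)
      at (at-y refl) = ⊥-elim (y-out i)
      at (in-G₂ _) = cong inj₂ (Sub-≡ refl)
  mt : ∀ a b → h₁ a ≡ h₂ b → (a ≡ x H₁ × b ≡ x G₂) ⊎ (a ≡ y H₁ × b ≡ y G₂)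
  mt a b e = go (place b) (to-injective I e)
    where
    go : (p : Place b) → inj₁ a ≡ put p → (a ≡ x H₁ × b ≡ x G₂) ⊎ (a ≡ y H₁ × b ≡ y G₂)
    go (at-x p) q = inj₁ (Sum.inj₁-injective q , p)
    go (at-y p) q = inj₂ (Sum.inj₁-injective q , p)
    go (in-G₂ _) ()
  R : Fin (V H₁ + k) → Fin (V H₁ + k) → Set
  R u v = (∃[ a ] ∃[ a′ ] (h₁ a ≡ u × h₁ a′ ≡ v × Adj H₁ a a′)) ⊎ (∃[ b ] ∃[ b′ ] (h₂ b ≡ u × h₂ b′ ≡ v × Adj G₂ b b′))
  R? : ∀ u v → Dec (R u v)
  R? u v = exists₂ (λ a a′ → (h₁ a ≟ u) ×-dec ((h₁ a′ ≟ v) ×-dec (E (graph H₁) a a′ Bool.≟ true))) ⊎-dec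
    exists₂ (λ b b′ → (h₂ b ≟ u) ×-dec ((h₂ b′ ≟ v) ×-dec (E (graph G₂) b b′ Bool.≟ true)))
  R-sym : ∀ {u v} → R u v → R v u
  R-sym (inj₁ (a , b , p , q , e)) = inj₁ (b , a , q , p , Adj-sym H₁ e)
  R-sym (inj₂ (a , b , p , q , e)) = inj₂ (b , a , q , p , Adj-sym G₂ e)
  H : TGraph
  H = record { graph = relGraph R? ; x = h₁ (x H₁) ; y = h₁ (y H₁) ; x≢y = λ e → x≢y H₁ (h₁-inj e) }

module _ {G G₁ G₂ : TGraph} (s : XYSum G G₁ G₂) (na : NonAdjTerminals G₁) {a₀ b₀ : Fin (V G₁)} (e₀ : Adj G₁ a₀ b₀) where
  open XYSum s

  private
    not-terminals : ∀ {a b} → Adj G₁ a b → Terminal G₁ a → Terminal G₁ b → ⊥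
    not-terminals e (inj₁ refl) (inj₁ refl) = E-≢ (graph G₁) e refl
    not-terminals e (inj₁ refl) (inj₂ refl) = na e
    not-terminals e (inj₂ refl) (inj₁ refl) = na (Adj-sym G₁ e)
    not-terminals e (inj₂ refl) (inj₂ refl) = E-≢ (graph G₁) e refl

    common-terminal : ∀ {a b} → f₂ b ≡ f₁ a → Terminal G₁ a
    common-terminal e with meets (sym e)
    ... | inj₁ (p , _) = inj₁ p
    ... | inj₂ (p , _) = inj₂ p

    pair? : ∀ a b → Dec (Pair a₀ b₀ a b)
    pair? a b = ((a ≟ a₀) ×-dec (b ≟ b₀)) ⊎-dec ((a ≟ b₀) ×-dec (b ≟ a₀))

    pair-sym : ∀ {A : Set} {u v a b : A} → Pair u v a b → Pair u v b a
    pair-sym (inj₁ (p , q)) = inj₂ (q , p)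
    pair-sym (inj₂ (p , q)) = inj₁ (q , p)

    pair-f : ∀ {a b} → Pair (f₁ a₀) (f₁ b₀) (f₁ a) (f₁ b) → Pair a₀ b₀ a b
    pair-f (inj₁ (p , q)) = inj₁ (f₁-inj p , f₁-inj q)
    pair-f (inj₂ (p , q)) = inj₂ (f₁-inj p , f₁-inj q)

    f-pair : ∀ {a b} → Pair a₀ b₀ a b → Pair (f₁ a₀) (f₁ b₀) (f₁ a) (f₁ b)
    f-pair (inj₁ (p , q)) = inj₁ (cong f₁ p , cong f₁ q)
    f-pair (inj₂ (p , q)) = inj₂ (cong f₁ p , cong f₁ q)

    -- If the ends of the chosen edge also came from `G₂`, they would both be terminals, but the
    -- terminals are not adjacent in `G₁`.
    no-pair₂ : ∀ {a b} → Pair (f₁ a₀) (f₁ b₀) (f₂ a) (f₂ b) → ⊥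
    no-pair₂ (inj₁ (p , q)) = not-terminals e₀ (common-terminal p) (common-terminal q)
    no-pair₂ (inj₂ (p , q)) = not-terminals e₀ (common-terminal q) (common-terminal p)

  delete-transfer : Transfer s NoKer (Kept G (f₁ a₀) (f₁ b₀)) NoKer (Kept G₁ a₀ b₀)
  delete-transfer = record
    { ker⇒ = λ () ; ⇒ker = λ () ; ker-sym = λ () ; rem⇒ = rem⇒
    ; ⇒rem₁ = λ { (e , np) → Adj₁ e , λ p → np (pair-f p) }
    ; ⇒rem₂ = λ e → Adj₂ e , no-pair₂
    ; ker-t = λ () ; rem-sym = λ { (e , np) → Adj-sym G₁ e , λ p → np (pair-sym p) }
    ; rem? = λ a b → (E (graph G₁) a b Bool.≟ true) ×-dec ¬? (pair? a b) }
    where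
    rem⇒ : ∀ {u v} → Kept G (f₁ a₀) (f₁ b₀) u v → (∃[ a ] ∃[ b ] (f₁ a ≡ u × f₁ b ≡ v × Kept G₁ a₀ b₀ a b)) ⊎
      (∃[ a ] ∃[ b ] (f₂ a ≡ u × f₂ b ≡ v × Adj G₂ a b))
    rem⇒ (e , np) with Adj⇒ e
    ... | inj₁ (a , b , refl , refl , r) = inj₁ (a , b , refl , refl , r , λ p → np (f-pair p))
    ... | inj₂ h = inj₂ h

  contract-transfer : Transfer s (Pair (f₁ a₀) (f₁ b₀)) (Adj G) (Pair a₀ b₀) (Adj G₁)
  contract-transfer = record
    { ker⇒ = λ { (inj₁ (p , q)) → a₀ , b₀ , sym p , sym q , inj₁ (refl , refl)
               ; (inj₂ (p , q)) → b₀ , a₀ , sym p , sym q , inj₂ (refl , refl) }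
    ; ⇒ker = f-pair ; ker-sym = pair-sym ; rem⇒ = Adj⇒ ; ⇒rem₁ = Adj₁ ; ⇒rem₂ = Adj₂
    ; ker-t = λ { (inj₁ (refl , refl)) p q → not-terminals e₀ p q ; (inj₂ (refl , refl)) p q → not-terminals e₀ q p }
    ; rem-sym = Adj-sym G₁ ; rem? = λ a b → E (graph G₁) a b Bool.≟ true }

  not-terminal-edge : ¬ IsTerminalEdge G₁ a₀ b₀
  not-terminal-edge (inj₁ (p , q)) = not-terminals e₀ (inj₁ p) (inj₂ q)
  not-terminal-edge (inj₂ (p , q)) = not-terminals e₀ (inj₂ p) (inj₁ q)

  not-terminal-edge-G : ¬ IsTerminalEdge G (f₁ a₀) (f₁ b₀)
  not-terminal-edge-G (inj₁ (p , q)) = not-terminal-edge (inj₁ (f₁-inj (trans p (sym f₁-x)) , f₁-inj (trans q (sym f₁-y))))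
  not-terminal-edge-G (inj₂ (p , q)) = not-terminal-edge (inj₂ (f₁-inj (trans p (sym f₁-y)) , f₁-inj (trans q (sym f₁-x))))

  restrict-op : ∀ {H} → DeleteEdge G H (f₁ a₀) (f₁ b₀) ⊎ ContractEdge G H (f₁ a₀) (f₁ b₀) →
    ∃[ H₁ ] (MinorOp G₁ H₁ × XYSum H H₁ G₂)
  restrict-op (inj₁ d) with restrict-quotient s delete-transfer (proj₂ (delete⇒ d))
  ... | H₁ , Q , s′ = H₁ , (a₀ , b₀ , inj₁ (⇒delete e₀ Q)) , s′
  restrict-op (inj₂ c) with restrict-quotient s contract-transfer (proj₂ (contract⇒ c))
  ... | H₁ , Q , s′ = H₁ , (a₀ , b₀ , inj₂ (⇒contract e₀ not-terminal-edge Q)) , s′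

  extend-op : ∀ {H₁} → DeleteEdge G₁ H₁ a₀ b₀ ⊎ ContractEdge G₁ H₁ a₀ b₀ → ∃[ H ] (MinorOp G H × XYSum H H₁ G₂)
  extend-op {H₁} op = H , (f₁ a₀ , f₁ b₀ , lift op) , s′
    where
    H = proj₁ (xy-sum H₁ G₂)
    s′ = proj₂ (xy-sum H₁ G₂)
    lift : DeleteEdge G₁ H₁ a₀ b₀ ⊎ ContractEdge G₁ H₁ a₀ b₀ → DeleteEdge G H (f₁ a₀) (f₁ b₀) ⊎ ContractEdge G H (f₁ a₀) (f₁ b₀)
    lift (inj₁ d) = inj₁ (⇒delete (Adj₁ e₀) (extend-quotient s delete-transfer (proj₂ (delete⇒ d)) s′))
    lift (inj₂ c) = inj₂ (⇒contract (Adj₁ e₀) not-terminal-edge-G (extend-quotient s contract-transfer (proj₂ (contract⇒ c)) s′))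

minor-edge : ∀ {G H u v} → DeleteEdge G H u v ⊎ ContractEdge G H u v → Adj G u v
minor-edge (inj₁ d) = proj₁ d
minor-edge (inj₂ c) = proj₁ c

minor-of-sum : ∀ {G G₁ G₂ H} → XYSum G G₁ G₂ → NonAdjTerminals G₁ → NonAdjTerminals G₂ → MinorOp G H →
  (∃[ H₁ ] (MinorOp G₁ H₁ × XYSum H H₁ G₂)) ⊎ (∃[ H₂ ] (MinorOp G₂ H₂ × XYSum H H₂ G₁))
minor-of-sum {G} {G₁} {G₂} {H} s na₁ na₂ (u , v , op) with XYSum.Adj⇒ s (minor-edge {G} {H} op)
... | inj₁ (a , b , refl , refl , e) = inj₁ (restrict-op s na₁ e op)
... | inj₂ (a , b , refl , refl , e) = inj₂ (restrict-op (XYSum-sym s) na₂ e op)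

minor-of-summand : ∀ {G G₁ G₂ H₁} → XYSum G G₁ G₂ → NonAdjTerminals G₁ → MinorOp G₁ H₁ →
  ∃[ H ] (MinorOp G H × XYSum H H₁ G₂)
minor-of-summand {G} {G₁} {G₂} {H₁} s na (a , b , op) = extend-op s na (minor-edge {G₁} {H₁} op) op

delete-edge : ∀ G {u v} → Adj G u v → ∃[ H ] MinorOp G H
delete-edge G {u} {v} e = H , u , v , inj₁ (⇒delete {G} {H} e (record
  { φ = id ; surj = λ w → w , refl ; φ-x = refl ; φ-y = refl ; ker⇒ = inj₁ ; ⇒ker = λ ()
  ; adj⇒ = λ {a} {b} r → a , b , refl , refl , relGraph-E R? R-sym r
  ; ⇒adj = λ ne r → relGraph-intro R? ne r }))
  where
  R? : ∀ a b → Dec (Kept G u v a b)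
  R? a b = (E (graph G) a b Bool.≟ true) ×-dec ¬? (((a ≟ u) ×-dec (b ≟ v)) ⊎-dec ((a ≟ v) ×-dec (b ≟ u)))
  R-sym : ∀ {a b} → Kept G u v a b → Kept G u v b a
  R-sym (e , np) = Adj-sym G e , λ { (inj₁ (p , q)) → np (inj₂ (q , p)) ; (inj₂ (p , q)) → np (inj₁ (q , p)) }
  H : TGraph
  H = record { graph = relGraph R? ; x = x G ; y = y G ; x≢y = x≢y G }

-- Splitting at a 2-vertex-cut

cl⇒star : {A : Set} {R : Rel A 0ℓ} → (∀ {a b} → R a b → R b a) → ∀ {a b} → EqClosure R a b → Star R a b
cl⇒star R-sym ε = ε
cl⇒star R-sym (fwd r ◅ rs) = r ◅ cl⇒star R-sym rs
cl⇒star R-sym (bwd r ◅ rs) = R-sym r ◅ cl⇒star R-sym rs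

cl-adj⇒connected : ∀ G → (∀ a b → EqClosure (Adj G) a b) → Connected G
cl-adj⇒connected G h a b _ _ = go (cl⇒star (λ {a} {b} → Adj-sym G {a} {b}) (h a b))
  where
  go : ∀ {a b} → Star (Adj G) a b → Star (λ a b → Adj G a b × false ≡ false × false ≡ false) a b
  go ε = ε
  go (e ◅ r) = (e , refl , refl) ◅ go r

module Induced (G : TGraph) (P : Fin (V G) → Bool) (Px : P (x G) ≡ true) (Py : P (y G) ≡ true) where
  size : ℕ
  size = proj₁ (Sub-finite Fin↔Fin P)
  I : Sub P ↔ Fin size
  I = proj₂ (Sub-finite Fin↔Fin P)
  f : Fin size → Fin (V G)
  f i = proj₁ (Inverse.from I i)
  f-inj : ∀ {i j} → f i ≡ f j → i ≡ j
  f-inj e = from-injective I (Sub-≡ e)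
  f-P : ∀ i → P (f i) ≡ true
  f-P i = proj₂ (Inverse.from I i)
  idx : ∀ w → P w ≡ true → Fin size
  idx w p = Inverse.to I (w , p)
  f-idx : ∀ w p → f (idx w p) ≡ w
  f-idx w p = cong proj₁ (from-to I (w , p))
  R? : ∀ i j → Dec (Adj G (f i) (f j))
  R? i j = E (graph G) (f i) (f j) Bool.≟ true
  H : TGraph
  H = record { graph = relGraph R? ; x = idx (x G) Px ; y = idx (y G) Py
             ; x≢y = λ e → x≢y G (trans (sym (f-idx _ Px)) (trans (cong f e) (f-idx _ Py))) }
  Adj⇒ : ∀ {i j} → Adj H i j → Adj G (f i) (f j)
  Adj⇒ = relGraph-E R? (Adj-sym G)
  ⇒Adj : ∀ {i j} → Adj G (f i) (f j) → Adj H i j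
  ⇒Adj e = relGraph-intro R? (λ p → E-≢ (graph G) e (cong f p)) e
  adj-idx : ∀ {u v} p q → Adj G u v → Adj H (idx u p) (idx v q)
  adj-idx p q e = ⇒Adj (subst₂ (Adj G) (sym (f-idx _ p)) (sym (f-idx _ q)) e)

-- The edges are recorded because the positivity of a summand's genus is derived from deleting one.
record Decomposition (G : TGraph) : Set where
  field
    G₁ G₂      : TGraph
    sum        : XYSum G G₁ G₂
    connected₁ : Connected G₁
    connected₂ : Connected G₂
    nonAdj₁    : NonAdjTerminals G₁
    nonAdj₂    : NonAdjTerminals G₂
    edge₁      : ∃[ a ] ∃[ b ] Adj G₁ a b
    edge₂      : ∃[ a ] ∃[ b ] Adj G₂ a b

module Decompose (G : TGraph) (two : TwoConnected G) (na : NonAdjTerminals G) (cut : TerminalsCut G) where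

  private
    S : Fin (V G) → Bool
    S a = (a == x G) ∨ (a == y G)

    Inside : Rel (Fin (V G)) 0ℓ
    Inside a b = Adj G a b × S a ≡ false × S b ≡ false

    Inside-sym : ∀ {a b} → Inside a b → Inside b a
    Inside-sym (e , p , q) = Adj-sym G e , q , p

    C : ∃[ k ] Classes Inside k
    C = classes Fin↔Fin (λ a b → (E (graph G) a b Bool.≟ true) ×-dec ((S a Bool.≟ false) ×-dec (S b Bool.≟ false)))

    Separating : Fin (V G) → Fin (V G) → Set
    Separating u v = S u ≡ false × S v ≡ false × ¬ EqClosure Inside u v

    separating : ∃[ u ] ∃[ v ] Separating u v
    separating with exists₂ {P = Separating} (λ u v → (S u Bool.≟ false) ×-dec ((S v Bool.≟ false) ×-dec ¬? (related? (proj₂ C) u v)))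
    ... | yes w = w
    ... | no none = ⊥-elim (cut λ u v p q → cl⇒star Inside-sym (rel u v p q (related? (proj₂ C) u v)))
      where
      rel : ∀ u v → S u ≡ false → S v ≡ false → Dec (EqClosure Inside u v) → EqClosure Inside u v
      rel u v p q (yes r) = r
      rel u v p q (no ¬r) = ⊥-elim (none (u , v , p , q , ¬r))

    u₀ : Fin (V G)
    u₀ = proj₁ separating
    near? : ∀ w → Dec (EqClosure Inside u₀ w)
    near? w = related? (proj₂ C) u₀ w

    -- The first side is the component of `u₀` in `G` without its terminals, the second all other
    -- components; both receive the terminals.
    P₁ P₂ : Fin (V G) → Bool
    P₁ w = S w ∨ does (near? w)
    P₂ w = S w ∨ not (does (near? w))

    S-x : S (x G) ≡ true
    S-x = ∨-true₁ (==-true {u = x G} refl)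
    S-y : S (y G) ≡ true
    S-y = ∨-true₂ {y G == x G} (==-true {u = y G} refl)
    S⇒ : ∀ w → S w ≡ true → w ≡ x G ⊎ w ≡ y G
    S⇒ w p with ∨-true {w == x G} p
    ... | inj₁ q = inj₁ (true-== q)
    ... | inj₂ q = inj₂ (true-== q)

    near-step : ∀ {a b} → Inside a b → does (near? a) ≡ does (near? b)
    near-step {a} {b} i = bool-≡ (λ p → dec-true (near? b) (true⇒ (near? a) p ◅◅ Eq.return i))
      (λ p → dec-true (near? a) (true⇒ (near? b) p ◅◅ cl-sym (Eq.return i)))

    module Side (P : Fin (V G) → Bool) (P-S : ∀ {w} → S w ≡ true → P w ≡ true)
      (P-step : ∀ {a b} → Inside a b → P a ≡ true → P b ≡ true)
      (w₀ : Fin (V G)) (w₀-out : S w₀ ≡ false) (w₀-P : P w₀ ≡ true) where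
      open Induced G P (P-S S-x) (P-S S-y) public

      -- Follow a path avoiding the other terminal up to its first visit to the terminal τ.
      walk : ∀ {τ τ′} → S τ ≡ true → (∀ w → S w ≡ true → w ≡ τ ⊎ w ≡ τ′) → (Pτ : P τ ≡ true) →
        ∀ {c} → Star (λ a b → Adj G a b × (a == τ′) ≡ false × (b == τ′) ≡ false) c τ →
        S c ≡ false → (Pc : P c ≡ true) → EqClosure (Adj H) (idx c Pc) (idx τ Pτ)
      walk Sτ or Pτ ε Sc Pc = true≢false Sτ Sc
      walk {τ} {τ′} Sτ or Pτ {c} (_◅_ {j = d} (e , _ , d≢) r) Sc Pc = go (S d) refl
        where
        go : ∀ b → S d ≡ b → EqClosure (Adj H) (idx c Pc) (idx τ Pτ)
        go false Sd = Eq.return (adj-idx Pc Pd e) ◅◅ walk Sτ or Pτ r Sd Pd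
          where
          Pd : P d ≡ true
          Pd = P-step (e , Sc , Sd) Pc
        go true Sd with or d Sd
        ... | inj₂ refl = true≢false (==-true {u = τ′} refl) d≢
        ... | inj₁ refl = Eq.return (adj-idx Pc Pτ e)

      out⇒ : ∀ c → S c ≡ false → (c == x G) ≡ false × (c == y G) ≡ false
      out⇒ c Sc = go (c == x G) (c == y G) Sc
        where
        go : ∀ a b → a ∨ b ≡ false → a ≡ false × b ≡ false
        go false false _ = refl , refl

      -- 2-connectedness provides a path from `c` to `x` that avoids `y`; until it reaches `x` it
      -- cannot leave the side of `c`.
      to-x : ∀ c → S c ≡ false → (Pc : P c ≡ true) → EqClosure (Adj H) (idx c Pc) (x H)
      to-x c Sc Pc = walk S-x S⇒ (P-S S-x)
        (proj₂ two (y G) c (x G) (proj₂ (out⇒ c Sc)) (==-false (x≢y G))) Sc Pc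

      to-y : ∀ c → S c ≡ false → (Pc : P c ≡ true) → EqClosure (Adj H) (idx c Pc) (y H)
      to-y c Sc Pc = walk S-y (λ w p → [ inj₂ , inj₁ ]′ (S⇒ w p)) (P-S S-y)
        (proj₂ two (x G) c (y G) (proj₁ (out⇒ c Sc)) (==-false (λ e → x≢y G (sym e)))) Sc Pc

      all-to-x : ∀ i → EqClosure (Adj H) i (x H)
      all-to-x i = go (S (f i)) refl
        where
        go : ∀ b → S (f i) ≡ b → EqClosure (Adj H) i (x H)
        go false Si = cl-refl (f-inj (sym (f-idx (f i) (f-P i)))) ◅◅ to-x (f i) Si (f-P i)
        go true Si with S⇒ (f i) Si
        ... | inj₁ e = cl-refl (f-inj (trans e (sym (f-idx _ (P-S S-x)))))
        -- The terminals are not adjacent; `y` reaches `x` through the inner vertex `w₀` of this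
        -- side.
        ... | inj₂ e = cl-refl (f-inj (trans e (sym (f-idx _ (P-S S-y))))) ◅◅ cl-sym (to-y w₀ w₀-out w₀-P) ◅◅ to-x w₀ w₀-out w₀-P

      connected : Connected H
      connected = cl-adj⇒connected H (λ a b → all-to-x a ◅◅ cl-sym (all-to-x b))

      nonAdj : NonAdjTerminals H
      nonAdj e = na (subst₂ (Adj G) (f-idx _ (P-S S-x)) (f-idx _ (P-S S-y)) (Adj⇒ e))

      some-edge : ∃[ a ] ∃[ b ] Adj H a b
      some-edge = go (cl⇒star (λ {a} {b} → Adj-sym H {a} {b}) (to-x w₀ w₀-out w₀-P))
        where
        go : Star (Adj H) (idx w₀ w₀-P) (x H) → ∃[ a ] ∃[ b ] Adj H a b
        go r = first r refl refl
          where
          first : ∀ {a b} → Star (Adj H) a b → a ≡ idx w₀ w₀-P → b ≡ x H → ∃[ a ] ∃[ b ] Adj H a b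
          first ε p q = true≢false (trans (cong S (trans (sym (f-idx w₀ w₀-P)) (trans (cong f (trans (sym p) q)) (f-idx _ (P-S S-x))))) S-x) w₀-out
          first (e ◅ _) _ _ = _ , _ , e

    v₀ : Fin (V G)
    v₀ = proj₁ (proj₂ separating)

    step₁ : ∀ {a b} → Inside a b → P₁ a ≡ true → P₁ b ≡ true
    step₁ {a} {b} i@(_ , Sa , Sb) p = ∨-true₂ {S b} (trans (sym (near-step i)) (trans (cong (_∨ does (near? a)) (sym Sa)) p))

    step₂ : ∀ {a b} → Inside a b → P₂ a ≡ true → P₂ b ≡ true
    step₂ {a} {b} i@(_ , Sa , Sb) p =
      ∨-true₂ {S b} (trans (cong not (sym (near-step i))) (trans (cong (_∨ not (does (near? a))) (sym Sa)) p))

    P₁-u₀ : P₁ u₀ ≡ true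
    P₁-u₀ = ∨-true₂ {S u₀} (dec-true (near? u₀) ε)

    P₂-v₀ : P₂ v₀ ≡ true
    P₂-v₀ = ∨-true₂ {S v₀} (cong not (dec-false (near? v₀) (proj₂ (proj₂ (proj₂ (proj₂ separating))))))

    module S₁ = Side P₁ ∨-true₁ step₁ u₀ (proj₁ (proj₂ (proj₂ separating))) P₁-u₀
    module S₂ = Side P₂ ∨-true₁ step₂ v₀ (proj₁ (proj₂ (proj₂ (proj₂ separating)))) P₂-v₀

  G₁ G₂ : TGraph
  G₁ = S₁.H
  G₂ = S₂.H

  sum : XYSum G G₁ G₂
  sum = record
    { f₁ = S₁.f ; f₂ = S₂.f ; f₁-inj = S₁.f-inj ; f₂-inj = S₂.f-inj
    ; f₁-x = S₁.f-idx (x G) (∨-true₁ S-x) ; f₁-y = S₁.f-idx (y G) (∨-true₁ S-y)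
    ; f₂-x = S₂.f-idx (x G) (∨-true₁ S-x) ; f₂-y = S₂.f-idx (y G) (∨-true₁ S-y)
    ; covers = covers ; meets = λ {a} {b} → meets a b
    ; Adj⇒ = λ {u} {v} → Adj-split u v
    ; Adj₁ = S₁.Adj⇒ ; Adj₂ = S₂.Adj⇒ }
    where
    P-either : ∀ w → P₁ w ≡ true ⊎ P₂ w ≡ true
    P-either w = go (S w) (does (near? w)) refl refl
      where
      go : ∀ s b → S w ≡ s → does (near? w) ≡ b → P₁ w ≡ true ⊎ P₂ w ≡ true
      go _ true _ q = inj₁ (∨-true₂ {S w} q)
      go _ false _ q = inj₂ (∨-true₂ {S w} (cong not q))
    covers : ∀ w → (∃[ a ] S₁.f a ≡ w) ⊎ (∃[ b ] S₂.f b ≡ w)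
    covers w = [ (λ p → inj₁ (S₁.idx w p , S₁.f-idx w p)) , (λ p → inj₂ (S₂.idx w p , S₂.f-idx w p)) ]′ (P-either w)
    P-both : ∀ {w} → P₁ w ≡ true → P₂ w ≡ true → w ≡ x G ⊎ w ≡ y G
    P-both {w} p q with ∨-true {S w} p | ∨-true {S w} q
    ... | inj₁ s | _ = S⇒ w s
    ... | inj₂ _ | inj₁ s = S⇒ w s
    ... | inj₂ r | inj₂ r′ = true≢false r (not-true r′)
    meets : ∀ a b → S₁.f a ≡ S₂.f b → (a ≡ x G₁ × b ≡ x G₂) ⊎ (a ≡ y G₁ × b ≡ y G₂)
    meets a b e = go (P-both (S₁.f-P a) (subst (λ w → P₂ w ≡ true) (sym e) (S₂.f-P b)))
      where
      at : ∀ τ (p₁ : P₁ τ ≡ true) (p₂ : P₂ τ ≡ true) → S₁.f a ≡ τ → a ≡ S₁.idx τ p₁ × b ≡ S₂.idx τ p₂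
      at τ p₁ p₂ p = S₁.f-inj (trans p (sym (S₁.f-idx τ p₁))) , S₂.f-inj (trans (trans (sym e) p) (sym (S₂.f-idx τ p₂)))
      go : S₁.f a ≡ x G ⊎ S₁.f a ≡ y G → (a ≡ x G₁ × b ≡ x G₂) ⊎ (a ≡ y G₁ × b ≡ y G₂)
      go (inj₁ p) = inj₁ (at (x G) (∨-true₁ S-x) (∨-true₁ S-x) p)
      go (inj₂ p) = inj₂ (at (y G) (∨-true₁ S-y) (∨-true₁ S-y) p)
    same-side : ∀ u v → Adj G u v → (P₁ u ≡ true × P₁ v ≡ true) ⊎ (P₂ u ≡ true × P₂ v ≡ true)
    same-side u v e = go (S u) (S v) refl refl
      where
      go : ∀ s t → S u ≡ s → S v ≡ t → (P₁ u ≡ true × P₁ v ≡ true) ⊎ (P₂ u ≡ true × P₂ v ≡ true)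
      go true false p _ = [ (λ q → inj₁ (∨-true₁ p , q)) , (λ q → inj₂ (∨-true₁ p , q)) ]′ (P-either v)
      go false true _ p = [ (λ q → inj₁ (q , ∨-true₁ p)) , (λ q → inj₂ (q , ∨-true₁ p)) ]′ (P-either u)
      go true true p q with S⇒ u p | S⇒ v q
      ... | inj₁ refl | inj₁ refl = ⊥-elim (E-≢ (graph G) e refl)
      ... | inj₁ refl | inj₂ refl = ⊥-elim (na e)
      ... | inj₂ refl | inj₁ refl = ⊥-elim (na (Adj-sym G e))
      ... | inj₂ refl | inj₂ refl = ⊥-elim (E-≢ (graph G) e refl)
      go false false p q = pick (does (near? u)) refl
        where
        eq = near-step (e , p , q)
        pick : ∀ b → does (near? u) ≡ b → (P₁ u ≡ true × P₁ v ≡ true) ⊎ (P₂ u ≡ true × P₂ v ≡ true)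
        pick true r = inj₁ (∨-true₂ {S u} r , ∨-true₂ {S v} (trans (sym eq) r))
        pick false r = inj₂ (∨-true₂ {S u} (cong not r) , ∨-true₂ {S v} (cong not (trans (sym eq) r)))
    Adj-split : ∀ u v → Adj G u v → (∃[ a ] ∃[ a′ ] (S₁.f a ≡ u × S₁.f a′ ≡ v × Adj G₁ a a′)) ⊎
      (∃[ b ] ∃[ b′ ] (S₂.f b ≡ u × S₂.f b′ ≡ v × Adj G₂ b b′))
    Adj-split u v e = go (same-side u v e)
      where
      go : (P₁ u ≡ true × P₁ v ≡ true) ⊎ (P₂ u ≡ true × P₂ v ≡ true) → (∃[ a ] ∃[ a′ ] (S₁.f a ≡ u × S₁.f a′ ≡ v × Adj G₁ a a′)) ⊎
        (∃[ b ] ∃[ b′ ] (S₂.f b ≡ u × S₂.f b′ ≡ v × Adj G₂ b b′))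
      go (inj₁ (p , q)) = inj₁ (S₁.idx u p , S₁.idx v q , S₁.f-idx u p , S₁.f-idx v q , S₁.adj-idx p q e)
      go (inj₂ (p , q)) = inj₂ (S₂.idx u p , S₂.idx v q , S₂.f-idx u p , S₂.f-idx v q , S₂.adj-idx p q e)

  decomposition : Decomposition G
  decomposition = record
    { G₁ = G₁ ; G₂ = G₂ ; sum = sum ; connected₁ = S₁.connected ; connected₂ = S₂.connected
    ; nonAdj₁ = S₁.nonAdj ; nonAdj₂ = S₂.nonAdj ; edge₁ = S₁.some-edge ; edge₂ = S₂.some-edge }

-- Critical graphs

-- An operation on the sum changes one summand only, lowering its genus; additivity carries the drop
-- over to the sum.
sum-critical : ∀ {G G₁ G₂} a b → XYSum G G₁ G₂ → NonAdjTerminals G₁ → NonAdjTerminals G₂ →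
  Critical G₁ → Critical G₂ → EulerGenusPlus G₁ a → EulerGenusPlus G₂ b → Critical G
sum-critical {G} {G₁} {G₂} a b s na₁ na₂ c₁ c₂ g₁ g₂ H op h k gH gG =
  subst (h <_) (sym (genus-unique (plus G) k (a + b) gG (genus-sum s a b g₁ g₂))) (go (minor-of-sum s na₁ na₂ op))
  where
  in₁ : ∀ {H₁} → MinorOp G₁ H₁ → ∃[ a′ ] ∃[ b′ ] (EulerGenusPlus H₁ a′ × EulerGenusPlus G₂ b′ × a′ + b′ ≡ h) → h < a + b
  in₁ {H₁} op₁ (a′ , b′ , ga , gb , e) = subst (_< a + b) e
    (ℕ.+-mono-<-≤ (c₁ H₁ op₁ a′ a ga g₁) (ℕ.≤-reflexive (genus-unique (plus G₂) b′ b gb g₂)))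
  in₂ : ∀ {H₂} → MinorOp G₂ H₂ → ∃[ b′ ] ∃[ a′ ] (EulerGenusPlus H₂ b′ × EulerGenusPlus G₁ a′ × b′ + a′ ≡ h) → h < a + b
  in₂ {H₂} op₂ (b′ , a′ , gb , ga , e) = subst (_< a + b) (trans (ℕ.+-comm a′ b′) e)
    (ℕ.+-mono-≤-< (ℕ.≤-reflexive (genus-unique (plus G₁) a′ a ga g₁)) (c₂ H₂ op₂ b′ b gb g₂))
  go : (∃[ H₁ ] (MinorOp G₁ H₁ × XYSum H H₁ G₂)) ⊎ (∃[ H₂ ] (MinorOp G₂ H₂ × XYSum H H₂ G₁)) → h < a + b
  go (inj₁ (H₁ , op₁ , s′)) = in₁ {H₁} op₁ (genus-split s′ h gH)
  go (inj₂ (H₂ , op₂ , s′)) = in₂ {H₂} op₂ (genus-split s′ h gH)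

-- The operation is performed inside the sum, and the genus of the other summand is cancelled.
summand-critical : ∀ {G G₁ G₂} b → XYSum G G₁ G₂ → NonAdjTerminals G₁ → Critical G → EulerGenusPlus G₂ b → Critical G₁
summand-critical {G} {G₁} {G₂} b s na c g₂ H₁ op h a gH g₁ = go (minor-of-summand s na op)
  where
  go : ∃[ H ] (MinorOp G H × XYSum H H₁ G₂) → h < a
  go (H , opG , s′) = ℕ.+-cancelʳ-< b h a (c H opG (h + b) (a + b) (genus-sum s′ h b gH g₂) (genus-sum s a b g₁ g₂))

sum-nonAdj : ∀ {G G₁ G₂} → XYSum G G₁ G₂ → NonAdjTerminals G₁ → NonAdjTerminals G₂ → NonAdjTerminals G
sum-nonAdj {G} {G₁} {G₂} s na₁ na₂ e = go (Adj⇒ e)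
  where
  open XYSum s
  go : (∃[ a ] ∃[ a′ ] (f₁ a ≡ x G × f₁ a′ ≡ y G × Adj G₁ a a′)) ⊎
    (∃[ b ] ∃[ b′ ] (f₂ b ≡ x G × f₂ b′ ≡ y G × Adj G₂ b b′)) → ⊥
  go (inj₁ (a , a′ , p , q , r)) = na₁ (subst₂ (Adj G₁) (f₁-inj (trans p (sym f₁-x))) (f₁-inj (trans q (sym f₁-y))) r)
  go (inj₂ (b , b′ , p , q , r)) = na₂ (subst₂ (Adj G₂) (f₂-inj (trans p (sym f₂-x))) (f₂-inj (trans q (sym f₂-y))) r)

-- Deleting an edge of a critical graph decreases its genus, which is therefore positive.
critical-genus>0 : ∀ G g → Critical G → (∃[ u ] ∃[ v ] Adj G u v) → EulerGenusPlus G g → g ≢ 0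
critical-genus>0 G g c (_ , _ , e) gG refl = ¬¬genus (plus H) (proj₁ em) (proj₂ em) (λ { (h , gH) → ℕ.n≮0 (c H op h 0 gH gG) })
  where
  H : TGraph
  H = proj₁ (delete-edge G e)
  op : MinorOp G H
  op = proj₂ (delete-edge G e)
  em : ∃[ k ] EmbedsIn (plus H) k
  em = some-embedding (plus H)

splits-of-3 : ∀ a b → a + b ≡ 3 → a ≢ 0 → b ≢ 0 → (a ≡ 1 × b ≡ 2) ⊎ (a ≡ 2 × b ≡ 1)
splits-of-3 zero b e a≢0 b≢0 = ⊥-elim (a≢0 refl)
splits-of-3 (suc zero) b e a≢0 b≢0 = inj₁ (refl , ℕ.suc-injective e)
splits-of-3 (suc (suc zero)) b e a≢0 b≢0 = inj₂ (refl , ℕ.suc-injective (ℕ.suc-injective e))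
splits-of-3 (suc (suc (suc a))) zero e a≢0 b≢0 = ⊥-elim (b≢0 refl)
splits-of-3 (suc (suc (suc a))) (suc b) e a≢0 b≢0
  with () ← trans (sym (ℕ.+-suc a b)) (ℕ.suc-injective (ℕ.suc-injective (ℕ.suc-injective e)))

theorem5p9 : (∀ (G G₁ G₂ : TGraph) → IsXYSum G G₁ G₂ →
    Connected G₁ → Connected G₂ → NonAdjTerminals G₁ → NonAdjTerminals G₂ →
    InC° 0 G₁ → InC° 1 G₂ → InC° 2 G)
    × (∀ (G : TGraph) → TwoConnected G → InC° 2 G → TerminalsCut G →
    ∃[ G₁ ] ∃[ G₂ ] (IsXYSum G G₁ G₂ × Connected G₁ × Connected G₂ ×
    NonAdjTerminals G₁ × NonAdjTerminals G₂ × InC° 0 G₁ × InC° 1 G₂))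
theorem5p9 = forward , converse
  where
  forward : ∀ (G G₁ G₂ : TGraph) → IsXYSum G G₁ G₂ →
    Connected G₁ → Connected G₂ → NonAdjTerminals G₁ → NonAdjTerminals G₂ → InC° 0 G₁ → InC° 1 G₂ → InC° 2 G
  forward G G₁ G₂ isSum _ _ na₁ na₂ (_ , c₁ , g₁) (_ , c₂ , g₂) =
    sum-nonAdj s na₁ na₂ , sum-critical 1 2 s na₁ na₂ c₁ c₂ g₁ g₂ , genus-sum s 1 2 g₁ g₂
    where
    s : XYSum G G₁ G₂
    s = fromXYSum isSum

  converse : ∀ (G : TGraph) → TwoConnected G → InC° 2 G → TerminalsCut G →
    ∃[ G₁ ] ∃[ G₂ ] (IsXYSum G G₁ G₂ × Connected G₁ × Connected G₂ ×
    NonAdjTerminals G₁ × NonAdjTerminals G₂ × InC° 0 G₁ × InC° 1 G₂)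
  converse G two (na , c , g) cut = from (Decompose.decomposition G two na cut)
    where
    from : Decomposition G → ∃[ G₁ ] ∃[ G₂ ] (IsXYSum G G₁ G₂ × Connected G₁ × Connected G₂ ×
      NonAdjTerminals G₁ × NonAdjTerminals G₂ × InC° 0 G₁ × InC° 1 G₂)
    from D = go (genus-split sum 3 g)
      where
      open Decomposition D
      go : ∃[ a ] ∃[ b ] (EulerGenusPlus G₁ a × EulerGenusPlus G₂ b × a + b ≡ 3) →
        ∃[ G₁ ] ∃[ G₂ ] (IsXYSum G G₁ G₂ × Connected G₁ × Connected G₂ ×
        NonAdjTerminals G₁ × NonAdjTerminals G₂ × InC° 0 G₁ × InC° 1 G₂)
      go (a , b , g₁ , g₂ , e) = order (splits-of-3 a b e
          (critical-genus>0 G₁ a c₁ edge₁ g₁) (critical-genus>0 G₂ b c₂ edge₂ g₂))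
        where
        c₁ : Critical G₁
        c₁ = summand-critical b sum nonAdj₁ c g₂
        c₂ : Critical G₂
        c₂ = summand-critical a (XYSum-sym sum) nonAdj₂ c g₁
        order : (a ≡ 1 × b ≡ 2) ⊎ (a ≡ 2 × b ≡ 1) →
          ∃[ G₁ ] ∃[ G₂ ] (IsXYSum G G₁ G₂ × Connected G₁ × Connected G₂ ×
          NonAdjTerminals G₁ × NonAdjTerminals G₂ × InC° 0 G₁ × InC° 1 G₂)
        order (inj₁ (refl , refl)) = G₁ , G₂ , toXYSum sum , connected₁ , connected₂ , nonAdj₁ , nonAdj₂ ,
          (nonAdj₁ , c₁ , g₁) , (nonAdj₂ , c₂ , g₂)
        -- The cut does not tell which side has genus 1, so the summands may have to change places.
        order (inj₂ (refl , refl)) = G₂ , G₁ , toXYSum (XYSum-sym sum) , connected₂ , connected₁ , nonAdj₂ , nonAdj₁ ,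
          (nonAdj₂ , c₂ , g₂) , (nonAdj₁ , c₁ , g₁)
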